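{- For integers $m,j,n\ge 0$ let $P_{m,j}(n)$ denote the number of partitions of $n$ into $m$ distinct parts, the largest of which is $j$, together with one further part size $2m+1$ that may repeat any number of times or not appear at all. Equivalently, $P_{m,j}(n)$ is the number of pairs $(\delta,k)$ where $\delta$ is a partition into exactly $m$ distinct positive parts with largest part $j$ (with $j=0$ when $m=0$), $k\ge 0$ is an integer, and $|\delta|+k(2m+1)=n$, where $|\delta|$ is the sum of the parts of $\delta$. Then, for $0<|q|<1$, $$\sum_{m,n,j\ge0}(-1)^jP_{m,j}(n)q^n= \frac{1}{2}\sum_{n\ge0}q^{n^2+n/2}(1+q^{n+1/2})\sum_{|j|\le n}q^{j^2/2}+\frac{1}{2}\sum_{n\ge0}(-1)^nq^{n^2+n/2}(1-q^{n+1/2})\sum_{|j|\le n}(-1)^jq^{j^2/2}.$$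
   Context: Here $q\in\mathbb{C}$ with $0<|q|<1$, and $q^{1/2}$ is a fixed square root of $q$ (half-integer powers of $q$ are powers of $q^{1/2}$). On the right-hand side, $\sum_{|j|\le n}$ runs over all integers $j$ with $-n\le j\le n$; this $j$ is a dummy index unrelated to the $j$ on the left-hand side. -}

module Defs where

open import Algebra.Bundles using (RawRing)
open import Data.Integer as ℤ using (ℤ; +_)
open import Data.List using (List; []; _∷_; _++_; map; foldr; filter; length; upTo; cartesianProduct)
open import Data.List.Membership.Propositional using (_∈_)
open import Data.List.Membership.Propositional.Properties
open import Data.List.Relation.Binary.Subset.Propositional using (_⊆_)
open import Data.List.Relation.Unary.All as All using (All; []; _∷_)
open import Data.List.Relation.Unary.AllPairs using (AllPairs; allPairs?; []; _∷_)
open import Data.List.Relation.Unary.Any using (here)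
open import Data.List.Relation.Unary.Unique.Propositional using (Unique)
import Data.List.Relation.Unary.Unique.Propositional.Properties as Unique
open import Data.List.Properties using (∷-injectiveʳ)
open import Data.Nat as ℕ using (ℕ; zero; suc)
open import Data.Nat.ListAction using (sum)
import Data.Nat.Properties as ℕ
open import Data.Product using (_×_; _,_; ∃; proj₁; proj₂)
open import Data.Rational as ℚ using (ℚ; 0ℚ; 1ℚ; ½)
import Data.Rational.Properties as ℚ
open import Data.Rational.Solver using (module +-*-Solver)
open import Data.Sum using (inj₁; inj₂)
open import Data.Empty using (⊥)
open import Level using (0ℓ)
open import Relation.Binary.PropositionalEquality
open import Relation.Nullary using (Dec; yes; no; contradiction)
open import Relation.Nullary.Decidable using (_×-dec_; map′)

-- Real numbers: Cauchy sequences of rationals, compared up to a null sequence.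

IsCauchy : (ℕ → ℚ) → Set
IsCauchy x = ∀ ε → 0ℚ ℚ.< ε →
  ∃ λ N → ∀ m n → N ℕ.≤ m → N ℕ.≤ n → ℚ.∣ x m ℚ.- x n ∣ ℚ.< ε

record ℝ : Set where
  constructor mkℝ
  field
    seq    : ℕ → ℚ
    cauchy : IsCauchy seq

open ℝ public

infix 4 _≈ᴿ_ _<ᴿ_

_≈ᴿ_ : ℝ → ℝ → Set
x ≈ᴿ y = ∀ ε → 0ℚ ℚ.< ε → ∃ λ N → ∀ n → N ℕ.≤ n → ℚ.∣ seq x n ℚ.- seq y n ∣ ℚ.< ε

_<ᴿ_ : ℝ → ℝ → Set
x <ᴿ y = ∃ λ ε → 0ℚ ℚ.< ε × ∃ λ N → ∀ n → N ℕ.≤ n → seq x n ℚ.+ ε ℚ.≤ seq y n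

fromℚ : ℚ → ℝ
fromℚ p = mkℝ (λ _ → p) λ ε 0<ε → 0 , λ _ _ _ _ →
  subst (ℚ._< ε) (sym (cong ℚ.∣_∣ (ℚ.+-inverseʳ p))) 0<ε

private
  open +-*-Solver using (solve; _:+_; _:*_; :-_; _:-_; _:=_; con)

  0<½* : ∀ {ε} → 0ℚ ℚ.< ε → 0ℚ ℚ.< ½ ℚ.* ε
  0<½* {ε} 0<ε = subst (ℚ._< ½ ℚ.* ε) (ℚ.*-zeroʳ ½) (ℚ.*-monoʳ-<-pos ½ 0<ε)

  ½+½ : ∀ ε → ½ ℚ.* ε ℚ.+ ½ ℚ.* ε ≡ ε
  ½+½ ε = trans (sym (ℚ.*-distribʳ-+ ε ½ ½)) (ℚ.*-identityˡ ε)

  +-cauchy : ∀ {x y} → IsCauchy x → IsCauchy y → IsCauchy (λ n → x n ℚ.+ y n)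
  +-cauchy {x} {y} cx cy ε 0<ε with cx (½ ℚ.* ε) (0<½* 0<ε) | cy (½ ℚ.* ε) (0<½* 0<ε)
  ... | M , p | N , r = M ℕ.⊔ N , λ m n m≥ n≥ → begin-strict
    ℚ.∣ x m ℚ.+ y m ℚ.- (x n ℚ.+ y n) ∣
      ≡⟨ cong ℚ.∣_∣ (solve 4 (λ a b c d → (a :+ b) :- (c :+ d) := (a :- c) :+ (b :- d)) refl
           (x m) (y m) (x n) (y n)) ⟩
    ℚ.∣ (x m ℚ.- x n) ℚ.+ (y m ℚ.- y n) ∣
      ≤⟨ ℚ.∣p+q∣≤∣p∣+∣q∣ (x m ℚ.- x n) (y m ℚ.- y n) ⟩
    ℚ.∣ x m ℚ.- x n ∣ ℚ.+ ℚ.∣ y m ℚ.- y n ∣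
      <⟨ ℚ.+-mono-< (p m n (ℕ.m⊔n≤o⇒m≤o M N m≥) (ℕ.m⊔n≤o⇒m≤o M N n≥))
                    (r m n (ℕ.m⊔n≤o⇒n≤o M N m≥) (ℕ.m⊔n≤o⇒n≤o M N n≥)) ⟩
    ½ ℚ.* ε ℚ.+ ½ ℚ.* ε
      ≡⟨ ½+½ ε ⟩
    ε ∎
    where open ℚ.≤-Reasoning

  neg-cauchy : ∀ {x} → IsCauchy x → IsCauchy (λ n → ℚ.- x n)
  neg-cauchy {x} cx ε 0<ε with cx ε 0<ε
  ... | N , p = N , λ m n m≥ n≥ → subst (ℚ._< ε)
    (trans (sym (ℚ.∣-p∣≡∣p∣ (x m ℚ.- x n)))
           (cong ℚ.∣_∣ (solve 2 (λ a b → :- (a :- b) := :- a :- :- b) refl (x m) (x n))))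
    (p m n m≥ n≥)

  bounded : ∀ {x} → IsCauchy x → ∃ λ B → 0ℚ ℚ.< B × ∃ λ N → ∀ n → N ℕ.≤ n → ℚ.∣ x n ∣ ℚ.≤ B
  bounded {x} cx with cx 1ℚ (ℚ.positive⁻¹ 1ℚ)
  ... | N , p = ℚ.∣ x N ∣ ℚ.+ 1ℚ
    , ℚ.+-mono-≤-< (ℚ.0≤∣p∣ (x N)) (ℚ.positive⁻¹ 1ℚ)
    , N , λ n n≥ → begin
      ℚ.∣ x n ∣
        ≡⟨ cong ℚ.∣_∣ (solve 2 (λ a b → a := b :+ (a :- b)) refl (x n) (x N)) ⟩
      ℚ.∣ x N ℚ.+ (x n ℚ.- x N) ∣
        ≤⟨ ℚ.∣p+q∣≤∣p∣+∣q∣ (x N) (x n ℚ.- x N) ⟩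
      ℚ.∣ x N ∣ ℚ.+ ℚ.∣ x n ℚ.- x N ∣
        ≤⟨ ℚ.+-monoʳ-≤ ℚ.∣ x N ∣ (ℚ.<⇒≤ (p n N n≥ ℕ.≤-refl)) ⟩
      ℚ.∣ x N ∣ ℚ.+ 1ℚ ∎
    where open ℚ.≤-Reasoning

  scale : ∀ {B} ε → 0ℚ ℚ.< B → 0ℚ ℚ.< ε → ∃ λ δ → 0ℚ ℚ.< δ × B ℚ.* δ ≡ ε
  scale {B} ε 0<B 0<ε = 1/B ℚ.* ε
    , subst (ℚ._< 1/B ℚ.* ε) (ℚ.*-zeroʳ 1/B) (ℚ.*-monoʳ-<-pos 1/B 0<ε)
    , trans (sym (ℚ.*-assoc B 1/B ε))
        (trans (cong (ℚ._* ε) (ℚ.*-inverseʳ B)) (ℚ.*-identityˡ ε))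
    where
    instance
      B-pos : ℚ.Positive B
      B-pos = ℚ.positive 0<B
      B-nz : ℚ.NonZero B
      B-nz = ℚ.pos⇒nonZero B
    1/B : ℚ
    1/B = ℚ.1/ B
    instance
      1/B-pos : ℚ.Positive 1/B
      1/B-pos = ℚ.1/pos⇒pos B

  ∣*∣< : ∀ B a b δ → 0ℚ ℚ.< B → ℚ.∣ a ∣ ℚ.≤ B → ℚ.∣ b ∣ ℚ.< δ → ℚ.∣ a ℚ.* b ∣ ℚ.< B ℚ.* δ
  ∣*∣< B a b δ 0<B a≤B b<δ = begin-strict
    ℚ.∣ a ℚ.* b ∣         ≡⟨ ℚ.∣p*q∣≡∣p∣*∣q∣ a b ⟩
    ℚ.∣ a ∣ ℚ.* ℚ.∣ b ∣   ≤⟨ ℚ.*-monoʳ-≤-nonNeg ℚ.∣ b ∣ a≤B ⟩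
    B ℚ.* ℚ.∣ b ∣         <⟨ ℚ.*-monoʳ-<-pos B b<δ ⟩
    B ℚ.* δ               ∎
    where
    open ℚ.≤-Reasoning
    instance
      B-pos : ℚ.Positive B
      B-pos = ℚ.positive 0<B
      b-nn : ℚ.NonNegative ℚ.∣ b ∣
      b-nn = ℚ.∣-∣-nonNeg b

  *-difference : ∀ a b c d → a ℚ.* b ℚ.- c ℚ.* d ≡ a ℚ.* (b ℚ.- d) ℚ.+ d ℚ.* (a ℚ.- c)
  *-difference = solve 4 (λ a b c d → a :* b :- c :* d := a :* (b :- d) :+ d :* (a :- c)) refl

  *-estimate : ∀ a b c d B C δ → 0ℚ ℚ.< B → 0ℚ ℚ.< C → ℚ.∣ a ∣ ℚ.≤ B → ℚ.∣ d ∣ ℚ.≤ C →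
    ℚ.∣ a ℚ.- c ∣ ℚ.< δ → ℚ.∣ b ℚ.- d ∣ ℚ.< δ →
    ℚ.∣ a ℚ.* b ℚ.- c ℚ.* d ∣ ℚ.< (B ℚ.+ C) ℚ.* δ
  *-estimate a b c d B C δ 0<B 0<C a≤B d≤C ac<δ bd<δ = begin-strict
    ℚ.∣ a ℚ.* b ℚ.- c ℚ.* d ∣
      ≡⟨ cong ℚ.∣_∣ (*-difference a b c d) ⟩
    ℚ.∣ a ℚ.* (b ℚ.- d) ℚ.+ d ℚ.* (a ℚ.- c) ∣
      ≤⟨ ℚ.∣p+q∣≤∣p∣+∣q∣ (a ℚ.* (b ℚ.- d)) (d ℚ.* (a ℚ.- c)) ⟩
    ℚ.∣ a ℚ.* (b ℚ.- d) ∣ ℚ.+ ℚ.∣ d ℚ.* (a ℚ.- c) ∣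
      <⟨ ℚ.+-mono-< (∣*∣< B a (b ℚ.- d) δ 0<B a≤B bd<δ) (∣*∣< C d (a ℚ.- c) δ 0<C d≤C ac<δ) ⟩
    B ℚ.* δ ℚ.+ C ℚ.* δ
      ≡⟨ sym (ℚ.*-distribʳ-+ δ B C) ⟩
    (B ℚ.+ C) ℚ.* δ ∎
    where open ℚ.≤-Reasoning

  *-cauchy : ∀ {x y} → IsCauchy x → IsCauchy y → IsCauchy (λ n → x n ℚ.* y n)
  *-cauchy {x} {y} cx cy ε 0<ε =
    let B , 0<B , K , xB = bounded {x} cx
        C , 0<C , L , yC = bounded {y} cy
        δ , 0<δ , eq = scale ε (ℚ.+-mono-< 0<B 0<C) 0<ε
        M , p = cx δ 0<δ
        N , r = cy δ 0<δ
    in (K ℕ.⊔ L) ℕ.⊔ (M ℕ.⊔ N) , λ m n m≥ n≥ →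
      let KL≤m = ℕ.m⊔n≤o⇒m≤o (K ℕ.⊔ L) (M ℕ.⊔ N) m≥
          KL≤n = ℕ.m⊔n≤o⇒m≤o (K ℕ.⊔ L) (M ℕ.⊔ N) n≥
          MN≤m = ℕ.m⊔n≤o⇒n≤o (K ℕ.⊔ L) (M ℕ.⊔ N) m≥
          MN≤n = ℕ.m⊔n≤o⇒n≤o (K ℕ.⊔ L) (M ℕ.⊔ N) n≥
      in subst (ℚ.∣ x m ℚ.* y m ℚ.- x n ℚ.* y n ∣ ℚ.<_) eq
        (*-estimate (x m) (y m) (x n) (y n) B C δ 0<B 0<C
          (xB m (ℕ.m⊔n≤o⇒m≤o K L KL≤m)) (yC n (ℕ.m⊔n≤o⇒n≤o K L KL≤n))
          (p m n (ℕ.m⊔n≤o⇒m≤o M N MN≤m) (ℕ.m⊔n≤o⇒m≤o M N MN≤n))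
          (r m n (ℕ.m⊔n≤o⇒n≤o M N MN≤m) (ℕ.m⊔n≤o⇒n≤o M N MN≤n)))

infixl 6 _+ᴿ_
infixl 7 _*ᴿ_
infix  8 -ᴿ_

_+ᴿ_ _*ᴿ_ : ℝ → ℝ → ℝ
x +ᴿ y = mkℝ (λ n → seq x n ℚ.+ seq y n) (+-cauchy {seq x} {seq y} (cauchy x) (cauchy y))
x *ᴿ y = mkℝ (λ n → seq x n ℚ.* seq y n) (*-cauchy {seq x} {seq y} (cauchy x) (cauchy y))

-ᴿ_ : ℝ → ℝ
-ᴿ x = mkℝ (λ n → ℚ.- seq x n) (neg-cauchy {seq x} (cauchy x))

0ᴿ 1ᴿ : ℝ
0ᴿ = fromℚ 0ℚ
1ᴿ = fromℚ 1ℚ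

record ℂ : Set where
  constructor _+i_
  field
    re im : ℝ

open ℂ public

ℂ-rawRing : RawRing 0ℓ 0ℓ
ℂ-rawRing = record
  { Carrier = ℂ
  ; _≈_ = λ z w → re z ≈ᴿ re w × im z ≈ᴿ im w
  ; _+_ = λ z w → (re z +ᴿ re w) +i (im z +ᴿ im w)
  ; _*_ = λ z w → (re z *ᴿ re w +ᴿ -ᴿ (im z *ᴿ im w)) +i (re z *ᴿ im w +ᴿ im z *ᴿ re w)
  ; -_ = λ z → (-ᴿ re z) +i (-ᴿ im z)
  ; 0# = 0ᴿ +i 0ᴿ
  ; 1# = 1ᴿ +i 0ᴿ
  }

open RawRing ℂ-rawRing public using (_≈_; _+_; _*_; -_; 0#; 1#)

-- n · z is the n-fold sum z + … + z.
open import Algebra.Definitions.RawSemiring (RawRing.rawSemiring ℂ-rawRing) public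
  using (_^_) renaming (_×_ to infixr 8 _·_)

infixl 6 _-_

_-_ : ℂ → ℂ → ℂ
z - w = z + (- w)

½ᶜ : ℂ
½ᶜ = fromℚ ½ +i 0ᴿ

-- Bounds on |z| are stated through |z|² = (re z)² + (im z)², which spares a real square root.

∣_∣² : ℂ → ℝ
∣ z ∣² = re z *ᴿ re z +ᴿ im z *ᴿ im z

infix 4 0<∣_∣ ∣_∣<_

0<∣_∣ : ℂ → Set
0<∣ z ∣ = 0ᴿ <ᴿ ∣ z ∣²

∣_∣<_ : ℂ → ℝ → Set
∣ z ∣< r = 0ᴿ <ᴿ r × ∣ z ∣² <ᴿ r *ᴿ r

Σ[_]_ : {I : Set} → List I → (I → ℂ) → ℂ
Σ[ is ] f = foldr _+_ 0# (map f is)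

-- Unconditional convergence of Σ_{i ∈ I} f i to s along the finite subsets of I
-- (duplicate-free lists), so no order of summation has to be chosen.
HasSum : {I : Set} → (I → ℂ) → ℂ → Set
HasSum {I} f s = ∀ ε → 0ℚ ℚ.< ε →
  ∃ λ (F₀ : List I) → ∀ F → Unique F → F₀ ⊆ F → ∣ Σ[ F ] f - s ∣< fromℚ ε

-- The integers -n, …, n.
symRange : ℕ → List ℤ
symRange n = map (λ i → + i ℤ.- + n) (upTo (suc (2 ℕ.* n)))

largest : List ℕ → ℕ
largest = foldr ℕ._⊔_ 0

-- δ is listed in strictly decreasing order; k is the multiplicity of the part size 2m+1.
record IsPair (m j n : ℕ) (p : List ℕ × ℕ) : Set where
  constructor mkIsPair
  δ = proj₁ p
  k = proj₂ p
  field
    distinct    : AllPairs ℕ._>_ δ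
    positive    : All (0 ℕ.<_) δ
    m-parts     : length δ ≡ m
    largest≡j   : largest δ ≡ j
    total≡n     : sum δ ℕ.+ k ℕ.* (2 ℕ.* m ℕ.+ 1) ≡ n

isPair? : ∀ m j n p → Dec (IsPair m j n p)
isPair? m j n p@(δ , k) = map′
  (λ (a , b , c , d , e) → mkIsPair a b c d e)
  (λ (mkIsPair a b c d e) → a , b , c , d , e)
  (allPairs? (λ x y → y ℕ.<? x) δ ×-dec All.all? (λ x → 0 ℕ.<? x) δ ×-dec
   length δ ℕ.≟ m ×-dec largest δ ℕ.≟ j ×-dec
   sum δ ℕ.+ k ℕ.* (2 ℕ.* m ℕ.+ 1) ℕ.≟ n)

-- All strictly decreasing lists with entries in {1, …, b}.
decreasing : ℕ → List (List ℕ)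
decreasing zero    = [] ∷ []
decreasing (suc b) = map (suc b ∷_) (decreasing b) ++ decreasing b

pairs : ℕ → ℕ → ℕ → List (List ℕ × ℕ)
pairs m j n = filter (isPair? m j n) (cartesianProduct (decreasing n) (upTo (suc n)))

P : ℕ → ℕ → ℕ → ℕ
P m j n = length (pairs m j n)

-- The search bounds in pairs lose nothing: it lists each pair exactly once.

private
  ∈-decreasing : ∀ b {δ} → AllPairs ℕ._>_ δ → All (0 ℕ.<_) δ → All (ℕ._≤ b) δ → δ ∈ decreasing b
  ∈-decreasing zero    []      []         []        = here refl
  ∈-decreasing zero    (_ ∷ _) (0<x ∷ _)  (x≤0 ∷ _) = contradiction (ℕ.≤-trans 0<x x≤0) λ ()
  ∈-decreasing (suc b) []      []         []        = ∈-++⁺ʳ _ (∈-decreasing b [] [] [])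
  ∈-decreasing (suc b) {x ∷ _} (x> ∷ d) (0<x ∷ pos) (x≤ ∷ le) with x ℕ.≟ suc b
  ... | yes refl = ∈-++⁺ˡ (∈-map⁺ (suc b ∷_) (∈-decreasing b d pos (All.map ℕ.s≤s⁻¹ x>)))
  ... | no x≢    = ∈-++⁺ʳ _ (∈-decreasing b (x> ∷ d) (0<x ∷ pos)
                     (x≤b ∷ All.map (λ y<x → ℕ.≤-trans (ℕ.<⇒≤ y<x) x≤b) x>))
    where x≤b = ℕ.s≤s⁻¹ (ℕ.≤∧≢⇒< x≤ x≢)

  decreasing-≤ : ∀ b {δ} → δ ∈ decreasing b → All (ℕ._≤ b) δ
  decreasing-≤ zero (here refl) = []
  decreasing-≤ (suc b) δ∈ with ∈-++⁻ (map (suc b ∷_) (decreasing b)) δ∈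
  ... | inj₂ δ∈′ = All.map ℕ.m≤n⇒m≤1+n (decreasing-≤ b δ∈′)
  ... | inj₁ δ∈′ with ∈-map⁻ (suc b ∷_) δ∈′
  ... | _ , τ∈ , refl = ℕ.≤-refl ∷ All.map ℕ.m≤n⇒m≤1+n (decreasing-≤ b τ∈)

  decreasing-unique : ∀ b → Unique (decreasing b)
  decreasing-unique zero    = [] ∷ []
  decreasing-unique (suc b) =
    Unique.++⁺ (Unique.map⁺ ∷-injectiveʳ (decreasing-unique b)) (decreasing-unique b) disjoint
    where
    disjoint : ∀ {δ} → δ ∈ map (suc b ∷_) (decreasing b) × δ ∈ decreasing b → ⊥
    disjoint (δ∈₁ , δ∈₂) with ∈-map⁻ (suc b ∷_) δ∈₁
    ... | _ , _ , refl = ℕ.<-irrefl refl (All.head (decreasing-≤ b δ∈₂))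

  parts≤sum : ∀ δ → All (ℕ._≤ sum δ) δ
  parts≤sum []      = []
  parts≤sum (x ∷ δ) = ℕ.m≤m+n x _ ∷ All.map (λ y≤ → ℕ.≤-trans y≤ (ℕ.m≤n+m _ x)) (parts≤sum δ)

∈-pairs : ∀ {m j n p} → IsPair m j n p → p ∈ pairs m j n
∈-pairs {m} {j} {n} {δ , k} isP@(mkIsPair dist pos _ _ total) =
  ∈-filter⁺ (isPair? m j n)
    (∈-cartesianProduct⁺
      (∈-decreasing n dist pos (All.map (λ x≤ → ℕ.≤-trans x≤ sum≤n) (parts≤sum δ)))
      (∈-upTo⁺ (ℕ.s≤s k≤n)))
    isP
  where
  sum≤n : sum δ ℕ.≤ n
  sum≤n = subst (sum δ ℕ.≤_) total (ℕ.m≤m+n (sum δ) _)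
  k≤n : k ℕ.≤ n
  k≤n = subst (k ℕ.≤_) (trans (cong (λ c → sum δ ℕ.+ k ℕ.* c) (ℕ.+-comm 1 (2 ℕ.* m))) total)
    (ℕ.≤-trans (ℕ.m≤m*n k (suc (2 ℕ.* m))) (ℕ.m≤n+m _ (sum δ)))

∈-pairs⁻ : ∀ {m j n p} → p ∈ pairs m j n → IsPair m j n p
∈-pairs⁻ {m} {j} {n} p∈ =
  proj₂ (∈-filter⁻ (isPair? m j n) {xs = cartesianProduct (decreasing n) (upTo (suc n))} p∈)

pairs-unique : ∀ m j n → Unique (pairs m j n)
pairs-unique m j n = Unique.filter⁺ (isPair? m j n)
  (Unique.cartesianProduct⁺ (decreasing-unique n) (Unique.upTo⁺ (suc n)))

{-# OPTIONS --safe #-}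

-- Put t = q^½.  Lowering every part by one shows that the generating function D_m of the partitions
-- into m distinct parts, signed by the largest part, satisfies (1 + q^m) D_m = -q^m D_(m-1), so the
-- left-hand side is Σ_m (-1)^m q^(m(m+1)/2) / ((-q;q)_m (1 - q^(2m+1))).  Since
-- 2/(1 - q^(2m+1)) = 1/(1 - t^(2m+1)) + 1/(1 + t^(2m+1)), the theorem follows from the cases s = ±t of
--   Σ_m (-1)^m q^(m(m+1)/2) / ((-q;q)_m (1 - s^(2m+1))) = Σ_n s^(2n²+n) (1 + s^(2n+1)) Σ_{|j|≤n} s^(j²).
-- Here one multiplies and divides by (q)_m, expands
-- 1/(q²;q²)_m = Σ_r (-1)^r q^(r²) / ((q)_(m-r) (q)_(m+r)) and sums over m first; the quantity
--   V_r = (-1)^r s^(r²) Σ_m (-1)^m q^(m(m+1)/2) (q)_m / ((1 - s^(2m+1)) (q)_(m-r) (q)_(m+r))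
-- satisfies V_r - V_(r+1) = s^(2r²+r) (1 + s^(2r+1)), and a summation by parts finishes.
-- The identity is one of formal power series, proved modulo every power of t.  Evaluated at a complex
-- t with |t| < 1, the terms that do not cancel are controlled by absolutely convergent tails.

module Submission where

open import Algebra.Bundles using (CommutativeRing)
open import Data.Empty using (⊥)
open import Data.Integer as ℤ using (ℤ; +_; -[1+_]; 0ℤ; 1ℤ; ∣_∣)
import Data.Integer.Properties as ℤ
import Data.Integer.Solver
open import Data.List
  using (List; []; _∷_; _++_; map; foldr; filter; concatMap; length; upTo; applyUpTo; cartesianProduct)
open import Data.List.Membership.Propositional using (_∈_; find; lose)
open import Data.List.Membership.Propositional.Properties
import Data.List.Properties as List
open import Data.List.Relation.Binary.Permutation.Propositional as ↭ using (_↭_)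
open import Data.List.Relation.Binary.Permutation.Propositional.Properties as ↭ using (shift)
open import Data.List.Relation.Binary.Subset.Propositional using (_⊆_)
open import Data.List.Relation.Unary.All as All using (All; []; _∷_)
import Data.List.Relation.Unary.All.Properties as All
open import Data.List.Relation.Unary.AllPairs using (AllPairs; []; _∷_)
open import Data.List.Relation.Unary.Any using (here; there)
open import Data.List.Relation.Unary.Unique.Propositional using (Unique)
import Data.List.Relation.Unary.Unique.Propositional.Properties as Unique
open import Data.Maybe as Maybe using (Maybe)
open import Data.Nat as ℕ using (ℕ; zero; suc; z≤n; s≤s)
open import Data.Nat.Coprimality as Coprimality using (1-coprimeTo)
open import Data.Nat.ListAction using (sum)
import Data.Nat.Properties as ℕ
import Data.Nat.Solver
open import Data.Product using (_×_; _,_; proj₁; proj₂; ∃)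
open import Data.Rational as ℚ using (ℚ; mkℚ; 0ℚ; 1ℚ; ½)
import Data.Rational.Properties as ℚ
open import Data.Rational.Solver using () renaming (module +-*-Solver to ℚ-Solver)
import Data.Rational.Unnormalised as ℚᵘ
import Data.Rational.Unnormalised.Properties as ℚᵘ
import Data.Sign as Sign
open import Data.Sum using (inj₁; inj₂)
open import Function using (_∘_; id)
open import Level using (0ℓ)
open import Relation.Binary.PropositionalEquality as ≡ using (_≡_)
open import Relation.Nullary using (¬_; Dec; yes; no; contradiction)
open import Relation.Nullary.Decidable using (dec⇒maybe)
open import Relation.Unary using (Pred; Decidable)
import Defs
open Defs using (symRange; largest; decreasing; pairs; P; mkIsPair; ∈-pairs; ∈-pairs⁻; pairs-unique; isPair?;
    seq; cauchy; re; im; mkℝ)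

open Data.Nat.Solver.+-*-Solver using ()
  renaming (solve to ℕ-solve; _:*_ to _⊗_; _:+_ to _⊕_; con to ℕ-con; _:=_ to _⊜_; _:^_ to _↑_)

-- The quotients of the formal computation, such as 1/(1 - t^k), are never formed among complex
-- numbers. The algebra lives in an arbitrary commutative ring with given inverses and t^(b+1) = 0,
-- and is applied to integer power series modulo X^(b+1). What passes to a complex t is a finite
-- fact: twice the partition sum minus both Hecke-type sums, all cut off at b, is a sum of signed
-- monomials whose coefficients below degree b+1 cancel, so only monomials of degree above b remain.
-- These are dominated by sums of positive powers that are bounded uniformly in b. Two things shape
-- the analysis. A real number is a Cauchy sequence, so every estimate concerns the i-th entries,
-- which are Gaussian rationals, for all large i; there t² is only close to q, and each partition
-- summand is moved from q to t² by a Lipschitz bound. And the rational-valued norm |a| + |b| can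
-- exceed 1 although |z| < 1, so decay is stated for powers: z^w has norm at most 2σ^(2w). One
-- factor σ^w makes a tail small, the other makes it summable.

-- Ring normalisation with integer coefficients in an arbitrary commutative ring.

module IntegerCoefficients {c ℓ} (R : CommutativeRing c ℓ) where
  open CommutativeRing R hiding (zero)
  open import Algebra.Properties.Ring ring using (-0#≈0#; -‿distribˡ-*; -‿distribʳ-*; -‿involutive; -‿+-comm)
  open import Algebra.Properties.Semiring.Mult.TCOptimised semiring
    using (1+×; ×1-homo-*; ×-homo-+) renaming (_×_ to _·_)
  open import Algebra.Solver.Ring.AlmostCommutativeRing
    using (fromCommutativeRing; _-Raw-AlmostCommutative⟶_)
  open import Relation.Binary.Reasoning.Setoid setoid
  open import Algebra.Properties.CommutativeSemigroup +-commutativeSemigroup using (interchange)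

  -- The canonical homomorphism from the integers. It gives the solver coefficients with decidable
  -- equality, and later evaluates integer power series in `R`.
  ι : ℤ → Carrier
  ι (+ n)    = n · 1#
  ι -[1+ n ] = - (suc n · 1#)

  ι-neg : ∀ i → ι (ℤ.- i) ≈ - ι i
  ι-neg (+ zero)  = sym -0#≈0#
  ι-neg (+ suc n) = refl
  ι-neg -[1+ n ]  = sym (-‿involutive _)

  ι-⊖ : ∀ m n → ι (m ℤ.⊖ n) ≈ m · 1# - n · 1#
  ι-⊖ m zero = sym (trans (+-congˡ -0#≈0#) (+-identityʳ _))
  ι-⊖ zero (suc n) = sym (+-identityˡ _)
  ι-⊖ (suc m) (suc n) = begin
    ι (suc m ℤ.⊖ suc n)  ≡⟨ ≡.cong ι (ℤ.[1+m]⊖[1+n]≡m⊖n m n) ⟩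
    ι (m ℤ.⊖ n)  ≈⟨ ι-⊖ m n ⟩
    m · 1# - n · 1#  ≈⟨ +-identityˡ _ ⟨
    0# + (m · 1# - n · 1#)  ≈⟨ +-congʳ (-‿inverseʳ 1#) ⟨
    (1# - 1#) + (m · 1# - n · 1#)  ≈⟨ interchange _ _ _ _ ⟩
    (1# + m · 1#) + (- 1# - n · 1#)  ≈⟨ +-cong (sym (1+× m 1#)) (trans (-‿+-comm _ _) (-‿cong (sym (1+× n 1#)))) ⟩
    suc m · 1# - suc n · 1# ∎

  ι-+ : ∀ i j → ι (i ℤ.+ j) ≈ ι i + ι j
  ι-+ (+ m) (+ n) = ×-homo-+ 1# m n
  ι-+ (+ m) -[1+ n ] = ι-⊖ m (suc n)
  ι-+ -[1+ m ] (+ n) = trans (ι-⊖ n (suc m)) (+-comm _ _)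
  ι-+ -[1+ m ] -[1+ n ] = begin
    - (suc (suc (m ℕ.+ n)) · 1#)  ≡⟨ ≡.cong (λ k → - (suc k · 1#)) (ℕ.+-suc m n) ⟨
    - ((suc m ℕ.+ suc n) · 1#)  ≈⟨ -‿cong (×-homo-+ 1# (suc m) (suc n)) ⟩
    - (suc m · 1# + suc n · 1#)  ≈⟨ -‿+-comm _ _ ⟨
    - (suc m · 1#) - suc n · 1# ∎
    where import Data.Nat.Properties as ℕ

  ι-neg◃ : ∀ n → ι (Sign.- ℤ.◃ n) ≈ - (n · 1#)
  ι-neg◃ zero    = sym -0#≈0#
  ι-neg◃ (suc n) = refl

  ι-* : ∀ i j → ι (i ℤ.* j) ≈ ι i * ι j
  ι-* (+ m) (+ n) = trans (reflexive (≡.cong ι (ℤ.+◃n≡+n (m ℕ.* n)))) (×1-homo-* m n)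
  ι-* (+ m) -[1+ n ] = trans (ι-neg◃ (m ℕ.* suc n))
    (trans (-‿cong (×1-homo-* m (suc n))) (-‿distribʳ-* _ _))
  ι-* -[1+ m ] (+ n) = trans (ι-neg◃ (suc m ℕ.* n))
    (trans (-‿cong (×1-homo-* (suc m) n)) (-‿distribˡ-* _ _))
  ι-* -[1+ m ] -[1+ n ] = begin
    (suc m ℕ.* suc n) · 1#  ≈⟨ ×1-homo-* (suc m) (suc n) ⟩
    suc m · 1# * (suc n · 1#)  ≈⟨ -‿involutive _ ⟨
    - - (suc m · 1# * (suc n · 1#))  ≈⟨ -‿cong (-‿distribˡ-* _ _) ⟩
    - (- (suc m · 1#) * (suc n · 1#))  ≈⟨ -‿distribʳ-* _ _ ⟩
    - (suc m · 1#) * - (suc n · 1#) ∎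

  morphism : ℤ.+-*-rawRing -Raw-AlmostCommutative⟶ fromCommutativeRing R
  morphism = record
    { ⟦_⟧ = ι ; +-homo = ι-+ ; *-homo = ι-* ; -‿homo = ι-neg ; 0-homo = refl ; 1-homo = refl }

  ι≟ : ∀ i j → Maybe (ι i ≈ ι j)
  ι≟ i j = Maybe.map (λ i≡j → reflexive (≡.cong ι i≡j)) (dec⇒maybe (i ℤ.≟ j))

  open import Algebra.Solver.Ring ℤ.+-*-rawRing (fromCommutativeRing R) morphism ι≟ public
    using (Polynomial; solve; _:+_; _:*_; _:-_; :-_; _:=_; con)

  :0 :1 :2 : ∀ {n} → Polynomial n
  :0 = con (+ 0)
  :1 = con (+ 1)
  :2 = con (+ 2)

-- Sums over initial segments, telescoping and summation by parts.

module FiniteSums {a ℓ} (R : CommutativeRing a ℓ) where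
  open CommutativeRing R hiding (zero)
  open IntegerCoefficients R
  open import Relation.Binary.Reasoning.Setoid setoid

  sum< : ℕ → (ℕ → Carrier) → Carrier
  sum< zero    f = 0#
  sum< (suc n) f = sum< n f + f n

  sum<-cong : ∀ n {f g} → (∀ i → i ℕ.< n → f i ≈ g i) → sum< n f ≈ sum< n g
  sum<-cong zero    _   = refl
  sum<-cong (suc n) f≈g =
    +-cong (sum<-cong n λ i i<n → f≈g i (ℕ.m≤n⇒m≤1+n i<n)) (f≈g n (ℕ.n<1+n n))

  sum<-zero : ∀ n → sum< n (λ _ → 0#) ≈ 0#
  sum<-zero zero    = refl
  sum<-zero (suc n) = trans (+-identityʳ _) (sum<-zero n)

  sum<-+ : ∀ n f g → sum< n (λ i → f i + g i) ≈ sum< n f + sum< n g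
  sum<-+ zero    f g = sym (+-identityˡ 0#)
  sum<-+ (suc n) f g = trans (+-congʳ (sum<-+ n f g))
    (solve 4 (λ a b c d → (a :+ b) :+ (c :+ d) := (a :+ c) :+ (b :+ d)) refl _ _ _ _)

  sum<-*ˡ : ∀ n x f → sum< n (λ i → x * f i) ≈ x * sum< n f
  sum<-*ˡ zero    x f = sym (zeroʳ x)
  sum<-*ˡ (suc n) x f = trans (+-congʳ (sum<-*ˡ n x f)) (sym (distribˡ x _ _))

  sum<-swap : ∀ m n (f : ℕ → ℕ → Carrier) →
    sum< m (λ i → sum< n (f i)) ≈ sum< n (λ j → sum< m (λ i → f i j))
  sum<-swap zero    n f = sym (sum<-zero n)
  sum<-swap (suc m) n f = trans (+-congʳ (sum<-swap m n f)) (sym (sum<-+ n _ _))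

  sum<-head : ∀ n f → sum< (suc n) f ≈ f 0 + sum< n (λ i → f (suc i))
  sum<-head zero    f = +-comm _ _
  sum<-head (suc n) f = trans (+-congʳ (sum<-head n f)) (+-assoc _ _ _)

  sum<-telescope : ∀ n (f : ℕ → Carrier) → sum< n (λ i → f i - f (suc i)) ≈ f 0 - f n
  sum<-telescope zero    f = sym (-‿inverseʳ _)
  sum<-telescope (suc n) f = trans (+-congʳ (sum<-telescope n f))
    (solve 3 (λ a b c → (a :- b) :+ (b :- c) := a :- c) refl _ _ _)

  sum<-single : ∀ n {k f} → k ℕ.< n → (∀ i → i ≡.≢ k → f i ≈ 0#) → sum< n f ≈ f k
  sum<-single (suc n) {k} {f} k<1+n f≈0 with k ℕ.≟ n
  ... | yes ≡.refl = trans (+-congʳ (trans (sum<-cong n λ i i<n → f≈0 i (ℕ.<⇒≢ i<n)) (sum<-zero n))) (+-identityˡ _)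
  ... | no k≢n = trans (+-cong (sum<-single n (ℕ.≤∧≢⇒< (ℕ.s≤s⁻¹ k<1+n) k≢n) f≈0) (f≈0 n (k≢n ∘ ≡.sym)))
      (+-identityʳ _)

  sum<-byParts : ∀ n (σ v h : ℕ → Carrier) → (∀ i → v i - v (suc i) ≈ h i) →
    sum< n (λ i → σ i * v i) ≈ sum< n (λ i → h i * sum< (suc i) σ) + sum< n σ * v n
  sum<-byParts zero    σ v h Δv = sym (trans (+-identityˡ _) (zeroˡ _))
  sum<-byParts (suc n) σ v h Δv = begin
    sum< n (λ i → σ i * v i) + σ n * v n
      ≈⟨ +-congʳ (sum<-byParts n σ v h Δv) ⟩
    (sum< n (λ i → h i * sum< (suc i) σ) + sum< n σ * v n) + σ n * v n
      ≈⟨ solve 5 (λ a b c d e → (a :+ b :* d) :+ c :* d := (a :+ (d :- e) :* (b :+ c)) :+ (b :+ c) :* e)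
           refl _ _ _ _ _ ⟩
    (sum< n (λ i → h i * sum< (suc i) σ) + (v n - v (suc n)) * sum< (suc n) σ) + sum< (suc n) σ * v (suc n)
      ≈⟨ +-congʳ (+-congˡ (*-congʳ (Δv n))) ⟩
    sum< (suc n) (λ i → h i * sum< (suc i) σ) + sum< (suc n) σ * v (suc n) ∎

  -- Makes hypotheses available to the solver, which knows only polynomial identities: `α` is the
  -- cofactor that certifies membership of x - y in the ideal generated by a - b.
  by-multiple : ∀ {a b x y} α → a ≈ b → x ≈ y + α * (a - b) → x ≈ y
  by-multiple {a} {b} α a≈b x≈ = trans x≈
    (trans (+-congˡ (trans (*-congˡ (trans (+-congʳ a≈b) (-‿inverseʳ b))) (zeroʳ α))) (+-identityʳ _))

-- q-Pochhammer symbols, the finite Gauss sum, orthogonality and the Hecke-type sum.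

module QSeries {a ℓ} (R : CommutativeRing a ℓ) where
  open CommutativeRing R hiding (zero)
  open IntegerCoefficients R
  open FiniteSums R
  open import Algebra.Properties.Semiring.Exp semiring using (_^_; ^-homo-*)
  open import Relation.Binary.Reasoning.Setoid setoid

  -- The ring need not be a field, so `I n` = 1/(1 - q^(n+1)) and `H n` = 1/(1 + q^(n+1)) are data.
  module WithInverses (q : Carrier) (I H : ℕ → Carrier)
    (I-inverse : ∀ n → (1# - q ^ suc n) * I n ≈ 1#)
    (H-inverse : ∀ n → (1# + q ^ suc n) * H n ≈ 1#)
    where

    -- (q)_n, 1/(q)_n, 1/(-q)_n and (-1)^n q^(n(n+1)/2).
    poch ipoch ihpoch g : ℕ → Carrier
    poch zero = 1#
    poch (suc n) = poch n * (1# - q ^ suc n)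
    ipoch zero = 1#
    ipoch (suc n) = ipoch n * I n
    ihpoch zero = 1#
    ihpoch (suc n) = ihpoch n * H n
    g zero = 1#
    g (suc n) = - (q ^ suc n * g n)

    -- 1/(q)_(n-r), which is 0 for r > n.
    c : ℕ → ℕ → Carrier
    c n       zero    = ipoch n
    c zero    (suc r) = 0#
    c (suc n) (suc r) = c n r

    ipoch-pred : ∀ n → ipoch n ≈ (1# - q ^ suc n) * ipoch (suc n)
    ipoch-pred n = by-multiple (- ipoch n) (I-inverse n)
      (solve 3 (λ p x i → p := x :* (p :* i) :+ :- p :* (x :* i :- :1)) refl (ipoch n) _ (I n))

    poch-ipoch : ∀ n → poch n * ipoch n ≈ 1#
    poch-ipoch zero = *-identityˡ 1#
    poch-ipoch (suc n) = begin
      (poch n * (1# - q ^ suc n)) * (ipoch n * I n)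
        ≈⟨ solve 4 (λ a b c d → (a :* b) :* (c :* d) := (a :* c) :* (b :* d)) refl _ _ _ _ ⟩
      (poch n * ipoch n) * ((1# - q ^ suc n) * I n)
        ≈⟨ *-cong (poch-ipoch n) (I-inverse n) ⟩
      1# * 1#  ≈⟨ *-identityˡ 1# ⟩
      1# ∎

    -- This is 1/(q)_(n-r-1) = (1 - q^(n-r)) / (q)_(n-r), multiplied by q^r so that no negative
    -- exponent occurs. At r = n the factor on the right vanishes, which agrees with the convention
    -- that `c` is 0 beyond the diagonal; hence no side condition on r.
    c-suc : ∀ n r → q ^ r * c n (suc r) ≈ (q ^ r - q ^ n) * c n r
    c-suc zero    zero    = solve 0 (:1 :* :0 := (:1 :- :1) :* :1) refl
    c-suc zero    (suc r) = trans (zeroʳ _) (sym (zeroʳ _))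
    c-suc (suc n) zero    = trans (*-congˡ (ipoch-pred n)) (*-identityˡ _)
    c-suc (suc n) (suc r) = begin
      (q * q ^ r) * c n (suc r)  ≈⟨ *-assoc _ _ _ ⟩
      q * (q ^ r * c n (suc r))  ≈⟨ *-congˡ (c-suc n r) ⟩
      q * ((q ^ r - q ^ n) * c n r)
        ≈⟨ solve 4 (λ q a b c → q :* ((a :- b) :* c) := (q :* a :- q :* b) :* c) refl _ _ _ _ ⟩
      (q * q ^ r - q * q ^ n) * c n r ∎

    c-above : ∀ {n r} → n ℕ.< r → c n r ≈ 0#
    c-above {zero}  {suc r} _         = refl
    c-above {suc n} {suc r} (s≤s n<r) = c-above n<r

    ipoch-+-suc : ∀ n r → ipoch (n ℕ.+ suc r) ≈ ipoch (suc (n ℕ.+ r))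
    ipoch-+-suc n r = reflexive (≡.cong ipoch (ℕ.+-suc n r))

    ipoch-pred-+ : ∀ n r → ipoch (suc (n ℕ.+ r)) ≈ (1# - q * (q * (q ^ n * q ^ r))) * ipoch (suc (suc (n ℕ.+ r)))
    ipoch-pred-+ n r = trans (ipoch-pred (suc (n ℕ.+ r)))
      (*-congʳ (+-congˡ (-‿cong (*-congˡ (*-congˡ (^-homo-* q n r))))))

    -- (-1)^r q^(r²).
    w : ℕ → Carrier
    w zero    = 1#
    w (suc r) = - (q * (q ^ r * q ^ r)) * w r

    -- Σ_{|r| ≤ n} (-1)^r q^(r²) / ((q)_(n-r) (q)_(n+r)) = 1/(q²;q²)_n.  The terms with -r and r agree;
    -- K is the telescoping certificate for the recurrence of the sum in n.
    module Gauss (R : ℕ) where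
      f : ℕ → ℕ → Carrier
      f n r = w r * (c n r * ipoch (n ℕ.+ r))

      β : ℕ → Carrier
      β n = f n 0 + (1# + 1#) * sum< R (λ r → f n (suc r))

      K : ℕ → ℕ → Carrier
      K n r = - (w r * (q ^ r * (q ^ suc n * (c n r * ipoch (suc (n ℕ.+ r))))))

      -- Everything is written through 1/(q)_(n+r+2), `c n r` and `c n (suc r)`; since
      -- `c (suc n) (suc r)` computes to `c n r`, one multiple of `c-suc` reduces the claim to a
      -- polynomial identity.
      f-suc : ∀ n r → (1# - q ^ suc n * q ^ suc n) * f (suc n) (suc r) ≈ f n (suc r) + (K n r - K n (suc r))
      f-suc n r = begin
        (1# - q ^ suc n * q ^ suc n) * (w (suc r) * (c n r * ipoch (suc (n ℕ.+ suc r))))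
          ≈⟨ *-congˡ (*-congˡ (*-congˡ (ipoch-+-suc (suc n) r))) ⟩
        (1# - q ^ suc n * q ^ suc n) * (w (suc r) * (c n r * ipoch (suc (suc (n ℕ.+ r)))))
          ≈⟨ by-multiple (q * (q ^ r * (w r * i))) (c-suc n r)
             (solve 7 (λ q R N w c c' i →
               let j = (:1 :- q :* (q :* (N :* R))) :* i; w' = :- (q :* (R :* R)) :* w in
               (:1 :- (q :* N) :* (q :* N)) :* (w' :* (c :* i))
               := (w' :* (c' :* j) :+ (:- (w :* (R :* ((q :* N) :* (c :* j))))
                    :- (:- (w' :* ((q :* R) :* ((q :* N) :* (c' :* i)))))))
                  :+ (q :* (R :* (w :* i))) :* (R :* c' :- (R :- N) :* c)) refl q (q ^ r) (q ^ n) (w r) (c n r)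
                      (c n (suc r)) i) ⟩
        (w (suc r) * (c n (suc r) * j)) +
          (- (w r * (q ^ r * (q ^ suc n * (c n r * j)))) - (- (w (suc r) * (q ^ suc r * (q ^ suc n * (c n
              (suc r) * i))))))
          ≈⟨ +-cong (*-congˡ (*-congˡ (trans (sym (ipoch-pred-+ n r)) (sym (ipoch-+-suc n r)))))
               (+-cong (-‿cong (*-congˡ (*-congˡ (*-congˡ (*-congˡ (sym (ipoch-pred-+ n r)))))))
                 (-‿cong (-‿cong (*-congˡ (*-congˡ (*-congˡ (*-congˡ (reflexive (≡.cong (λ k → ipoch (suc k))
                     (≡.sym (ℕ.+-suc n r)))))))))))  ⟩
        f n (suc r) + (K n r - K n (suc r)) ∎
        where
        i = ipoch (suc (suc (n ℕ.+ r)))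
        j = (1# - q * (q * (q ^ n * q ^ r))) * i

      K-top : ∀ {n} → n ℕ.< R → K n R ≈ 0#
      K-top {n} n<R = trans (-‿cong (*-congˡ (*-congˡ (*-congˡ (*-congʳ (c-above n<R))))))
        (solve 4 (λ a b c d → :- (a :* (b :* (c :* (:0 :* d)))) := :0) refl _ _ _ _)

      -- The central term gives up exactly 2 `K n 0`, which is what the telescoped differences for r
      -- and -r leave at their lower end. The two cancel in `β-suc`.
      f-zero : ∀ n → (1# - q ^ suc n * q ^ suc n) * f (suc n) 0 ≈ f n 0 - (1# + 1#) * K n 0
      f-zero n = begin
        (1# - x * x) * f (suc n) 0  ≡⟨ ≡.cong (λ k → (1# - x * x) * (1# * (j * (ipoch (suc k))))) (ℕ.+-identityʳ n) ⟩
        (1# - x * x) * (1# * (j * j))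
          ≈⟨ solve 2 (λ x j → let i = (:1 :- x) :* j in (:1 :- x :* x) :* (:1 :* (j :* j)) :=
               :1 :* (i :* i) :- (:1 :+ :1) :* (:- (:1 :* (:1 :* (x :* (i :* j)))))) refl x j ⟩
        1# * (i * i) - (1# + 1#) * (- (1# * (1# * (x * (i * j)))))
          ≈⟨ +-cong (*-congˡ (*-cong (ipoch-pred n) (ipoch-pred n)))
               (-‿cong (*-congˡ (-‿cong (*-congˡ (*-congˡ (*-congˡ (*-congʳ (ipoch-pred n)))))))) ⟨
        1# * (ipoch n * ipoch n) - (1# + 1#) * (- (1# * (1# * (x * (ipoch n * j)))))
          ≡⟨ ≡.cong (λ k → 1# * (ipoch n * ipoch k) - (1# + 1#) * (- (1# * (1# * (x * (ipoch n * ipoch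
              (suc k))))))) (ℕ.+-identityʳ n) ⟨
        f n 0 - (1# + 1#) * K n 0 ∎
        where
        x = q ^ suc n
        j = ipoch (suc n)
        i = (1# - x) * j

      β-suc : ∀ {n} → n ℕ.< R → (1# - q ^ suc n * q ^ suc n) * β (suc n) ≈ β n
      β-suc {n} n<R = begin
        y * (f (suc n) 0 + (1# + 1#) * sum< R (λ r → f (suc n) (suc r)))
          ≈⟨ solve 3 (λ y a b → y :* (a :+ (:1 :+ :1) :* b) := y :* a :+ (:1 :+ :1) :* (y :* b)) refl _ _ _ ⟩
        y * f (suc n) 0 + (1# + 1#) * (y * sum< R (λ r → f (suc n) (suc r)))
          ≈⟨ +-cong (f-zero n) (*-congˡ (trans (sym (sum<-*ˡ R y _))
               (trans (sum<-cong R λ r _ → f-suc n r) (trans (sum<-+ R _ _) (+-congˡ (sum<-telescope R (K n))))))) ⟩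
        (f n 0 - (1# + 1#) * K n 0) + (1# + 1#) * (sum< R (λ r → f n (suc r)) + (K n 0 - K n R))
          ≈⟨ +-congˡ (*-congˡ (+-congˡ (+-congˡ (-‿cong (K-top n<R))))) ⟩
        (f n 0 - (1# + 1#) * K n 0) + (1# + 1#) * (sum< R (λ r → f n (suc r)) + (K n 0 - 0#))
          ≈⟨ solve 3 (λ a k s → (a :- (:1 :+ :1) :* k) :+ (:1 :+ :1) :* (s :+ (k :- :0)) := a :+
              (:1 :+ :1) :* s) refl _ _ _ ⟩
        β n ∎
        where y = 1# - q ^ suc n * q ^ suc n

      β-closed : ∀ {n} → n ℕ.≤ R → β n ≈ ipoch n * ihpoch n
      β-closed {zero} _ = trans (+-congˡ (*-congˡ (trans (sum<-cong R λ r _ → trans (*-congˡ (zeroˡ _))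
          (zeroʳ _)) (sum<-zero R))))
        (solve 0 (:1 :* (:1 :* :1) :+ (:1 :+ :1) :* :0 := :1 :* :1) refl)
      β-closed {suc n} n<R = begin
        β (suc n)
          -- Inserts (1 - x²) · 1/(1 - x) · 1/(1 + x) = 1, one inverse at a time.
          ≈⟨ by-multiple (- β (suc n)) (I-inverse n) (by-multiple (- ((1# - x) * I n * β (suc n))) (H-inverse n)
               (solve 4 (λ x i h b → b := (((:1 :- x :* x) :* b) :* (i :* h) :+ (:- b) :* ((:1 :- x) :* i :- :1))
                   :+ (:- ((:1 :- x) :* i :* b)) :* ((:1 :+ x) :* h :- :1)) refl x (I n) (H n) (β (suc n)))) ⟩
        ((1# - x * x) * β (suc n)) * (I n * H n)
          ≈⟨ *-congʳ (trans (β-suc n<R) (β-closed (ℕ.<⇒≤ n<R))) ⟩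
        (ipoch n * ihpoch n) * (I n * H n)
          ≈⟨ solve 4 (λ a b c d → (a :* b) :* (c :* d) := (a :* c) :* (b :* d)) refl _ _ _ _ ⟩
        ipoch (suc n) * ihpoch (suc n) ∎
        where x = q ^ suc n

    -- Σ_n (-1)^n q^(n(n+1)/2) (q)_n / ((q)_(n-r) (q)_(n+r+1)) = (-1)^r q^(r(r+1)/2) modulo q^M.
    -- D is the telescoping certificate for the recurrence of the sum in r.
    module Orthogonality (M : ℕ) (q^M≈0 : q ^ M ≈ 0#) where
      term : ℕ → ℕ → Carrier
      term r n = g n * (poch n * (c n r * ipoch (suc (n ℕ.+ r))))

      D : ℕ → ℕ → Carrier
      D r n = - ((1# + q ^ suc r) * (g n * (poch n * (c n (suc r) * ipoch (suc (n ℕ.+ r))))))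

      -- `g M` contains the factor q^M. So a sum over n < M loses nothing, and telescoping has no
      -- upper boundary term.
      g-top : g M ≈ 0#
      g-top = vanish M q^M≈0
        where
        vanish : ∀ n → q ^ n ≈ 0# → g n ≈ 0#
        vanish zero    1≈0 = 1≈0
        vanish (suc n) x≈0 = trans (-‿cong (trans (*-congʳ x≈0) (zeroˡ _))) (solve 0 (:- :0 := :0) refl)

      term-suc : ∀ r n → term (suc r) n + q ^ suc r * term r n ≈ - (D r n - D r (suc n))
      term-suc r n = begin
        g n * (poch n * (c' * ipoch (suc (n ℕ.+ suc r)))) + q ^ suc r * (g n * (poch n * (c₀ * ipoch (suc
            (n ℕ.+ r)))))
          ≈⟨ +-cong (*-congˡ (*-congˡ (*-congˡ (ipoch-+-suc (suc n) r))))
               (*-congˡ (*-congˡ (*-congˡ (*-congˡ (ipoch-pred-+ n r))))) ⟩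
        g n * (poch n * (c' * i)) + q ^ suc r * (g n * (poch n * (c₀ * j)))
          ≈⟨ by-multiple (g n * (poch n * (i * (q * (q * q ^ n - 1# + q * (q * (q ^ n * q ^ r))))))) (c-suc n r)
             (solve 8 (λ q R N g p c c' i →
               let j = (:1 :- q :* (q :* (N :* R))) :* i in
               g :* (p :* (c' :* i)) :+ (q :* R) :* (g :* (p :* (c :* j)))
               := (:- (:- ((:1 :+ q :* R) :* (g :* (p :* (c' :* j))))
                    :- (:- ((:1 :+ q :* R) :* (:- ((q :* N) :* g) :* ((p :* (:1 :- q :* N)) :* (c :* i)))))))
                  :+ (g :* (p :* (i :* (q :* (q :* N :- :1 :+ q :* (q :* (N :* R))))))) :* (R :* c' :- (R :- N) :* c))
               refl q (q ^ r) (q ^ n) (g n) (poch n) c₀ c' i) ⟩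
        - (- ((1# + q ^ suc r) * (g n * (poch n * (c' * j)))) - D r (suc n))
          ≈⟨ -‿cong (+-congʳ (-‿cong (*-congˡ (*-congˡ (*-congˡ (*-congˡ (ipoch-pred-+ n r))))))) ⟨
        - (D r n - D r (suc n)) ∎
        where
        c₀ = c n r
        c' = c n (suc r)
        i = ipoch (suc (suc (n ℕ.+ r)))
        j = (1# - q * (q * (q ^ n * q ^ r))) * i

      -- For r = 0 the factor (q)_n cancels one of the two inverses, and the term is itself a
      -- difference.
      term-zero : ∀ n → term 0 n ≈ g n * ipoch n - g (suc n) * ipoch (suc n)
      term-zero n = begin
        g n * (poch n * (ipoch n * ipoch (suc (n ℕ.+ 0))))
          ≡⟨ ≡.cong (λ k → g n * (poch n * (ipoch n * ipoch (suc k)))) (ℕ.+-identityʳ n) ⟩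
        g n * (poch n * (ipoch n * i))
          ≈⟨ by-multiple (g n * i) (poch-ipoch n) (solve 5 (λ g p j i x → g :* (p :* (j :* i))
               := (g :* ((:1 :- x) :* i) :- (:- (x :* g)) :* i) :+ (g :* i) :* (p :* j :- :1)) refl (g n)
                   (poch n) (ipoch n) i (q ^ suc n)) ⟩
        g n * ((1# - q ^ suc n) * i) - g (suc n) * i  ≈⟨ +-congʳ (*-congˡ (ipoch-pred n)) ⟨
        g n * ipoch n - g (suc n) * i ∎
        where i = ipoch (suc n)

      -- After telescoping, the sum for r+1 is -q^(r+1) times the sum for r, which is the recursion
      -- that defines `g`.
      sum-term : ∀ r → sum< M (term r) ≈ g r
      sum-term zero = begin
        sum< M (term 0)  ≈⟨ sum<-cong M (λ n _ → term-zero n) ⟩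
        sum< M (λ n → g n * ipoch n - g (suc n) * ipoch (suc n))  ≈⟨ sum<-telescope M (λ n → g n * ipoch n) ⟩
        1# * 1# - g M * ipoch M  ≈⟨ +-congˡ (-‿cong (*-congʳ g-top)) ⟩
        1# * 1# - 0# * ipoch M  ≈⟨ solve 1 (λ x → :1 :* :1 :- :0 :* x := :1) refl _ ⟩
        1# ∎
      sum-term (suc r) = begin
        sum< M (term (suc r))
          ≈⟨ solve 2 (λ a b → a := (a :+ b) :- b) refl _ (q ^ suc r * sum< M (term r)) ⟩
        (sum< M (term (suc r)) + q ^ suc r * sum< M (term r)) - q ^ suc r * sum< M (term r)
          ≈⟨ +-cong total (-‿cong (*-congˡ (sum-term r))) ⟩
        0# - q ^ suc r * g r  ≈⟨ +-identityˡ _ ⟩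
        g (suc r) ∎
        where
        D-bottom : D r 0 ≈ 0#
        D-bottom = solve 2 (λ x y → :- (x :* (:1 :* (:1 :* (:0 :* y)))) := :0) refl _ _

        D-top : D r M ≈ 0#
        D-top = trans (-‿cong (*-congˡ (*-congʳ g-top))) (solve 2 (λ x y → :- (x :* (:0 :* y)) := :0) refl _ _)

        total : sum< M (term (suc r)) + q ^ suc r * sum< M (term r) ≈ 0#
        total = begin
          sum< M (term (suc r)) + q ^ suc r * sum< M (term r)
            ≈⟨ +-congˡ (sum<-*ˡ M _ _) ⟨
          sum< M (term (suc r)) + sum< M (λ n → q ^ suc r * term r n)
            ≈⟨ sum<-+ M _ _ ⟨
          sum< M (λ n → term (suc r) n + q ^ suc r * term r n)
            ≈⟨ sum<-cong M (λ n _ → trans (term-suc r n) (solve 1 (λ x → :- x := (:- :1) :* x) refl _)) ⟩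
          sum< M (λ n → - 1# * (D r n - D r (suc n)))
            ≈⟨ trans (sum<-*ˡ M _ _) (*-congˡ (sum<-telescope M (D r))) ⟩
          - 1# * (D r 0 - D r M)  ≈⟨ *-congˡ (+-cong D-bottom (-‿cong D-top)) ⟩
          - 1# * (0# - 0#)  ≈⟨ solve 0 ((:- :1) :* (:0 :- :0) := :0) refl ⟩
          0# ∎

      -- Since s q^n = s^(2n+1), `J n` is 1/(1 - s^(2n+1)).
      module HeckeSum (s : Carrier) (s² : s * s ≈ q) (J : ℕ → Carrier)
        (J-inverse : ∀ n → (1# - s * q ^ n) * J n ≈ 1#) where

        -- s^(r²), (-1)^r s^(r²), and the two terms of Σ_{j ∈ ℤ} s^(j²) with |j| = r.
        θ v σ : ℕ → Carrier
        θ zero    = 1#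
        θ (suc r) = s * q ^ r * θ r
        v zero    = 1#
        v (suc r) = - (s * q ^ r * v r)
        σ zero    = 1#
        σ (suc r) = (1# + 1#) * θ (suc r)

        w≈vθ : ∀ r → w r ≈ v r * θ r
        w≈vθ zero = sym (*-identityˡ 1#)
        w≈vθ (suc r) = begin
          - (q * (q ^ r * q ^ r)) * w r  ≈⟨ *-cong (-‿cong (*-congʳ (sym s²))) (w≈vθ r) ⟩
          - (s * s * (q ^ r * q ^ r)) * (v r * θ r)
            ≈⟨ solve 4 (λ s x v a → :- (s :* s :* (x :* x)) :* (v :* a) := (:- (s :* x :* v)) :*
                (s :* x :* a)) refl _ _ _ _ ⟩
          v (suc r) * θ (suc r) ∎

        γ : ℕ → Carrier
        γ n = g n * (poch n * J n)

        -- V_r without its prefactor: V_r is `v r * W r`.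
        W : ℕ → Carrier
        W r = sum< M (λ n → γ n * (c n r * ipoch (n ℕ.+ r)))

        W-top : W M ≈ 0#
        W-top = trans (sum<-cong M λ n n<M → trans (*-congˡ (trans (*-congʳ (c-above n<M)) (zeroˡ _))) (zeroʳ _))
            (sum<-zero M)

        -- Over the common factor `c n r` / (q)_(n+r+1) the two terms add up to 1 - s²q^(n+r) +
        -- s(q^r - q^n) = (1 + s q^r)(1 - s q^n). The second factor cancels `J n`, and the
        -- orthogonality sum `term r` is left.
        W-suc : ∀ r → W r + s * q ^ r * W (suc r) ≈ (1# + s * q ^ r) * g r
        W-suc r = begin
          W r + s * q ^ r * W (suc r)
            ≈⟨ trans (+-congˡ (sym (sum<-*ˡ M _ _))) (sym (sum<-+ M _ _)) ⟩
          sum< M (λ n → γ n * (c n r * ipoch (n ℕ.+ r)) + s * q ^ r * (γ n * (c n (suc r) * ipoch (n ℕ.+ suc r))))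
            ≈⟨ sum<-cong M (λ n _ → local n) ⟩
          sum< M (λ n → (1# + s * q ^ r) * term r n)
            ≈⟨ sum<-*ˡ M _ _ ⟩
          (1# + s * q ^ r) * sum< M (term r)
            ≈⟨ *-congˡ (sum-term r) ⟩
          (1# + s * q ^ r) * g r ∎
          where
          local : ∀ n → γ n * (c n r * ipoch (n ℕ.+ r)) + s * q ^ r * (γ n * (c n (suc r) * ipoch (n ℕ.+ suc r)))
            ≈ (1# + s * q ^ r) * term r n
          local n = begin
            γ n * (c n r * ipoch (n ℕ.+ r)) + s * q ^ r * (γ n * (c n (suc r) * ipoch (n ℕ.+ suc r)))
              ≈⟨ +-cong (*-congˡ (*-congˡ (trans (ipoch-pred (n ℕ.+ r)) (*-congʳ (+-congˡ (-‿cong (*-cong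
                  (sym s²) (^-homo-* q n r))))))))
                   (*-congˡ (*-congˡ (*-congˡ (ipoch-+-suc n r)))) ⟩
            γ n * (c n r * ((1# - s * s * (q ^ n * q ^ r)) * i)) + s * q ^ r * (γ n * (c n (suc r) * i))
              ≈⟨ by-multiple (s * (γ n * i)) (c-suc n r) (by-multiple ((1# + s * q ^ r) * (g n * (poch n *
                  (c n r * i)))) (J-inverse n)
                   (solve 9 (λ s R N g p J c c' i → let γ = g :* (p :* J) in
                     γ :* (c :* ((:1 :- s :* s :* (N :* R)) :* i)) :+ s :* R :* (γ :* (c' :* i))
                     := ((:1 :+ s :* R) :* (g :* (p :* (c :* i))) :+ (s :* (γ :* i)) :* (R :* c' :- (R :- N) :* c))
                       :+ ((:1 :+ s :* R) :* (g :* (p :* (c :* i)))) :* ((:1 :- s :* N) :* J :- :1))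
                     refl s (q ^ r) (q ^ n) (g n) (poch n) (J n) (c n r) (c n (suc r)) i)) ⟩
            (1# + s * q ^ r) * term r n ∎
            where i = ipoch (suc (n ℕ.+ r))

        V-suc : ∀ r → v r * W r - v (suc r) * W (suc r) ≈ v r * g r * (1# + s * q ^ r)
        V-suc r = begin
          v r * W r - v (suc r) * W (suc r)
            ≈⟨ solve 4 (λ v x W W' → v :* W :- (:- (x :* v)) :* W' := v :* (W :+ x :* W')) refl _ (s * q ^ r) _ _ ⟩
          v r * (W r + s * q ^ r * W (suc r))  ≈⟨ *-congˡ (W-suc r) ⟩
          v r * ((1# + s * q ^ r) * g r)  ≈⟨ solve 3 (λ v x g → v :* (x :* g) := v :* g :* x) refl _ _ _ ⟩
          v r * g r * (1# + s * q ^ r) ∎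

        open Gauss M

        heckeSum : sum< M (λ n → g n * ihpoch n * J n) ≈
          sum< M (λ n → v n * g n * (1# + s * q ^ n) * sum< (suc n) σ)
        heckeSum = begin
          sum< M (λ n → g n * ihpoch n * J n)
            ≈⟨ sum<-cong M (λ n n<M → unfold n (ℕ.<⇒≤ n<M)) ⟩
          sum< M (λ n → γ n * f n 0 + sum< M (λ r → (1# + 1#) * (γ n * f n (suc r))))
            -- The order of summation is exchanged; each column r is then `v r * θ r * W r`, because
            -- (-1)^r q^(r²) is the product of (-1)^r s^(r²) and s^(r²).
            ≈⟨ trans (sum<-+ M _ _) (+-cong (column 0) (trans (sum<-swap M M _) (sum<-cong M λ r _ →
                 trans (sum<-*ˡ M _ _) (*-congˡ (column (suc r)))))) ⟩
          v 0 * θ 0 * W 0 + sum< M (λ r → (1# + 1#) * (v (suc r) * θ (suc r) * W (suc r)))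
            ≈⟨ +-cong (solve 1 (λ W → :1 :* :1 :* W := :1 :* (:1 :* W)) refl _)
                 (sum<-cong M λ r _ → solve 3 (λ v a W → (:1 :+ :1) :* (v :* a :* W) := (:1 :+ :1) :* a :*
                     (v :* W)) refl _ _ _) ⟩
          σ 0 * (v 0 * W 0) + sum< M (λ r → σ (suc r) * (v (suc r) * W (suc r)))
            -- Reindexing from 0 also brings in r = M. This term and the boundary term of the
            -- summation by parts both contain `W M`, which vanishes.
            ≈⟨ sum<-head M _ ⟨
          sum< M (λ r → σ r * (v r * W r)) + σ M * (v M * W M)
            ≈⟨ +-cong (sum<-byParts M σ _ _ V-suc) (trans (*-congˡ VM≈0) (zeroʳ _)) ⟩
          (sum< M (λ n → v n * g n * (1# + s * q ^ n) * sum< (suc n) σ) + sum< M σ * (v M * W M)) + 0#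
            ≈⟨ trans (+-identityʳ _) (trans (+-congˡ (trans (*-congˡ VM≈0) (zeroʳ _))) (+-identityʳ _)) ⟩
          sum< M (λ n → v n * g n * (1# + s * q ^ n) * sum< (suc n) σ) ∎
          where
          VM≈0 : v M * W M ≈ 0#
          VM≈0 = trans (*-congˡ W-top) (zeroʳ _)

          column : ∀ r → sum< M (λ n → γ n * f n r) ≈ v r * θ r * W r
          column r = trans (sum<-cong M λ n _ → solve 3 (λ x y z → x :* (y :* z) := y :* (x :* z)) refl _ _ _)
            (trans (sum<-*ˡ M _ _) (*-congʳ (w≈vθ r)))

          unfold : ∀ n → n ℕ.≤ M → g n * ihpoch n * J n ≈ γ n * f n 0 + sum< M (λ r → (1# + 1#) * (γ n * f n (suc r)))
          unfold n n≤M = begin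
            g n * ihpoch n * J n
              ≈⟨ by-multiple (- (g n * ihpoch n * J n)) (poch-ipoch n)
                   (solve 5 (λ g h J p i → g :* h :* J := (g :* (p :* J)) :* (i :* h) :+ (:- (g :* h :* J)) :*
                       (p :* i :- :1)) refl
                     (g n) (ihpoch n) (J n) (poch n) (ipoch n)) ⟩
            γ n * (ipoch n * ihpoch n)  ≈⟨ *-congˡ (β-closed n≤M) ⟨
            γ n * β n  ≈⟨ solve 3 (λ x y z → x :* (y :+ (:1 :+ :1) :* z) := x :* y :+
                ((:1 :+ :1) :* x) :* z) refl _ _ _ ⟩
            γ n * f n 0 + ((1# + 1#) * γ n) * sum< M (λ r → f n (suc r))
              ≈⟨ +-congˡ (sum<-*ˡ M _ _) ⟨
            γ n * f n 0 + sum< M (λ r → ((1# + 1#) * γ n) * f n (suc r))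
              ≈⟨ +-congˡ (sum<-cong M λ r _ → *-assoc _ _ _) ⟩
            γ n * f n 0 + sum< M (λ r → (1# + 1#) * (γ n * f n (suc r))) ∎

-- Exponents of the Hecke-type terms and bounded families of partitions.

heckePair : ℕ → ℤ → List ℕ
heckePair n j = e ℕ.+ ∣ j ∣ ℕ.^ 2 ∷ e ℕ.+ (2 ℕ.* n ℕ.+ 1) ℕ.+ ∣ j ∣ ℕ.^ 2 ∷ []
  where e = 2 ℕ.* n ℕ.^ 2 ℕ.+ n

heckeExponents : ℕ → List ℕ
heckeExponents n = concatMap (heckePair n) (symRange n)

total : List ℕ × ℕ → ℕ
total (δ , k) = sum δ ℕ.+ k ℕ.* (2 ℕ.* length δ ℕ.+ 1)

-- A product set, so that summing over k can be done separately for each δ. It contains every pair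
-- of total at most b; the pairs of larger total that it also contains only contribute to the tail.
box : ℕ → List (List ℕ × ℕ)
box b = cartesianProduct (decreasing b) (upTo (suc b))

largest-decreasing : ∀ b → All (λ δ → largest δ ℕ.≤ b) (decreasing b)
largest-decreasing zero    = z≤n ∷ []
largest-decreasing (suc b) = All.++⁺
  (All.map⁺ (All.map (λ l≤b → ℕ.⊔-lub ℕ.≤-refl (ℕ.m≤n⇒m≤1+n l≤b)) (largest-decreasing b)))
  (All.map ℕ.m≤n⇒m≤1+n (largest-decreasing b))

-- Sums over lists, and expansion of the Hecke-type terms into monomials.

module ListSums {a ℓ} (R : CommutativeRing a ℓ) where
  open CommutativeRing R hiding (zero)
  open IntegerCoefficients R
  open FiniteSums R
  open import Algebra.Properties.Semiring.Exp semiring using (_^_; ^-homo-*)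
  open import Relation.Binary.Reasoning.Setoid setoid

  Σˡ : {A : Set} → List A → (A → Carrier) → Carrier
  Σˡ xs f = foldr _+_ 0# (map f xs)

  module _ {A : Set} where
    Σˡ-cong : ∀ {f g : A → Carrier} {xs} → All (λ x → f x ≈ g x) xs → Σˡ xs f ≈ Σˡ xs g
    Σˡ-cong []         = refl
    Σˡ-cong (eq ∷ eqs) = +-cong eq (Σˡ-cong eqs)

    Σˡ-cong′ : ∀ {f g : A → Carrier} xs → (∀ x → f x ≈ g x) → Σˡ xs f ≈ Σˡ xs g
    Σˡ-cong′ xs f≈g = Σˡ-cong (All.universal f≈g xs)

    Σˡ-++ : ∀ xs ys (f : A → Carrier) → Σˡ (xs ++ ys) f ≈ Σˡ xs f + Σˡ ys f
    Σˡ-++ []       ys f = sym (+-identityˡ _)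
    Σˡ-++ (x ∷ xs) ys f = trans (+-congˡ (Σˡ-++ xs ys f)) (sym (+-assoc _ _ _))

    Σˡ-*ˡ : ∀ xs k (f : A → Carrier) → Σˡ xs (λ x → k * f x) ≈ k * Σˡ xs f
    Σˡ-*ˡ []       k f = sym (zeroʳ k)
    Σˡ-*ˡ (x ∷ xs) k f = trans (+-congˡ (Σˡ-*ˡ xs k f)) (sym (distribˡ k _ _))

    Σˡ-↭ : ∀ {xs ys} (f : A → Carrier) → xs ↭ ys → Σˡ xs f ≈ Σˡ ys f
    Σˡ-↭ f ↭.refl          = refl
    Σˡ-↭ f (↭.prep x p)    = +-congˡ (Σˡ-↭ f p)
    Σˡ-↭ f (↭.swap x y p)  = trans (+-congˡ (+-congˡ (Σˡ-↭ f p)))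
      (solve 3 (λ x y z → x :+ (y :+ z) := y :+ (x :+ z)) refl _ _ _)
    Σˡ-↭ f (↭.trans p p′)  = trans (Σˡ-↭ f p) (Σˡ-↭ f p′)

  module _ {A B : Set} where
    Σˡ-map : ∀ (h : A → B) xs (f : B → Carrier) → Σˡ (map h xs) f ≡ Σˡ xs (f ∘ h)
    Σˡ-map h xs f = ≡.cong (foldr _+_ 0#) (≡.sym (List.map-∘ xs))

    Σˡ-concatMap : ∀ (h : A → List B) xs (f : B → Carrier) → Σˡ (concatMap h xs) f ≈ Σˡ xs (λ x → Σˡ (h x) f)
    Σˡ-concatMap h []       f = refl
    Σˡ-concatMap h (x ∷ xs) f = trans (Σˡ-++ (h x) _ f) (+-congˡ (Σˡ-concatMap h xs f))

  module _ {A B : Set} where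
    Σˡ-× : ∀ xs ys (f : A × B → Carrier) → Σˡ (cartesianProduct xs ys) f ≈ Σˡ xs (λ x → Σˡ ys (λ y → f (x , y)))
    Σˡ-× []       ys f = refl
    Σˡ-× (x ∷ xs) ys f = trans (Σˡ-++ (map (x ,_) ys) _ f)
      (+-cong (reflexive (Σˡ-map (x ,_) ys f)) (Σˡ-× xs ys f))

  Σˡ-applyUpTo : ∀ (h : ℕ → ℕ) n (f : ℕ → Carrier) → Σˡ (applyUpTo h n) f ≈ sum< n (f ∘ h)
  Σˡ-applyUpTo h zero    f = refl
  Σˡ-applyUpTo h (suc n) f = trans (+-congˡ (Σˡ-applyUpTo (h ∘ suc) n f)) (sym (sum<-head n (f ∘ h)))

  Σˡ-upTo : ∀ n (f : ℕ → Carrier) → Σˡ (upTo n) f ≈ sum< n f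
  Σˡ-upTo = Σˡ-applyUpTo id

  -- Passing from n to n+1 adds one entry at each end of the range, both of absolute value n+1, and
  -- shifts the old entries by one place.
  Σˡ-symRange : ∀ n (f : ℕ → Carrier) → Σˡ (symRange n) (f ∘ ∣_∣) ≈ f 0 + (1# + 1#) * sum< n (f ∘ suc)
  Σˡ-symRange n f = trans (reflexive (Σˡ-map _ (upTo (suc (2 ℕ.* n))) _)) (trans (Σˡ-upTo (suc (2 ℕ.* n)) _) (go n))
    where
    d : ℕ → ℕ → Carrier
    d n i = f ∣ + i ℤ.- + n ∣

    d-suc : ∀ n i → d (suc n) (suc i) ≡ d n i
    d-suc n i = ≡.cong (f ∘ ∣_∣) (≡.trans (ℤ.[1+m]⊖[1+n]≡m⊖n i n) (≡.sym (ℤ.m-n≡m⊖n i n)))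

    last : ∀ n → ∣ + suc (2 ℕ.* n) ℤ.- + n ∣ ≡ suc n
    last n = ≡.cong ∣_∣ (≡.trans (ℤ.m-n≡m⊖n (suc (2 ℕ.* n)) n)
      (≡.trans (≡.cong (ℤ._⊖ n) (≡.trans (≡.cong (λ k → suc (n ℕ.+ k)) (ℕ.+-identityʳ n)) (≡.sym (ℕ.+-suc n n))))
        (≡.trans (ℤ.⊖-≥ (ℕ.m≤m+n n (suc n))) (≡.cong +_ (ℕ.m+n∸m≡n n (suc n))))))

    go : ∀ n → sum< (suc (2 ℕ.* n)) (d n) ≈ f 0 + (1# + 1#) * sum< n (f ∘ suc)
    go zero = solve 1 (λ x → :0 :+ x := x :+ (:1 :+ :1) :* :0) refl _
    go (suc n) = begin
      sum< (suc (2 ℕ.* suc n)) (d (suc n))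
        ≡⟨ ≡.cong (λ k → sum< (suc k) (d (suc n))) (ℕ.*-suc 2 n) ⟩
      sum< (suc (suc (suc (2 ℕ.* n)))) (d (suc n))  ≈⟨ sum<-head (suc (suc (2 ℕ.* n))) _ ⟩
      f (suc n) + sum< (suc (suc (2 ℕ.* n))) (d (suc n) ∘ suc)
        ≈⟨ +-congˡ (sum<-cong (suc (suc (2 ℕ.* n))) λ i _ → reflexive (d-suc n i)) ⟩
      f (suc n) + (sum< (suc (2 ℕ.* n)) (d n) + d n (suc (2 ℕ.* n)))
        ≈⟨ +-congˡ (+-cong (go n) (reflexive (≡.cong f (last n)))) ⟩
      f (suc n) + ((f 0 + (1# + 1#) * sum< n (f ∘ suc)) + f (suc n))
        ≈⟨ solve 3 (λ x y z → x :+ ((y :+ (:1 :+ :1) :* z) :+ x) := y :+ (:1 :+ :1) :* (z :+ x)) refl _ _ _ ⟩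
      f 0 + (1# + 1#) * sum< (suc n) (f ∘ suc) ∎

  -- At s = t this is the summand of the first series, at s = -t that of the second
  -- (`heckeTerm-neg`).
  heckeTerm : Carrier → ℕ → Carrier
  heckeTerm s n = s ^ (2 ℕ.* n ℕ.^ 2 ℕ.+ n) * (1# + s ^ (2 ℕ.* n ℕ.+ 1)) * Σˡ (symRange n) (λ j → s ^ (∣ j ∣ ℕ.^ 2))

  heckeTerm-expand : ∀ s n → heckeTerm s n ≈ Σˡ (heckeExponents n) (s ^_)
  heckeTerm-expand s n = begin
    x * (1# + y) * Σˡ (symRange n) (λ j → s ^ (∣ j ∣ ℕ.^ 2))
      ≈⟨ Σˡ-*ˡ (symRange n) _ _ ⟨
    Σˡ (symRange n) (λ j → x * (1# + y) * s ^ (∣ j ∣ ℕ.^ 2))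
      ≈⟨ Σˡ-cong′ (symRange n) (λ j → monomials (∣ j ∣ ℕ.^ 2)) ⟩
    Σˡ (symRange n) (λ j → Σˡ (heckePair n j) (s ^_))
      ≈⟨ Σˡ-concatMap (heckePair n) (symRange n) (s ^_) ⟨
    Σˡ (heckeExponents n) (s ^_) ∎
    where
    e = 2 ℕ.* n ℕ.^ 2 ℕ.+ n
    x = s ^ e
    y = s ^ (2 ℕ.* n ℕ.+ 1)

    monomials : ∀ k → x * (1# + y) * s ^ k ≈ s ^ (e ℕ.+ k) + (s ^ (e ℕ.+ (2 ℕ.* n ℕ.+ 1) ℕ.+ k) + 0#)
    monomials k = trans
      (solve 3 (λ x y z → x :* (:1 :+ y) :* z := x :* z :+ (x :* y :* z :+ :0)) refl _ _ _)
      (sym (+-cong (^-homo-* s e k) (+-congʳ (trans (^-homo-* s (e ℕ.+ (2 ℕ.* n ℕ.+ 1)) k) (*-congʳ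
          (^-homo-* s e _))))))

-- Generating functions of partitions into distinct bounded parts.

module PartitionSeries {a ℓ} (R : CommutativeRing a ℓ) where
  open CommutativeRing R hiding (zero)
  open IntegerCoefficients R
  open FiniteSums R
  open ListSums R
  open import Algebra.Properties.Semiring.Exp semiring using (_^_; ^-homo-*)
  open import Relation.Binary.Reasoning.Setoid setoid

  module _ (q : Carrier) where
    -- Generating functions of the partitions into m distinct parts at most b; in `D` each carries
    -- the sign of its largest part. Once the part b+1 is present the sign is settled, so the
    -- recursion of `D` continues with the unsigned `e`.
    e D : ℕ → ℕ → Carrier
    e b       zero    = 1#
    e zero    (suc m) = 0#
    e (suc b) (suc m) = e b (suc m) + q ^ suc b * e b m
    D b       zero    = 1#
    D zero    (suc m) = 0#
    D (suc b) (suc m) = D b (suc m) + (- 1#) ^ suc b * (q ^ suc b * e b m)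

    -- Lowering every part by one turns a part 1 into nothing.
    e-shift : ∀ b m → e (suc b) (suc m) ≈ q ^ suc m * (e b (suc m) + e b m)
    e-shift zero    zero    = solve 1 (λ q → :0 :+ (q :* :1) :* :1 := (q :* :1) :* (:0 :+ :1)) refl q
    e-shift zero    (suc m) = solve 2 (λ x y → :0 :+ x :* :0 := y :* (:0 :+ :0)) refl _ _
    e-shift (suc b) zero    = begin
      e (suc b) 1 + q * q ^ suc b * 1#  ≈⟨ +-congʳ (e-shift b 0) ⟩
      q * 1# * (e b 1 + 1#) + q * q ^ suc b * 1#
        ≈⟨ solve 3 (λ q e Q → q :* :1 :* (e :+ :1) :+ q :* Q :* :1 := (q :* :1) :*
            ((e :+ Q :* :1) :+ :1)) refl q _ _ ⟩
      q ^ 1 * (e (suc b) 1 + 1#) ∎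
    e-shift (suc b) (suc m) = begin
      e (suc b) (suc (suc m)) + q * q ^ suc b * e (suc b) (suc m)
        ≈⟨ +-cong (e-shift b (suc m)) (*-congˡ (e-shift b m)) ⟩
      q * q ^ suc m * (e b (suc (suc m)) + e b (suc m)) + q * q ^ suc b * (q ^ suc m * (e b (suc m) + e b m))
        ≈⟨ solve 6 (λ q M B x y z → q :* M :* (x :+ y) :+ q :* B :* (M :* (y :+ z))
             := q :* M :* ((x :+ B :* y) :+ (y :+ B :* z))) refl q _ _ _ _ _ ⟩
      q ^ suc (suc m) * (e (suc b) (suc (suc m)) + e (suc b) (suc m)) ∎

    -- As for `e-shift`; the largest part also drops by one, whence the minus sign.
    D-shift : ∀ b m → D (suc b) (suc m) ≈ - (q ^ suc m * (D b (suc m) + D b m))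
    D-shift zero    zero    = solve 1 (λ q → :0 :+ ((:- :1) :* :1) :* ((q :* :1) :* :1) := :- ((q :* :1) :*
        (:0 :+ :1))) refl q
    D-shift zero    (suc m) = solve 3 (λ x y z → :0 :+ z :* (x :* :0) := :- (y :* (:0 :+ :0))) refl _ _ _
    D-shift (suc b) zero    = begin
      D (suc b) 1 + - 1# * (- 1#) ^ suc b * (q * q ^ suc b * 1#)  ≈⟨ +-congʳ (D-shift b 0) ⟩
      - (q * 1# * (D b 1 + 1#)) + - 1# * (- 1#) ^ suc b * (q * q ^ suc b * 1#)
        ≈⟨ solve 4 (λ q e Q s → :- (q :* :1 :* (e :+ :1)) :+ (:- :1) :* s :* (q :* Q :* :1)
             := :- ((q :* :1) :* ((e :+ s :* (Q :* :1)) :+ :1))) refl q _ _ _ ⟩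
      - (q ^ 1 * (D (suc b) 1 + 1#)) ∎
    D-shift (suc b) (suc m) = begin
      D (suc b) (suc (suc m)) + - 1# * (- 1#) ^ suc b * (q * q ^ suc b * e (suc b) (suc m))
        ≈⟨ +-cong (D-shift b (suc m)) (*-congˡ (*-congˡ (e-shift b m))) ⟩
      - (q * q ^ suc m * (D b (suc (suc m)) + D b (suc m))) + - 1# * (- 1#) ^ suc b * (q * q ^ suc b *
          (q ^ suc m * (e b (suc m) + e b m)))
        ≈⟨ solve 8 (λ q M B x y z w s → :- (q :* M :* (x :+ y)) :+ (:- :1) :* s :* (q :* B :* (M :* (z :+ w)))
             := :- (q :* M :* ((x :+ s :* (B :* z)) :+ (y :+ s :* (B :* w))))) refl q _ _ _ _ _ _ _ ⟩
      - (q ^ suc (suc m) * (D (suc b) (suc (suc m)) + D (suc b) (suc m))) ∎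

    -- The weight `z` is meant for the contribution of the repeated part, which depends on δ only
    -- through its number of parts. There are at most b parts, so indices m < B cover them all.
    Σ-decreasing : ∀ b {B} → b ℕ.< B → ∀ (z : ℕ → Carrier) →
      Σˡ (decreasing b) (λ δ → q ^ sum δ * z (length δ)) ≈ sum< B (λ m → e b m * z m)
    Σ-decreasing zero {suc B} _ z = begin
      1# * z 0 + 0#  ≈⟨ +-congˡ (trans (sum<-cong B λ m _ → zeroˡ _) (sum<-zero B)) ⟨
      1# * z 0 + sum< B (λ m → 0# * z (suc m))  ≈⟨ sum<-head B _ ⟨
      sum< (suc B) (λ m → e 0 m * z m) ∎
    Σ-decreasing (suc b) {suc B} (s≤s b<B) z = begin
      Σˡ (map (suc b ∷_) (decreasing b) ++ decreasing b) φ
        ≈⟨ Σˡ-++ (map (suc b ∷_) (decreasing b)) _ φ ⟩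
      Σˡ (map (suc b ∷_) (decreasing b)) φ + Σˡ (decreasing b) φ
        ≈⟨ +-cong (trans (reflexive (Σˡ-map (suc b ∷_) (decreasing b) φ))
             (trans (Σˡ-cong′ (decreasing b) λ δ → trans (*-congʳ (^-homo-* q (suc b) (sum δ))) (*-assoc _ _ _))
                 (Σˡ-*ˡ (decreasing b) _ _)))
             (Σ-decreasing b (ℕ.m≤n⇒m≤1+n b<B) z) ⟩
      q ^ suc b * Σˡ (decreasing b) (λ δ → q ^ sum δ * z (suc (length δ))) + sum< (suc B) (λ m → e b m * z m)
        ≈⟨ +-cong (trans (*-congˡ (Σ-decreasing b b<B (z ∘ suc))) (sym (sum<-*ˡ B _ _))) (sum<-head B _) ⟩
      sum< B (λ m → q ^ suc b * (e b m * z (suc m))) + (1# * z 0 + sum< B (λ m → e b (suc m) * z (suc m)))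
        ≈⟨ solve 3 (λ x y z → x :+ (y :+ z) := y :+ (z :+ x)) refl _ _ _ ⟩
      1# * z 0 + (sum< B (λ m → e b (suc m) * z (suc m)) + sum< B (λ m → q ^ suc b * (e b m * z (suc m))))
        ≈⟨ +-congˡ (trans (sym (sum<-+ B _ _)) (sum<-cong B λ m _ →
             solve 4 (λ x z Q y → x :* z :+ Q :* (y :* z) := (x :+ Q :* y) :* z) refl _ _ _ _)) ⟩
      1# * z 0 + sum< B (λ m → e (suc b) (suc m) * z (suc m))  ≈⟨ sum<-head B _ ⟨
      sum< (suc B) (λ m → e (suc b) m * z m) ∎
      where
      φ : List ℕ → Carrier
      φ δ = q ^ sum δ * z (length δ)

    Σ±-decreasing : ∀ b {B} → b ℕ.< B → ∀ (z : ℕ → Carrier) →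
      Σˡ (decreasing b) (λ δ → (- 1#) ^ largest δ * (q ^ sum δ * z (length δ))) ≈ sum< B (λ m → D b m * z m)
    Σ±-decreasing zero {suc B} _ z = begin
      1# * (1# * z 0) + 0#  ≈⟨ +-cong (*-identityˡ _) (sym (trans (sum<-cong B λ m _ → zeroˡ _) (sum<-zero B))) ⟩
      1# * z 0 + sum< B (λ m → 0# * z (suc m))  ≈⟨ sum<-head B _ ⟨
      sum< (suc B) (λ m → D 0 m * z m) ∎
    Σ±-decreasing (suc b) {suc B} (s≤s b<B) z = begin
      Σˡ (map (suc b ∷_) (decreasing b) ++ decreasing b) φ
        ≈⟨ Σˡ-++ (map (suc b ∷_) (decreasing b)) _ φ ⟩
      Σˡ (map (suc b ∷_) (decreasing b)) φ + Σˡ (decreasing b) φ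
        ≈⟨ +-cong (trans (reflexive (Σˡ-map (suc b ∷_) (decreasing b) φ))
             (trans (Σˡ-cong (All.map (λ {δ} → cons {δ}) (largest-decreasing b))) (Σˡ-*ˡ (decreasing b) _ _)))
             (Σ±-decreasing b (ℕ.m≤n⇒m≤1+n b<B) z) ⟩
      x * Σˡ (decreasing b) (λ δ → q ^ sum δ * z (suc (length δ))) + sum< (suc B) (λ m → D b m * z m)
        ≈⟨ +-cong (trans (*-congˡ (Σ-decreasing b b<B (z ∘ suc))) (sym (sum<-*ˡ B _ _))) (sum<-head B _) ⟩
      sum< B (λ m → x * (e b m * z (suc m))) + (1# * z 0 + sum< B (λ m → D b (suc m) * z (suc m)))
        ≈⟨ solve 3 (λ x y z → x :+ (y :+ z) := y :+ (z :+ x)) refl _ _ _ ⟩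
      1# * z 0 + (sum< B (λ m → D b (suc m) * z (suc m)) + sum< B (λ m → x * (e b m * z (suc m))))
        ≈⟨ +-congˡ (trans (sym (sum<-+ B _ _)) (sum<-cong B λ m _ →
             solve 5 (λ x z s Q y → x :* z :+ s :* Q :* (y :* z) := (x :+ s :* (Q :* y)) :* z) refl _ _ _ _ _)) ⟩
      1# * z 0 + sum< B (λ m → D (suc b) (suc m) * z (suc m))  ≈⟨ sum<-head B _ ⟨
      sum< (suc B) (λ m → D (suc b) m * z m) ∎
      where
      φ : List ℕ → Carrier
      φ δ = (- 1#) ^ largest δ * (q ^ sum δ * z (length δ))
      x = (- 1#) ^ suc b * q ^ suc b

      cons : ∀ {δ} → largest δ ℕ.≤ b → φ (suc b ∷ δ) ≈ x * (q ^ sum δ * z (suc (length δ)))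
      cons {δ} l≤b = begin
        (- 1#) ^ (suc b ℕ.⊔ largest δ) * (q ^ (suc b ℕ.+ sum δ) * z (suc (length δ)))
          ≈⟨ *-cong (reflexive (≡.cong ((- 1#) ^_) (ℕ.m≥n⇒m⊔n≡m (ℕ.m≤n⇒m≤1+n l≤b)))) (*-congʳ (^-homo-* q (suc b)
              (sum δ))) ⟩
        (- 1#) ^ suc b * (q ^ suc b * q ^ sum δ * z (suc (length δ)))
          ≈⟨ solve 4 (λ s x y z → s :* (x :* y :* z) := s :* x :* (y :* z)) refl _ _ _ _ ⟩
        x * (q ^ sum δ * z (suc (length δ))) ∎

-- The identity in a ring where t^(b+1) = 0.

module TruncatedIdentity {a ℓ} (R : CommutativeRing a ℓ) where
  open CommutativeRing R hiding (zero)
  open IntegerCoefficients R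
  open FiniteSums R
  open ListSums R
  open PartitionSeries R
  open QSeries R
  open import Algebra.Properties.CommutativeSemiring.Exp commutativeSemiring
    using (_^_; ^-homo-*; ^-assocʳ; ^-congˡ; ^-distrib-*)
  open import Relation.Binary.Reasoning.Setoid setoid

  partitionTerm : Carrier → List ℕ × ℕ → Carrier
  partitionTerm q p = (- 1#) ^ largest (proj₁ p) * q ^ total p

  geometric : ∀ y n → (1# - y) * sum< n (y ^_) ≈ 1# - y ^ n
  geometric y zero = solve 1 (λ y → (:1 :- y) :* :0 := :1 :- :1) refl y
  geometric y (suc n) = trans (distribˡ _ _ _) (trans (+-congʳ (geometric y n))
    (solve 2 (λ y x → (:1 :- x) :+ (:1 :- y) :* x := :1 :- y :* x) refl y _))

  module _ (t : Carrier) (G : ℕ → Carrier) (G-inverse : ∀ k → (1# - t ^ suc k) * G k ≈ 1#)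
    (b : ℕ) (t^b+1≈0 : t ^ suc b ≈ 0#) where

    private
      q = t * t

      -- All three come from the single family 1/(1 - t^(k+1)): `I n` is 1/(1 - q^(n+1)), `H n` is
      -- (1 - q^(n+1))/(1 - q^(2n+2)) = 1/(1 + q^(n+1)), and `Z n` is 1/(1 - q^(2n+1)).
      I H Z : ℕ → Carrier
      I n = G (n ℕ.+ suc n)
      H n = (1# - q ^ suc n) * I (n ℕ.+ suc n)
      Z n = I (n ℕ.+ n)

      I-inverse : ∀ n → (1# - q ^ suc n) * I n ≈ 1#
      I-inverse n = trans (*-congʳ (+-congˡ (-‿cong (trans (^-distrib-* t t (suc n)) (sym (^-homo-* t (suc n)
          (suc n)))))))
        (G-inverse (n ℕ.+ suc n))

      H-inverse : ∀ n → (1# + q ^ suc n) * H n ≈ 1#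
      H-inverse n = begin
        (1# + q ^ suc n) * H n
          ≈⟨ solve 2 (λ x i → (:1 :+ x) :* ((:1 :- x) :* i) := (:1 :- x :* x) :* i) refl _ _ ⟩
        (1# - q ^ suc n * q ^ suc n) * I (n ℕ.+ suc n)
          ≈⟨ *-congʳ (+-congˡ (-‿cong (^-homo-* q (suc n) (suc n)))) ⟨
        (1# - q ^ (suc n ℕ.+ suc n)) * I (n ℕ.+ suc n)  ≈⟨ I-inverse (n ℕ.+ suc n) ⟩
        1# ∎

      q^b+1≈0 : q ^ suc b ≈ 0#
      q^b+1≈0 = trans (^-distrib-* t t (suc b)) (trans (*-congˡ t^b+1≈0) (zeroʳ _))

    open WithInverses q I H I-inverse H-inverse

    private
      open Orthogonality (suc b) q^b+1≈0 hiding (D)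

      -- As q^(b+1) = 0, allowing the additional part b+1 changes nothing, so `D-shift` turns into a
      -- recurrence in m at fixed b.
      D-closed : ∀ m → D q b m ≈ g m * ihpoch m
      D-closed zero = sym (*-identityˡ 1#)
      D-closed (suc m) = begin
        d
          ≈⟨ by-multiple (- d) (H-inverse m) (by-multiple (H m) recurrence
               (solve 4 (λ x h d e → d := ((:- (x :* e)) :* h :+ (:- d) :* ((:1 :+ x) :* h :- :1))
                   :+ h :* ((:1 :+ x) :* d :- :- (x :* e))) refl (q ^ suc m) (H m) d (D q b m))) ⟩
        - (q ^ suc m * D q b m) * H m  ≈⟨ *-congʳ (-‿cong (*-congˡ (D-closed m))) ⟩
        - (q ^ suc m * (g m * ihpoch m)) * H m
          ≈⟨ solve 4 (λ x g i h → :- (x :* (g :* i)) :* h := :- (x :* g) :* (i :* h)) refl _ _ _ _ ⟩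
        g (suc m) * ihpoch (suc m) ∎
        where
        d = D q b (suc m)

        recurrence : (1# + q ^ suc m) * d ≈ - (q ^ suc m * D q b m)
        recurrence = begin
          (1# + q ^ suc m) * d
            ≈⟨ solve 3 (λ x d s → (:1 :+ x) :* d := (d :+ s :* (:0 :* :1)) :+ x :* d) refl _ _ ((- 1#) ^ suc b) ⟩
          (d + (- 1#) ^ suc b * (0# * 1#)) + q ^ suc m * d
            ≈⟨ +-congʳ (+-congˡ (*-congˡ (trans (zeroˡ 1#) (sym (trans (*-congʳ q^b+1≈0) (zeroˡ _)))))) ⟩
          D q (suc b) (suc m) + q ^ suc m * d
            ≈⟨ +-congʳ (D-shift q b m) ⟩
          - (q ^ suc m * (d + D q b m)) + q ^ suc m * d
            ≈⟨ solve 3 (λ x d e → :- (x :* (d :+ e)) :+ x :* d := :- (x :* e)) refl _ _ _ ⟩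
          - (q ^ suc m * D q b m) ∎

      -- With y = q^(2m+1), y^(b+1) vanishes, so the geometric series cut off at b is already the
      -- inverse of 1 - y.
      multiplicities : ∀ m → Σˡ (upTo (suc b)) (λ k → q ^ (k ℕ.* (2 ℕ.* m ℕ.+ 1))) ≈ Z m
      multiplicities m = begin
        Σˡ (upTo (suc b)) (λ k → q ^ (k ℕ.* (2 ℕ.* m ℕ.+ 1)))
          ≈⟨ Σˡ-cong′ (upTo (suc b)) (λ k → trans (reflexive (≡.cong (q ^_) (exponent k))) (sym (^-assocʳ q (suc
              (m ℕ.+ m)) k))) ⟩
        Σˡ (upTo (suc b)) (y ^_)  ≈⟨ Σˡ-upTo (suc b) _ ⟩
        S  ≈⟨ by-multiple (- S) (I-inverse (m ℕ.+ m)) (by-multiple (Z m) (trans (geometric y (suc b)) (trans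
            (+-congˡ (-‿cong y^b+1≈0)) (solve 0 (:1 :- :0 := :1) refl)))
               (solve 3 (λ y s z → s := (z :+ (:- s) :* ((:1 :- y) :* z :- :1)) :+ z :*
                   ((:1 :- y) :* s :- :1)) refl y S (Z m))) ⟩
        Z m ∎
        where
        y = q ^ suc (m ℕ.+ m)
        S = sum< (suc b) (y ^_)

        exponent : ∀ k → k ℕ.* (2 ℕ.* m ℕ.+ 1) ≡ suc (m ℕ.+ m) ℕ.* k
        exponent = ℕ-solve 2 (λ m k → k ⊗ (ℕ-con 2 ⊗ m ⊕ ℕ-con 1) ⊜ (ℕ-con 1 ⊕ (m ⊕ m)) ⊗ k) ≡.refl m

        y^b+1≈0 : y ^ suc b ≈ 0#
        y^b+1≈0 = begin
          y ^ suc b  ≈⟨ ^-assocʳ q (suc (m ℕ.+ m)) (suc b) ⟩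
          q ^ (suc (m ℕ.+ m) ℕ.* suc b)  ≡⟨ ≡.cong (q ^_) (ℕ.*-comm (suc (m ℕ.+ m)) (suc b)) ⟩
          q ^ (suc b ℕ.* suc (m ℕ.+ m))  ≈⟨ ^-assocʳ q (suc b) (suc (m ℕ.+ m)) ⟨
          (q ^ suc b) ^ suc (m ℕ.+ m)  ≈⟨ *-congʳ q^b+1≈0 ⟩
          0# * (q ^ suc b) ^ (m ℕ.+ m)  ≈⟨ zeroˡ _ ⟩
          0# ∎

      partitionSum : Σˡ (box b) (partitionTerm q) ≈ sum< (suc b) (λ m → g m * ihpoch m * Z m)
      partitionSum = begin
        Σˡ (box b) (partitionTerm q)  ≈⟨ Σˡ-× (decreasing b) (upTo (suc b)) _ ⟩
        Σˡ (decreasing b) (λ δ → Σˡ (upTo (suc b)) (λ k → partitionTerm q (δ , k)))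
          ≈⟨ Σˡ-cong′ (decreasing b) (λ δ → trans
               (Σˡ-cong′ (upTo (suc b)) (λ k → trans (*-congˡ (^-homo-* q (sum δ) _)) (sym (*-assoc _ _ _))))
               (trans (Σˡ-*ˡ (upTo (suc b)) _ _) (trans (*-congˡ (multiplicities (length δ))) (*-assoc _ _ _)))) ⟩
        Σˡ (decreasing b) (λ δ → (- 1#) ^ largest δ * (q ^ sum δ * Z (length δ)))
          ≈⟨ Σ±-decreasing q b (ℕ.n<1+n b) Z ⟩
        sum< (suc b) (λ m → D q b m * Z m)
          ≈⟨ sum<-cong (suc b) (λ m _ → *-congʳ (D-closed m)) ⟩
        sum< (suc b) (λ m → g m * ihpoch m * Z m) ∎

      module Sided (s : Carrier) (s² : s * s ≈ q) (J : ℕ → Carrier)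
        (J-inverse : ∀ n → (1# - s * q ^ n) * J n ≈ 1#) where
        open HeckeSum s s² J J-inverse

        odd-power : ∀ n → s * q ^ n ≈ s ^ (2 ℕ.* n ℕ.+ 1)
        odd-power n = begin
          s * q ^ n  ≈⟨ *-congˡ (trans (^-congˡ n (trans (sym s²) (*-congˡ (sym (*-identityʳ s)))))
              (^-assocʳ s 2 n)) ⟩
          s ^ suc (2 ℕ.* n)  ≡⟨ ≡.cong (s ^_) (ℕ.+-comm 1 (2 ℕ.* n)) ⟩
          s ^ (2 ℕ.* n ℕ.+ 1) ∎

        θ-closed : ∀ n → θ n ≈ s ^ (n ℕ.^ 2)
        θ-closed zero = refl
        θ-closed (suc n) = begin
          s * q ^ n * θ n  ≈⟨ *-cong (odd-power n) (θ-closed n) ⟩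
          s ^ (2 ℕ.* n ℕ.+ 1) * s ^ (n ℕ.^ 2)  ≈⟨ ^-homo-* s (2 ℕ.* n ℕ.+ 1) (n ℕ.^ 2) ⟨
          s ^ (2 ℕ.* n ℕ.+ 1 ℕ.+ n ℕ.^ 2)
            ≡⟨ ≡.cong (s ^_) (ℕ-solve 1 (λ n → ℕ-con 2 ⊗ n ⊕ ℕ-con 1 ⊕ n ↑ 2 ⊜ (ℕ-con 1 ⊕ n) ↑ 2) ≡.refl n) ⟩
          s ^ (suc n ℕ.^ 2) ∎

        -- The two signs (-1)^n cancel, and s^(n²) q^(n(n+1)/2) has exponent n² + n(n+1) in s.
        vg-closed : ∀ n → v n * g n ≈ s ^ (2 ℕ.* n ℕ.^ 2 ℕ.+ n)
        vg-closed zero = *-identityˡ 1#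
        vg-closed (suc n) = begin
          - (s * q ^ n * v n) * - (q * q ^ n * g n)
            ≈⟨ *-congˡ (-‿cong (*-congʳ (*-congʳ (sym s²)))) ⟩
          - (s * q ^ n * v n) * - (s * s * q ^ n * g n)
            ≈⟨ solve 4 (λ s x v g → :- (s :* x :* v) :* :- (s :* s :* x :* g) := s :* (s :* x) :* (s :* x) :*
                (v :* g)) refl _ _ _ _ ⟩
          s * (s * q ^ n) * (s * q ^ n) * (v n * g n)
            ≈⟨ *-cong (*-cong (*-congˡ (odd-power n)) (odd-power n)) (vg-closed n) ⟩
          s ^ suc k * s ^ k * s ^ (2 ℕ.* n ℕ.^ 2 ℕ.+ n)
            ≈⟨ trans (^-homo-* s (suc k ℕ.+ k) _) (*-congʳ (^-homo-* s (suc k) k)) ⟨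
          s ^ (suc k ℕ.+ k ℕ.+ (2 ℕ.* n ℕ.^ 2 ℕ.+ n))
            ≡⟨ ≡.cong (s ^_) (ℕ-solve 1 (λ n → let k = ℕ-con 2 ⊗ n ⊕ ℕ-con 1 in
                 ℕ-con 1 ⊕ k ⊕ k ⊕ (ℕ-con 2 ⊗ n ↑ 2 ⊕ n) ⊜ ℕ-con 2 ⊗ (ℕ-con 1 ⊕ n) ↑ 2 ⊕ (ℕ-con 1 ⊕ n)) ≡.refl n) ⟩
          s ^ (2 ℕ.* suc n ℕ.^ 2 ℕ.+ suc n) ∎
          where k = 2 ℕ.* n ℕ.+ 1

        σ-closed : ∀ n → sum< (suc n) σ ≈ Σˡ (symRange n) (λ j → s ^ (∣ j ∣ ℕ.^ 2))
        σ-closed n = begin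
          sum< (suc n) σ  ≈⟨ sum<-head n σ ⟩
          1# + sum< n (λ r → (1# + 1#) * θ (suc r))
            ≈⟨ +-congˡ (trans (sum<-*ˡ n _ _) (*-congˡ (sum<-cong n λ r _ → θ-closed (suc r)))) ⟩
          1# + (1# + 1#) * sum< n (λ r → s ^ (suc r ℕ.^ 2))  ≈⟨ Σˡ-symRange n (λ r → s ^ (r ℕ.^ 2)) ⟨
          Σˡ (symRange n) (λ j → s ^ (∣ j ∣ ℕ.^ 2)) ∎

        side : sum< (suc b) (λ n → g n * ihpoch n * J n) ≈ Σˡ (upTo (suc b)) (heckeTerm s)
        side = begin
          sum< (suc b) (λ n → g n * ihpoch n * J n)  ≈⟨ heckeSum ⟩
          sum< (suc b) (λ n → v n * g n * (1# + s * q ^ n) * sum< (suc n) σ)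
            ≈⟨ sum<-cong (suc b) (λ n _ → closed n) ⟩
          sum< (suc b) (heckeTerm s)  ≈⟨ Σˡ-upTo (suc b) (heckeTerm s) ⟨
          Σˡ (upTo (suc b)) (heckeTerm s) ∎
          where
          closed : ∀ n → v n * g n * (1# + s * q ^ n) * sum< (suc n) σ ≈ heckeTerm s n
          closed n = *-cong (*-cong (vg-closed n) (+-congˡ (odd-power n))) (σ-closed n)

      Z-inverse : ∀ n → (1# - t * q ^ n * (t * q ^ n)) * Z n ≈ 1#
      Z-inverse n = trans (*-congʳ (+-congˡ (-‿cong (trans
        (solve 2 (λ t x → t :* x :* (t :* x) := t :* t :* (x :* x)) refl t (q ^ n)) (*-congˡ (sym
            (^-homo-* q n n)))))))
        (I-inverse (n ℕ.+ n))

      -- Partial fractions: with y = t^(2n+1), `Z n` is 1/(1 - y²), so multiplying by 1 + y or 1 - y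
      -- gives 1/(1 - y) or 1/(1 + y), and the two add up to 2 `Z n`.
      J₊ J₋ : ℕ → Carrier
      J₊ n = (1# + t * q ^ n) * Z n
      J₋ n = (1# - t * q ^ n) * Z n

      J₊-inverse : ∀ n → (1# - t * q ^ n) * J₊ n ≈ 1#
      J₊-inverse n = trans (solve 2 (λ y z → (:1 :- y) :* ((:1 :+ y) :* z) := (:1 :- y :* y) :* z) refl
          (t * q ^ n) (Z n)) (Z-inverse n)

      J₋-inverse : ∀ n → (1# - (- t) * q ^ n) * J₋ n ≈ 1#
      J₋-inverse n = trans (solve 3 (λ t x z → (:1 :- (:- t) :* x) :* ((:1 :- t :* x) :* z) := (:1 :- t :* x :*
          (t :* x)) :* z) refl t (q ^ n) (Z n)) (Z-inverse n)

      J₊+J₋ : ∀ n → (1# + 1#) * (g n * ihpoch n * Z n) ≈ g n * ihpoch n * J₊ n + g n * ihpoch n * J₋ n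
      J₊+J₋ n = solve 3 (λ x y z → (:1 :+ :1) :* (x :* z) := x :* ((:1 :+ y) :* z) :+ x :* ((:1 :- y) :* z))
        refl (g n * ihpoch n) (t * q ^ n) (Z n)

      module Plus  = Sided t refl J₊ J₊-inverse
      module Minus = Sided (- t) (solve 1 (λ t → (:- t) :* (:- t) := t :* t) refl t) J₋ J₋-inverse

    -- The sums are cut off in their indices, not by degree; everything omitted would vanish with
    -- t^(b+1). The factor 2 stays on the left because integer power series have no ½.
    truncatedIdentity : (1# + 1#) * Σˡ (box b) (partitionTerm (t * t)) ≈
      Σˡ (upTo (suc b)) (heckeTerm t) + Σˡ (upTo (suc b)) (heckeTerm (- t))
    truncatedIdentity = begin
      (1# + 1#) * Σˡ (box b) (partitionTerm q)
        ≈⟨ trans (*-congˡ partitionSum) (sym (sum<-*ˡ (suc b) (1# + 1#) (λ n → g n * ihpoch n * Z n))) ⟩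
      sum< (suc b) (λ n → (1# + 1#) * (g n * ihpoch n * Z n))
        ≈⟨ trans (sum<-cong (suc b) λ n _ → J₊+J₋ n) (sum<-+ (suc b) (λ n → g n * ihpoch n * J₊ n) (λ n →
            g n * ihpoch n * J₋ n)) ⟩
      sum< (suc b) (λ n → g n * ihpoch n * J₊ n) + sum< (suc b) (λ n → g n * ihpoch n * J₋ n)
        ≈⟨ +-cong Plus.side Minus.side ⟩
      Σˡ (upTo (suc b)) (heckeTerm t) + Σˡ (upTo (suc b)) (heckeTerm (- t)) ∎

-- Integer power series modulo X^M.

module PowerSeries where
  open ≡.≡-Reasoning
  open Data.Integer.Solver.+-*-Solver using (solve; _:+_; _:*_; _:=_)

  Series : Set
  Series = ℕ → ℤ

  infixl 7 _⊛_
  _⊛_ : Series → Series → Series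
  (f ⊛ g) zero    = f 0 ℤ.* g 0
  (f ⊛ g) (suc n) = f 0 ℤ.* g (suc n) ℤ.+ (f ∘ suc ⊛ g) n

  constant : ℤ → Series
  constant k zero    = k
  constant k (suc n) = 0ℤ

  X : Series
  X zero    = 0ℤ
  X (suc n) = constant 1ℤ n

  ⊛-cong : ∀ n {f f′ g g′} → (∀ i → i ℕ.≤ n → f i ≡ f′ i) → (∀ i → i ℕ.≤ n → g i ≡ g′ i) → (f ⊛ g) n ≡ (f′ ⊛ g′) n
  ⊛-cong zero    f≡ g≡ = ≡.cong₂ ℤ._*_ (f≡ 0 z≤n) (g≡ 0 z≤n)
  ⊛-cong (suc n) f≡ g≡ = ≡.cong₂ ℤ._+_ (≡.cong₂ ℤ._*_ (f≡ 0 z≤n) (g≡ (suc n) ℕ.≤-refl))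
    (⊛-cong n (λ i i≤n → f≡ (suc i) (s≤s i≤n)) (λ i i≤n → g≡ i (ℕ.m≤n⇒m≤1+n i≤n)))

  -- The recursion of the Cauchy product peels the first factor; this is its mirror image, on which
  -- commutativity rests.
  ⊛-sucʳ : ∀ n f g → (f ⊛ g) (suc n) ≡ f (suc n) ℤ.* g 0 ℤ.+ (f ⊛ g ∘ suc) n
  ⊛-sucʳ zero    f g = ℤ.+-comm (f 0 ℤ.* g 1) (f 1 ℤ.* g 0)
  ⊛-sucʳ (suc n) f g = ≡.trans (≡.cong (ℤ._+_ (f 0 ℤ.* g (suc (suc n)))) (⊛-sucʳ n (f ∘ suc) g))
    (solve 3 (λ a b c → a :+ (b :+ c) := b :+ (a :+ c)) ≡.refl (f 0 ℤ.* g (suc (suc n))) (f (suc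
        (suc n)) ℤ.* g 0) ((f ∘ suc ⊛ g ∘ suc) n))

  ⊛-comm : ∀ n f g → (f ⊛ g) n ≡ (g ⊛ f) n
  ⊛-comm zero    f g = ℤ.*-comm (f 0) (g 0)
  ⊛-comm (suc n) f g = ≡.trans (≡.cong₂ ℤ._+_ (ℤ.*-comm (f 0) (g (suc n))) (⊛-comm n (f ∘ suc) g)) (≡.sym
      (⊛-sucʳ n g f))

  ⊛-distribʳ : ∀ n h f g → ((λ i → f i ℤ.+ g i) ⊛ h) n ≡ (f ⊛ h) n ℤ.+ (g ⊛ h) n
  ⊛-distribʳ zero    h f g = ℤ.*-distribʳ-+ (h 0) (f 0) (g 0)
  ⊛-distribʳ (suc n) h f g = ≡.trans (≡.cong (ℤ._+_ ((f 0 ℤ.+ g 0) ℤ.* h (suc n))) (⊛-distribʳ n h (f ∘ suc)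
      (g ∘ suc)))
    (solve 5 (λ a b x y z → (a :+ b) :* x :+ (y :+ z) := (a :* x :+ y) :+ (b :* x :+ z)) ≡.refl (f 0) (g 0) (h
        (suc n)) ((f ∘ suc ⊛ h) n) ((g ∘ suc ⊛ h) n))

  ⊛-scale : ∀ n k f g → ((λ i → k ℤ.* f i) ⊛ g) n ≡ k ℤ.* (f ⊛ g) n
  ⊛-scale zero    k f g = ℤ.*-assoc k (f 0) (g 0)
  ⊛-scale (suc n) k f g = ≡.trans (≡.cong (ℤ._+_ (k ℤ.* f 0 ℤ.* g (suc n))) (⊛-scale n k (f ∘ suc) g))
    (solve 4 (λ k a b c → k :* a :* b :+ k :* c := k :* (a :* b :+ c)) ≡.refl k (f 0) (g (suc n)) ((f ∘ suc ⊛ g) n))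

  ⊛-assoc : ∀ n f g h → (f ⊛ g ⊛ h) n ≡ (f ⊛ (g ⊛ h)) n
  ⊛-assoc zero    f g h = ℤ.*-assoc (f 0) (g 0) (h 0)
  ⊛-assoc (suc n) f g h = begin
    f 0 ℤ.* g 0 ℤ.* h (suc n) ℤ.+ ((λ i → f 0 ℤ.* g (suc i) ℤ.+ (f ∘ suc ⊛ g) i) ⊛ h) n
      ≡⟨ ≡.cong (ℤ._+_ (f 0 ℤ.* g 0 ℤ.* h (suc n))) (≡.trans (⊛-distribʳ n h _ (f ∘ suc ⊛ g))
           (≡.cong₂ ℤ._+_ (⊛-scale n (f 0) (g ∘ suc) h) (⊛-assoc n (f ∘ suc) g h))) ⟩
    f 0 ℤ.* g 0 ℤ.* h (suc n) ℤ.+ (f 0 ℤ.* (g ∘ suc ⊛ h) n ℤ.+ (f ∘ suc ⊛ (g ⊛ h)) n)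
      ≡⟨ solve 5 (λ a b c x y → a :* b :* c :+ (a :* x :+ y) := a :* (b :* c :+ x) :+ y) ≡.refl (f 0) (g 0) (h
          (suc n)) ((g ∘ suc ⊛ h) n) ((f ∘ suc ⊛ (g ⊛ h)) n) ⟩
    (f ⊛ (g ⊛ h)) (suc n) ∎

  ⊛-zeroˡ : ∀ n f g → (∀ i → f i ≡ 0ℤ) → (f ⊛ g) n ≡ 0ℤ
  ⊛-zeroˡ zero    f g f≡0 = ≡.cong (ℤ._* g 0) (f≡0 0)
  ⊛-zeroˡ (suc n) f g f≡0 = ≡.cong₂ ℤ._+_ (≡.cong (ℤ._* g (suc n)) (f≡0 0)) (⊛-zeroˡ n (f ∘ suc) g (f≡0 ∘ suc))

  ⊛-constantˡ : ∀ n k f → (constant k ⊛ f) n ≡ k ℤ.* f n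
  ⊛-constantˡ zero    k f = ≡.refl
  ⊛-constantˡ (suc n) k f = ≡.trans (≡.cong (ℤ._+_ (k ℤ.* f (suc n))) (⊛-zeroˡ n (λ _ → 0ℤ) f λ _ → ≡.refl))
      (ℤ.+-identityʳ _)

  X⊛-suc : ∀ n f → (X ⊛ f) (suc n) ≡ f n
  X⊛-suc n f = ≡.trans (ℤ.+-identityˡ _) (≡.trans (⊛-constantˡ n 1ℤ f) (ℤ.*-identityˡ (f n)))

  module _ (M : ℕ) where
    infix 4 _≋_
    -- Congruence modulo X^M. The operations act on whole series and only the equality is truncated,
    -- so the same series `X` and `periodic k 0` serve for every M.
    _≋_ : Series → Series → Set
    f ≋ g = ∀ n → n ℕ.< M → f n ≡ g n

    private
      everywhere : ∀ {f g : Series} → (∀ n → f n ≡ g n) → f ≋ g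
      everywhere eq n _ = eq n

      ⊛-identityˡ : ∀ n f → (constant 1ℤ ⊛ f) n ≡ f n
      ⊛-identityˡ n f = ≡.trans (⊛-constantˡ n 1ℤ f) (ℤ.*-identityˡ (f n))

    truncated : CommutativeRing 0ℓ 0ℓ
    truncated = record
      { Carrier = Series
      ; _≈_ = _≋_
      ; _+_ = λ f g n → f n ℤ.+ g n
      ; _*_ = _⊛_
      ; -_ = λ f n → ℤ.- f n
      ; 0# = λ _ → 0ℤ
      ; 1# = constant 1ℤ
      ; isCommutativeRing = record
        { isRing = record
          { +-isAbelianGroup = record
            { isGroup = record
              { isMonoid = record
                { isSemigroup = record
                  { isMagma = record
                    { isEquivalence = record
                      { refl = λ _ _ → ≡.refl
                      ; sym = λ eq n n<M → ≡.sym (eq n n<M)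
                      ; trans = λ eq eq′ n n<M → ≡.trans (eq n n<M) (eq′ n n<M) }
                    ; ∙-cong = λ eq eq′ n n<M → ≡.cong₂ ℤ._+_ (eq n n<M) (eq′ n n<M) }
                  ; assoc = λ f g h → everywhere λ n → ℤ.+-assoc (f n) (g n) (h n) }
                ; identity = (λ f → everywhere λ n → ℤ.+-identityˡ (f n)) , (λ f → everywhere λ n → ℤ.+-identityʳ
                    (f n)) }
              ; inverse = (λ f → everywhere λ n → ℤ.+-inverseˡ (f n)) , (λ f → everywhere λ n → ℤ.+-inverseʳ (f n))
              ; ⁻¹-cong = λ eq n n<M → ≡.cong ℤ.-_ (eq n n<M) }
            ; comm = λ f g → everywhere λ n → ℤ.+-comm (f n) (g n) }
          ; *-cong = λ eq eq′ n n<M → ⊛-cong n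
              (λ i i≤n → eq i (ℕ.≤-<-trans i≤n n<M)) (λ i i≤n → eq′ i (ℕ.≤-<-trans i≤n n<M))
          ; *-assoc = λ f g h → everywhere λ n → ⊛-assoc n f g h
          ; *-identity = (λ f → everywhere λ n → ⊛-identityˡ n f)
              , (λ f → everywhere λ n → ≡.trans (⊛-comm n f _) (⊛-identityˡ n f))
          ; distrib = (λ h f g → everywhere λ n → ≡.trans (⊛-comm n h _)
                (≡.trans (⊛-distribʳ n h f g) (≡.cong₂ ℤ._+_ (⊛-comm n f h) (⊛-comm n g h))))
              , (λ h f g → everywhere λ n → ⊛-distribʳ n h f g) }
        ; *-comm = λ f g → everywhere λ n → ⊛-comm n f g } }

    open import Algebra.Properties.Semiring.Exp (CommutativeRing.semiring truncated) using (_^_)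

    X^-diagonal : ∀ k → (X ^ k) k ≡ 1ℤ
    X^-diagonal zero    = ≡.refl
    X^-diagonal (suc k) = ≡.trans (X⊛-suc k (X ^ k)) (X^-diagonal k)

    X^-offDiagonal : ∀ k {n} → n ≡.≢ k → (X ^ k) n ≡ 0ℤ
    X^-offDiagonal zero    {zero}  n≢k = contradiction ≡.refl n≢k
    X^-offDiagonal zero    {suc n} n≢k = ≡.refl
    X^-offDiagonal (suc k) {zero}  n≢k = ≡.refl
    X^-offDiagonal (suc k) {suc n} n≢k = ≡.trans (X⊛-suc n (X ^ k)) (X^-offDiagonal k (n≢k ∘ ≡.cong suc))

    X^M≋0 : X ^ M ≋ λ _ → 0ℤ
    X^M≋0 n n<M = X^-offDiagonal M (ℕ.<⇒≢ n<M)

    -1^ : ∀ a n → ((λ i → ℤ.- constant 1ℤ i) ^ a) n ≡ constant (ℤ.-1ℤ ℤ.^ a) n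
    -1^ zero    n = ≡.refl
    -1^ (suc a) n = begin
      ((λ i → ℤ.- constant 1ℤ i) ⊛ ((λ i → ℤ.- constant 1ℤ i) ^ a)) n
        ≡⟨ ⊛-cong n (λ i _ → negate i) (λ i _ → -1^ a i) ⟩
      (constant ℤ.-1ℤ ⊛ constant (ℤ.-1ℤ ℤ.^ a)) n  ≡⟨ ⊛-constantˡ n ℤ.-1ℤ _ ⟩
      ℤ.-1ℤ ℤ.* constant (ℤ.-1ℤ ℤ.^ a) n  ≡⟨ multiply n ⟩
      constant (ℤ.-1ℤ ℤ.^ suc a) n ∎
      where
      negate : ∀ i → ℤ.- constant 1ℤ i ≡ constant ℤ.-1ℤ i
      negate zero    = ≡.refl
      negate (suc i) = ≡.refl
      multiply : ∀ n → ℤ.-1ℤ ℤ.* constant (ℤ.-1ℤ ℤ.^ a) n ≡ constant (ℤ.-1ℤ ℤ.^ suc a) n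
      multiply zero    = ≡.refl
      multiply (suc n) = ≡.refl

    -- X^c / (1 - X^(k+1)), the first argument after k counting down to the next coefficient 1.
    periodic : ℕ → ℕ → Series
    periodic k zero    zero    = 1ℤ
    periodic k (suc c) zero    = 0ℤ
    periodic k zero    (suc n) = periodic k k n
    periodic k (suc c) (suc n) = periodic k c n

    X^⊛periodic : ∀ k c n → (X ^ c ⊛ periodic k 0) n ≡ periodic k c n
    X^⊛periodic k zero    n       = ⊛-identityˡ n (periodic k 0)
    X^⊛periodic k (suc c) zero    = ≡.refl
    X^⊛periodic k (suc c) (suc n) = ≡.trans (⊛-assoc (suc n) X (X ^ c) (periodic k 0))
      (≡.trans (X⊛-suc n (X ^ c ⊛ periodic k 0)) (X^⊛periodic k c n))

    -- Multiplication by X^(k+1) delays the sequence by one full period, which changes only the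
    -- constant term.
    periodic-inverse : ∀ k → ((λ n → constant 1ℤ n ℤ.+ ℤ.- (X ^ suc k) n) ⊛ periodic k 0) ≋ constant 1ℤ
    periodic-inverse k n _ = begin
      ((λ n → constant 1ℤ n ℤ.+ ℤ.- (X ^ suc k) n) ⊛ periodic k 0) n
        ≡⟨ ⊛-distribʳ n (periodic k 0) (constant 1ℤ) _ ⟩
      (constant 1ℤ ⊛ periodic k 0) n ℤ.+ ((λ n → ℤ.- (X ^ suc k) n) ⊛ periodic k 0) n
        ≡⟨ ≡.cong₂ ℤ._+_ (⊛-identityˡ n (periodic k 0))
             (≡.trans (⊛-cong n (λ i _ → ≡.sym (ℤ.-1*i≡-i ((X ^ suc k) i))) (λ _ _ → ≡.refl)) (⊛-scale n ℤ.-1ℤ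
                 (X ^ suc k) (periodic k 0))) ⟩
      periodic k 0 n ℤ.+ ℤ.-1ℤ ℤ.* (X ^ suc k ⊛ periodic k 0) n
        ≡⟨ ≡.cong (λ i → periodic k 0 n ℤ.+ ℤ.-1ℤ ℤ.* i) (X^⊛periodic k (suc k) n) ⟩
      periodic k 0 n ℤ.+ ℤ.-1ℤ ℤ.* periodic k (suc k) n  ≡⟨ step n ⟩
      constant 1ℤ n ∎
      where
      step : ∀ n → periodic k 0 n ℤ.+ ℤ.-1ℤ ℤ.* periodic k (suc k) n ≡ constant 1ℤ n
      step zero    = ≡.refl
      step (suc n) = ≡.trans (≡.cong (ℤ._+_ (periodic k k n)) (ℤ.-1*i≡-i (periodic k k n))) (ℤ.+-inverseʳ
          (periodic k k n))

-- From power series to arbitrary rings: only monomials of high degree survive.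

Monomial : Set
Monomial = ℕ × ℕ

-- (a , w) stands for (-1)^a t^w.
partitionMonomials heckeMonomials₊ heckeMonomials₋ errorMonomials : ℕ → List Monomial
partitionMonomials b = map (λ p → largest (proj₁ p) , 2 ℕ.* total p) (box b)
heckeMonomials₊ b = map (λ w → 1 , w) (concatMap heckeExponents (upTo (suc b)))
heckeMonomials₋ b = map (λ w → suc w , w) (concatMap heckeExponents (upTo (suc b)))
errorMonomials b = (partitionMonomials b ++ partitionMonomials b) ++ (heckeMonomials₊ b ++ heckeMonomials₋ b)

module Monomials {a ℓ} (R : CommutativeRing a ℓ) where
  open CommutativeRing R hiding (zero)
  open IntegerCoefficients R
  open FiniteSums R
  open ListSums R
  open TruncatedIdentity R
  open import Algebra.Properties.CommutativeSemiring.Exp commutativeSemiring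
    using (_^_; ^-assocʳ; ^-congˡ; ^-distrib-*)
  open import Relation.Binary.Reasoning.Setoid setoid

  monomial : Carrier → Monomial → Carrier
  monomial t (a , w) = (- 1#) ^ a * t ^ w

  error : Carrier → ℕ → Carrier
  error t b = (1# + 1#) * Σˡ (box b) (partitionTerm (t * t))
    - (Σˡ (upTo (suc b)) (heckeTerm t) + Σˡ (upTo (suc b)) (heckeTerm (- t)))

  neg^ : ∀ t n → (- t) ^ n ≈ (- 1#) ^ n * t ^ n
  neg^ t n = trans (^-congˡ n (solve 1 (λ t → :- t := (:- :1) :* t) refl t)) (^-distrib-* (- 1#) t n)

  -- The partition monomials occur twice in place of the coefficient 2. The Hecke monomials are
  -- subtracted, hence the sign exponent 1; for -t the sign (-1)^w joins it, hence `suc w`.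
  error-expand : ∀ t b → error t b ≈ Σˡ (errorMonomials b) (monomial t)
  error-expand t b = begin
    error t b
      ≈⟨ solve 3 (λ x y z → (:1 :+ :1) :* x :- (y :+ z) := (x :+ x) :+ ((:- :1) :* y :+ (:- :1) :* z)) refl p h₊ h₋ ⟩
    (p + p) + (- 1# * h₊ + - 1# * h₋)
      ≈⟨ +-cong (+-cong p≈ p≈) (+-cong (h≈ t (λ _ → 1) λ w → *-congʳ (sym (*-identityʳ _))) (h≈ (- t) suc λ w →
          trans (*-congˡ (neg^ t w)) (sym (*-assoc _ _ _)))) ⟩
    (p′ + p′) + (Σˡ (heckeMonomials₊ b) (monomial t) + Σˡ (heckeMonomials₋ b) (monomial t))
      ≈⟨ trans (Σˡ-++ (partitionMonomials b ++ partitionMonomials b) (heckeMonomials₊ b ++ heckeMonomials₋ b)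
          (monomial t))
           (+-cong (Σˡ-++ (partitionMonomials b) (partitionMonomials b) (monomial t)) (Σˡ-++ (heckeMonomials₊ b)
               (heckeMonomials₋ b) (monomial t))) ⟨
    Σˡ (errorMonomials b) (monomial t) ∎
    where
    heckes = concatMap heckeExponents (upTo (suc b))
    p = Σˡ (box b) (partitionTerm (t * t))
    h₊ = Σˡ (upTo (suc b)) (heckeTerm t)
    h₋ = Σˡ (upTo (suc b)) (heckeTerm (- t))
    p′ = Σˡ (partitionMonomials b) (monomial t)

    p≈ : p ≈ p′
    p≈ = trans (Σˡ-cong′ (box b) λ x → *-congˡ (trans (^-congˡ (total x) (*-congˡ (sym (*-identityʳ t))))
        (^-assocʳ t 2 (total x))))
      (reflexive (≡.sym (Σˡ-map _ (box b) (monomial t))))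

    h≈ : ∀ s (f : ℕ → ℕ) → (∀ w → - 1# * s ^ w ≈ monomial t (f w , w)) →
      - 1# * Σˡ (upTo (suc b)) (heckeTerm s) ≈ Σˡ (map (λ w → f w , w) heckes) (monomial t)
    h≈ s f sign = begin
      - 1# * Σˡ (upTo (suc b)) (heckeTerm s)
        ≈⟨ *-congˡ (trans (Σˡ-cong′ (upTo (suc b)) (heckeTerm-expand s)) (sym (Σˡ-concatMap heckeExponents (upTo
            (suc b)) (s ^_)))) ⟩
      - 1# * Σˡ heckes (s ^_)  ≈⟨ Σˡ-*ˡ heckes (- 1#) (s ^_) ⟨
      Σˡ heckes (λ w → - 1# * s ^ w)  ≈⟨ Σˡ-cong′ heckes sign ⟩
      Σˡ heckes (λ w → monomial t (f w , w))  ≡⟨ Σˡ-map _ heckes (monomial t) ⟨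
      Σˡ (map (λ w → f w , w) heckes) (monomial t) ∎

  ι-sign : ∀ a → ι (ℤ.-1ℤ ℤ.^ a) ≈ (- 1#) ^ a
  ι-sign zero    = refl
  ι-sign (suc a) = trans (ι-* ℤ.-1ℤ (ℤ.-1ℤ ℤ.^ a)) (*-congˡ (ι-sign a))

module Truncation {a ℓ} (R : CommutativeRing a ℓ) where
  open CommutativeRing R hiding (zero)
  open IntegerCoefficients R
  open FiniteSums R
  open ListSums R
  open Monomials R
  open PowerSeries using (Series; truncated; constant; X; X^-diagonal; X^-offDiagonal; X^M≋0; -1^; ⊛-cong;
      ⊛-constantˡ; periodic; periodic-inverse)
  open import Algebra.Properties.CommutativeSemiring.Exp commutativeSemiring using (_^_)
  open import Relation.Binary.Reasoning.Setoid setoid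

  module _ (M : ℕ) where
    coefficients : List Monomial → Series
    coefficients xs = ListSums.Σˡ (truncated M) xs (Monomials.monomial (truncated M) X)

    open import Algebra.Properties.Semiring.Exp (CommutativeRing.semiring (truncated M)) using () renaming (_^_ to _^ˢ_)

    monomial-coefficient : ∀ a w n → Monomials.monomial (truncated M) X (a , w) n ≡ ℤ.-1ℤ ℤ.^ a ℤ.* (X ^ˢ w) n
    monomial-coefficient a w n = ≡.trans (⊛-cong n (λ i _ → -1^ M a i) (λ _ _ → ≡.refl)) (⊛-constantˡ n _ (X ^ˢ w))

    module _ (t : Carrier) where
      -- Truncation makes this additive but not multiplicative. Additivity suffices, since it is
      -- applied to sums of monomials.
      evaluate : Series → Carrier
      evaluate f = sum< M (λ n → ι (f n) * t ^ n)

      offDiagonal : ∀ x {w n} → n ≡.≢ w → ι (Monomials.monomial (truncated M) X (x , w) n) * t ^ n ≈ 0#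
      offDiagonal x {w} {n} n≢w = trans (*-congʳ (reflexive (≡.cong ι (≡.trans (monomial-coefficient x w n)
        (≡.trans (≡.cong (ℤ.-1ℤ ℤ.^ x ℤ.*_) (X^-offDiagonal M w n≢w)) (ℤ.*-zeroʳ (ℤ.-1ℤ ℤ.^ x))))))) (zeroˡ _)

      evaluate-low : ∀ {x w} → w ℕ.< M → evaluate (Monomials.monomial (truncated M) X (x , w)) ≈ monomial t (x , w)
      evaluate-low {x} {w} w<M = trans (sum<-single M w<M λ n → offDiagonal x)
        (*-congʳ (trans (reflexive (≡.cong ι (≡.trans (monomial-coefficient x w w)
          (≡.trans (≡.cong (ℤ.-1ℤ ℤ.^ x ℤ.*_) (X^-diagonal M w)) (ℤ.*-identityʳ (ℤ.-1ℤ ℤ.^ x)))))) (ι-sign x)))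

      evaluate-high : ∀ {x w} → M ℕ.≤ w → evaluate (Monomials.monomial (truncated M) X (x , w)) ≈ 0#
      evaluate-high {x} M≤w = trans (sum<-cong M λ n n<M → offDiagonal x (ℕ.<⇒≢ (ℕ.<-≤-trans n<M M≤w))) (sum<-zero M)

      high? : ∀ (x : Monomial) → Dec (M ℕ.≤ proj₂ x)
      high? x = M ℕ.≤? proj₂ x

      -- A monomial of degree below M is recovered from its coefficient; one of degree at least M is
      -- invisible to `evaluate` and stays in the filtered list.
      collect : ∀ xs → Σˡ xs (monomial t) ≈ evaluate (coefficients xs) + Σˡ (filter high? xs) (monomial t)
      collect [] = sym (trans (+-identityʳ _) (trans (sum<-cong M λ n _ → zeroˡ (t ^ n)) (sum<-zero M)))
      collect (x ∷ xs) = trans (+-congˡ (collect xs)) (trans (step (M ℕ.≤? proj₂ x)) (+-congʳ (sym split)))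
        where
        E = evaluate (Monomials.monomial (truncated M) X x)

        split : evaluate (coefficients (x ∷ xs)) ≈ E + evaluate (coefficients xs)
        split = trans (sum<-cong M λ n _ → trans (*-congʳ (ι-+ (Monomials.monomial (truncated M) X x n)
            (coefficients xs n))) (distribʳ _ _ _)) (sum<-+ M _ _)

        step : Dec (M ℕ.≤ proj₂ x) →
          monomial t x + (evaluate (coefficients xs) + Σˡ (filter high? xs) (monomial t))
          ≈ (E + evaluate (coefficients xs)) + Σˡ (filter high? (x ∷ xs)) (monomial t)
        step (yes M≤w) = begin
          m + (e + h)  ≈⟨ solve 3 (λ m e h → m :+ (e :+ h) := (:0 :+ e) :+ (m :+ h)) refl m e h ⟩
          (0# + e) + (m + h)
            ≈⟨ +-cong (+-congʳ (sym (evaluate-high {proj₁ x} M≤w))) (reflexive (≡.cong (λ ys → Σˡ ys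
                (monomial t)) (≡.sym (List.filter-accept high? {x} {xs} M≤w)))) ⟩
          (E + e) + Σˡ (filter high? (x ∷ xs)) (monomial t) ∎
          where
          m = monomial t x
          e = evaluate (coefficients xs)
          h = Σˡ (filter high? xs) (monomial t)
        step (no M≰w) = begin
          m + (e + h)  ≈⟨ +-assoc m e h ⟨
          (m + e) + h
            ≈⟨ +-cong (+-congʳ (sym (evaluate-low {proj₁ x} (ℕ.≰⇒> M≰w)))) (reflexive (≡.cong (λ ys → Σˡ ys
                (monomial t)) (≡.sym (List.filter-reject high? {x} {xs} M≰w)))) ⟩
          (E + e) + Σˡ (filter high? (x ∷ xs)) (monomial t) ∎
          where
          m = monomial t x
          e = evaluate (coefficients xs)
          h = Σˡ (filter high? xs) (monomial t)

  -- The truncated identity at t = X, where 1/(1 - X^(k+1)) is a periodic sequence and X^(b+1) is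
  -- zero.
  errorCoefficients-vanish : ∀ b n → n ℕ.< suc b → coefficients (suc b) (errorMonomials b) n ≡ 0ℤ
  errorCoefficients-vanish b = S.trans (S.sym (Monomials.error-expand T X b))
    (S.trans (S.+-congʳ (TruncatedIdentity.truncatedIdentity T X (λ k → periodic (suc b) k 0) (periodic-inverse
        (suc b)) b (X^M≋0 (suc b))))
      (S.-‿inverseʳ (ListSums.Σˡ T (upTo (suc b)) (ListSums.heckeTerm T X)
        S.+ ListSums.Σˡ T (upTo (suc b)) (ListSums.heckeTerm T (S.- X)))))
    where
    T = truncated (suc b)
    module S = CommutativeRing T

  -- Valid for every t in every commutative ring, although the identity behind it needs inverses and
  -- t^(b+1) = 0: only integer coefficients are carried over.
  error-tail : ∀ t b → error t b ≈ Σˡ (filter (high? (suc b) t) (errorMonomials b)) (monomial t)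
  error-tail t b = begin
    error t b  ≈⟨ trans (error-expand t b) (collect (suc b) t (errorMonomials b)) ⟩
    evaluate (suc b) t (coefficients (suc b) (errorMonomials b)) + Σˡ (filter (high? (suc b) t)
        (errorMonomials b)) (monomial t)
      ≈⟨ +-congʳ (trans (sum<-cong (suc b) λ n n<b → trans (*-congʳ (reflexive (≡.cong ι
          (errorCoefficients-vanish b n n<b)))) (zeroˡ _)) (sum<-zero (suc b))) ⟩
    0# + Σˡ (filter (high? (suc b) t) (errorMonomials b)) (monomial t)  ≈⟨ +-identityˡ _ ⟩
    Σˡ (filter (high? (suc b) t) (errorMonomials b)) (monomial t) ∎

-- Rational estimates: powers, geometric series and products.

module Rationals where
  open import Algebra.Properties.Semiring.Exp (CommutativeRing.semiring ℚ.+-*-commutativeRing) public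
    using (_^_; ^-homo-*; ^-assocʳ)
  open FiniteSums ℚ.+-*-commutativeRing public using (sum<)
  open ListSums ℚ.+-*-commutativeRing public
  open ℚ-Solver
  open ℚ.≤-Reasoning

  0≤1 : 0ℚ ℚ.≤ 1ℚ
  0≤1 = ℚ.nonNegative⁻¹ 1ℚ

  *-monoˡ : ∀ {a b c} → 0ℚ ℚ.≤ c → a ℚ.≤ b → c ℚ.* a ℚ.≤ c ℚ.* b
  *-monoˡ {c = c} 0≤c = ℚ.*-monoˡ-≤-nonNeg c {{ℚ.nonNegative 0≤c}}

  *-monoʳ : ∀ {a b c} → 0ℚ ℚ.≤ c → a ℚ.≤ b → a ℚ.* c ℚ.≤ b ℚ.* c
  *-monoʳ {c = c} 0≤c = ℚ.*-monoʳ-≤-nonNeg c {{ℚ.nonNegative 0≤c}}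

  *-mono : ∀ {a b c d} → 0ℚ ℚ.≤ b → 0ℚ ℚ.≤ c → a ℚ.≤ b → c ℚ.≤ d → a ℚ.* c ℚ.≤ b ℚ.* d
  *-mono 0≤b 0≤c a≤b c≤d = ℚ.≤-trans (*-monoʳ 0≤c a≤b) (*-monoˡ 0≤b c≤d)

  0≤* : ∀ {a b} → 0ℚ ℚ.≤ a → 0ℚ ℚ.≤ b → 0ℚ ℚ.≤ a ℚ.* b
  0≤* {a} {b} 0≤a 0≤b = ≡.subst (ℚ._≤ a ℚ.* b) (ℚ.*-zeroʳ a) (*-monoˡ 0≤a 0≤b)

  0≤+ : ∀ {a b} → 0ℚ ℚ.≤ a → 0ℚ ℚ.≤ b → 0ℚ ℚ.≤ a ℚ.+ b
  0≤+ = ℚ.+-mono-≤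

  0<* : ∀ {a b} → 0ℚ ℚ.< a → 0ℚ ℚ.< b → 0ℚ ℚ.< a ℚ.* b
  0<* {a} {b} 0<a 0<b = ≡.subst (ℚ._< a ℚ.* b) (ℚ.*-zeroʳ a) (ℚ.*-monoʳ-<-pos a {{ℚ.positive 0<a}} 0<b)

  ≤-gap : ∀ {a b} c → 0ℚ ℚ.≤ c → b ≡ a ℚ.+ c → a ℚ.≤ b
  ≤-gap {a} c 0≤c b≡ = ≡.subst₂ ℚ._≤_ (ℚ.+-identityʳ a) (≡.sym b≡) (ℚ.+-monoʳ-≤ a 0≤c)

  ≤⇒0≤- : ∀ {a b} → a ℚ.≤ b → 0ℚ ℚ.≤ b ℚ.- a
  ≤⇒0≤- {a} {b} a≤b = ≡.subst (ℚ._≤ b ℚ.- a) (ℚ.+-inverseʳ a) (ℚ.+-monoˡ-≤ (ℚ.- a) a≤b)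

  -- Replaces square roots: a bound on the squared modulus becomes one on the norm.
  square-cancel-≤ : ∀ {a b} → 0ℚ ℚ.≤ b → a ℚ.* a ℚ.≤ b ℚ.* b → a ℚ.≤ b
  square-cancel-≤ {a} {b} 0≤b aa≤bb with a ℚ.≤? b
  ... | yes a≤b = a≤b
  ... | no a≰b = contradiction (begin-strict
      b ℚ.* b  ≤⟨ *-monoˡ 0≤b (ℚ.<⇒≤ b<a) ⟩
      b ℚ.* a  <⟨ ℚ.*-monoˡ-<-pos a {{ℚ.positive (ℚ.≤-<-trans 0≤b b<a)}} b<a ⟩
      a ℚ.* a  ≤⟨ aa≤bb ⟩
      b ℚ.* b ∎) (ℚ.<-irrefl ≡.refl)
    where b<a = ℚ.≰⇒> a≰b

  0≤^ : ∀ {a} n → 0ℚ ℚ.≤ a → 0ℚ ℚ.≤ a ^ n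
  0≤^ zero    0≤a = 0≤1
  0≤^ (suc n) 0≤a = 0≤* 0≤a (0≤^ n 0≤a)

  ^-monoˡ : ∀ {a b} n → 0ℚ ℚ.≤ a → a ℚ.≤ b → a ^ n ℚ.≤ b ^ n
  ^-monoˡ zero    0≤a a≤b = ℚ.≤-refl
  ^-monoˡ (suc n) 0≤a a≤b = *-mono (ℚ.≤-trans 0≤a a≤b) (0≤^ n 0≤a) a≤b (^-monoˡ n 0≤a a≤b)

  natℚ : ℕ → ℚ
  natℚ n = mkℚ (+ n) 0 (Coprimality.sym (1-coprimeTo n))

  natℚ-suc : ∀ n → natℚ (suc n) ≡ 1ℚ ℚ.+ natℚ n
  natℚ-suc n = ℚ.toℚᵘ-injective (ℚᵘ.≃-trans
    (ℚᵘ.*≡* (≡.cong (λ i → (+ 1 ℤ.+ i) ℤ.* + 1) (≡.sym (ℤ.*-identityʳ (+ n)))))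
    (ℚᵘ.≃-sym (ℚ.toℚᵘ-homo-+ 1ℚ (natℚ n))))

  archimedean : ∀ {p} → 0ℚ ℚ.< p → ∃ λ n → 1ℚ ℚ.≤ natℚ n ℚ.* p
  archimedean {p} 0<p = bound (ℚ.1/ p) (ℚ.*-inverseˡ p)
    where
    instance
      p>0 : ℚ.Positive p
      p>0 = ℚ.positive 0<p
      p≢0 : ℚ.NonZero p
      p≢0 = ℚ.pos⇒nonZero p
    bound : ∀ r → r ℚ.* p ≡ 1ℚ → ∃ λ n → 1ℚ ℚ.≤ natℚ n ℚ.* p
    -- A fraction is at most the absolute value of its numerator, as its denominator is at least 1;
    -- so the numerator of 1/p gives the witness.
    bound r@(mkℚ i d-1 _) rp≡1 = ℤ.∣ i ∣ , ≡.subst (ℚ._≤ natℚ ℤ.∣ i ∣ ℚ.* p) rp≡1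
      (*-monoʳ {r} {natℚ ℤ.∣ i ∣} (ℚ.<⇒≤ 0<p) (ℚ.*≤* (ℤ.≤-trans (ℤ.*-monoʳ-≤-nonNeg (+ 1) (i≤∣i∣ i))
        (ℤ.*-monoˡ-≤-nonNeg (+ ℤ.∣ i ∣) {+ 1} {+ suc d-1} (ℤ.+≤+ (s≤s z≤n))))))
      where
      i≤∣i∣ : ∀ i → i ℤ.≤ + ℤ.∣ i ∣
      i≤∣i∣ (+ n) = ℤ.≤-refl
      i≤∣i∣ ℤ.-[1+ n ] = ℤ.-≤+

  module Geometric (σ δ : ℚ) (0≤σ : 0ℚ ℚ.≤ σ) (0<δ : 0ℚ ℚ.< δ) (σ+δ≡1 : σ ℚ.+ δ ≡ 1ℚ) where
    0≤δ : 0ℚ ℚ.≤ δ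
    0≤δ = ℚ.<⇒≤ 0<δ

    δ≡1-σ : δ ≡ 1ℚ ℚ.- σ
    δ≡1-σ = ≡.trans (solve 2 (λ s d → d := (s :+ d) :- s) ≡.refl σ δ) (≡.cong (ℚ._- σ) σ+δ≡1)

    σ≤1 : σ ℚ.≤ 1ℚ
    σ≤1 = ≤-gap δ 0≤δ (≡.sym σ+δ≡1)

    ^-antitone : ∀ {m n} → m ℕ.≤ n → σ ^ n ℚ.≤ σ ^ m
    ^-antitone {zero} {zero}  z≤n       = ℚ.≤-refl
    ^-antitone {zero} {suc n} z≤n       = *-mono 0≤1 (0≤^ n 0≤σ) σ≤1 (^-antitone {zero} {n} z≤n)
    ^-antitone (s≤s m≤n) = *-monoˡ 0≤σ (^-antitone m≤n)

    -- Bernoulli's inequality without division. The induction uses (1 - δ)(1 + (n+1)δ) = 1 + nδ -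
    -- (n+1)δ²; `rest` is the discarded nonnegative part.
    bernoulli : ∀ n → σ ^ n ℚ.* (1ℚ ℚ.+ natℚ n ℚ.* δ) ℚ.≤ 1ℚ
    bernoulli zero = ℚ.≤-reflexive (solve 1 (λ d → con 1ℚ :* (con 1ℚ :+ con 0ℚ :* d) := con 1ℚ) ≡.refl δ)
    bernoulli (suc n) = ℚ.≤-trans
      (≤-gap (σ ^ n ℚ.* (natℚ n ℚ.* δ ℚ.* δ ℚ.+ δ ℚ.* δ)) (0≤* (0≤^ n 0≤σ) (0≤+ (0≤* (0≤* (0≤nat n) 0≤δ) 0≤δ)
          (0≤* 0≤δ 0≤δ)))
        (begin-equality
          σ ^ n ℚ.* (1ℚ ℚ.+ natℚ n ℚ.* δ)
            ≡⟨ solve 3 (λ x d n → x :* (con 1ℚ :+ n :* d) :=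
                 (con 1ℚ :- d) :* x :* (con 1ℚ :+ (con 1ℚ :+ n) :* d) :+ x :* (n :* d :* d :+ d :* d)) ≡.refl
                     (σ ^ n) δ (natℚ n) ⟩
          (1ℚ ℚ.- δ) ℚ.* σ ^ n ℚ.* (1ℚ ℚ.+ (1ℚ ℚ.+ natℚ n) ℚ.* δ) ℚ.+ rest
            ≡⟨ ≡.cong₂ (λ s m → s ℚ.* σ ^ n ℚ.* (1ℚ ℚ.+ m ℚ.* δ) ℚ.+ rest) 1-δ≡σ (≡.sym (natℚ-suc n)) ⟩
          σ ^ suc n ℚ.* (1ℚ ℚ.+ natℚ (suc n) ℚ.* δ) ℚ.+ rest ∎))
      (bernoulli n)
      where
      rest = σ ^ n ℚ.* (natℚ n ℚ.* δ ℚ.* δ ℚ.+ δ ℚ.* δ)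
      1-δ≡σ : 1ℚ ℚ.- δ ≡ σ
      1-δ≡σ = ≡.trans (≡.cong (ℚ._- δ) (≡.sym σ+δ≡1)) (solve 2 (λ s d → (s :+ d) :- d := s) ≡.refl σ δ)
      0≤nat : ∀ n → 0ℚ ℚ.≤ natℚ n
      0≤nat n = ℚ.nonNegative⁻¹ (natℚ n)

    ^-small : ∀ {ε} → 0ℚ ℚ.< ε → ∃ λ n → σ ^ n ℚ.< ε
    -- With nδε at least 1, the assumption ε ≤ σ^n would give ε + nδε ≤ 1 by Bernoulli, although ε >
    -- 0.
    ^-small {ε} 0<ε = let n , 1≤nδε = archimedean {δ ℚ.* ε} (0<* 0<δ 0<ε) in n , ℚ.≰⇒> λ ε≤σ^n → ℚ.<-irrefl ≡.refl (begin-strict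
      1ℚ  ≤⟨ 1≤nδε ⟩
      natℚ n ℚ.* (δ ℚ.* ε)  ≡⟨ ℚ.+-identityˡ _ ⟨
      0ℚ ℚ.+ natℚ n ℚ.* (δ ℚ.* ε)  <⟨ ℚ.+-monoˡ-< (natℚ n ℚ.* (δ ℚ.* ε)) 0<ε ⟩
      ε ℚ.+ natℚ n ℚ.* (δ ℚ.* ε)
        ≡⟨ solve 3 (λ e n d → e :+ n :* (d :* e) := e :* (con 1ℚ :+ n :* d)) ≡.refl ε (natℚ n) δ ⟩
      ε ℚ.* (1ℚ ℚ.+ natℚ n ℚ.* δ)
        ≤⟨ *-monoʳ (0≤+ 0≤1 (0≤* (ℚ.nonNegative⁻¹ (natℚ n)) 0≤δ)) ε≤σ^n ⟩
      σ ^ n ℚ.* (1ℚ ℚ.+ natℚ n ℚ.* δ)  ≤⟨ bernoulli n ⟩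
      1ℚ ∎)

    private instance
      δ>0 : ℚ.Positive δ
      δ>0 = ℚ.positive 0<δ
      δ≢0 : ℚ.NonZero δ
      δ≢0 = ℚ.pos⇒nonZero δ

    γ : ℚ
    γ = ℚ.1/ δ

    0≤γ : 0ℚ ℚ.≤ γ
    0≤γ = ℚ.<⇒≤ (ℚ.positive⁻¹ γ {{ℚ.1/pos⇒pos δ}})

    sum<-nonNeg : ∀ n {f : ℕ → ℚ} → (∀ i → 0ℚ ℚ.≤ f i) → 0ℚ ℚ.≤ sum< n f
    sum<-nonNeg zero    0≤f = ℚ.≤-refl
    sum<-nonNeg (suc n) 0≤f = 0≤+ (sum<-nonNeg n 0≤f) (0≤f n)

    sum<-mono : ∀ n {f g : ℕ → ℚ} → (∀ i → f i ℚ.≤ g i) → sum< n f ℚ.≤ sum< n g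
    sum<-mono zero    f≤g = ℚ.≤-refl
    sum<-mono (suc n) f≤g = ℚ.+-mono-≤ (sum<-mono n f≤g) (f≤g n)

    geometric-≤ : ∀ n → sum< n (σ ^_) ℚ.≤ γ
    geometric-≤ n = begin
      S  ≡⟨ ≡.trans (≡.cong (ℚ._* S) (ℚ.*-inverseˡ δ)) (ℚ.*-identityˡ S) ⟨
      ℚ.1/ δ ℚ.* δ ℚ.* S  ≡⟨ ℚ.*-assoc γ δ S ⟩
      γ ℚ.* (δ ℚ.* S)  ≤⟨ *-monoˡ 0≤γ δS≤1 ⟩
      γ ℚ.* 1ℚ  ≡⟨ ℚ.*-identityʳ γ ⟩
      γ ∎
      where
      S = sum< n (σ ^_)
      δS≤1 : δ ℚ.* S ℚ.≤ 1ℚ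
      δS≤1 = ≤-gap (σ ^ n) (0≤^ n 0≤σ) (begin-equality
        1ℚ  ≡⟨ solve 1 (λ x → con 1ℚ := (con 1ℚ :- x) :+ x) ≡.refl (σ ^ n) ⟩
        1ℚ ℚ.- σ ^ n ℚ.+ σ ^ n  ≡⟨ ≡.cong (ℚ._+ σ ^ n) (TruncatedIdentity.geometric ℚ.+-*-commutativeRing σ n) ⟨
        (1ℚ ℚ.- σ) ℚ.* S ℚ.+ σ ^ n  ≡⟨ ≡.cong (λ d → d ℚ.* S ℚ.+ σ ^ n) δ≡1-σ ⟨
        δ ℚ.* S ℚ.+ σ ^ n ∎)

    -- The value at σ of the generating function of partitions into distinct parts at most b
    -- (`distinct-sum`).
    distinct : ℕ → ℚ
    distinct zero    = 1ℚ
    distinct (suc b) = (1ℚ ℚ.+ σ ^ suc b) ℚ.* distinct b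

    0≤distinct : ∀ b → 0ℚ ℚ.≤ distinct b
    0≤distinct zero    = 0≤1
    0≤distinct (suc b) = 0≤* (0≤+ 0≤1 (0≤^ (suc b) 0≤σ)) (0≤distinct b)

    distinct-suc : ∀ b → distinct b ℚ.≤ distinct (suc b)
    distinct-suc b = ≤-gap (σ ^ suc b ℚ.* distinct b) (0≤* (0≤^ (suc b) 0≤σ) (0≤distinct b))
      (solve 2 (λ x u → (con 1ℚ :+ x) :* u := u :+ x :* u) ≡.refl (σ ^ suc b) (distinct b))

    distinct-mono : ∀ k n → distinct n ℚ.≤ distinct (n ℕ.+ k)
    distinct-mono zero    n = ℚ.≤-reflexive (≡.cong distinct (≡.sym (ℕ.+-identityʳ n)))
    distinct-mono (suc k) n = ℚ.≤-trans (distinct-mono k n)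
      (ℚ.≤-trans (distinct-suc (n ℕ.+ k)) (ℚ.≤-reflexive (≡.cong distinct (≡.sym (ℕ.+-suc n k)))))

    -- ∏ (1 + x) ≤ 1 / (1 - Σ x), started where the sum is at most ½.
    distinct-bounded : ∃ λ C → 0ℚ ℚ.≤ C × ∀ b → distinct b ℚ.≤ C
    distinct-bounded = U ℚ.+ U , 0≤+ (0≤distinct k) (0≤distinct k) , λ b → ℚ.≤-trans (distinct-mono k b) (bound b)
      where
      small : ∃ λ k → σ ^ k ℚ.< ½ ℚ.* δ
      small = ^-small {½ ℚ.* δ} (0<* {½} {δ} (ℚ.positive⁻¹ ½) 0<δ)
      k = proj₁ small
      σ^k<½δ = proj₂ small
      U = distinct k
      T : ℕ → ℚ
      T n = sum< n (λ i → σ ^ suc (i ℕ.+ k))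

      T-nonNeg : ∀ n → 0ℚ ℚ.≤ T n
      T-nonNeg n = sum<-nonNeg n (λ i → 0≤^ (suc (i ℕ.+ k)) 0≤σ)

      product : ∀ n → distinct (n ℕ.+ k) ℚ.* (1ℚ ℚ.- T n) ℚ.≤ U
      product zero = ℚ.≤-reflexive (ℚ.*-identityʳ U)
      product (suc n) = ℚ.≤-trans
        (≤-gap (distinct (n ℕ.+ k) ℚ.* (x ℚ.* (T n ℚ.+ x))) (0≤* (0≤distinct (n ℕ.+ k)) (0≤* 0≤x (0≤+
            (T-nonNeg n) 0≤x)))
          (solve 3 (λ u x t → u :* (con 1ℚ :- t) := (con 1ℚ :+ x) :* u :* (con 1ℚ :- (t :+ x)) :+ u :* (x :*
              (t :+ x)))
            ≡.refl (distinct (n ℕ.+ k)) x (T n)))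
        (product n)
        where
        x = σ ^ suc (n ℕ.+ k)
        0≤x = 0≤^ (suc (n ℕ.+ k)) 0≤σ

      T≤½ : ∀ n → T n ℚ.≤ ½
      T≤½ n = begin
        T n  ≤⟨ sum<-mono n (λ i → ℚ.≤-trans (^-antitone (ℕ.n≤1+n (i ℕ.+ k))) (ℚ.≤-reflexive (≡.trans
            (^-homo-* σ i k) (ℚ.*-comm (σ ^ i) (σ ^ k))))) ⟩
        sum< n (λ i → σ ^ k ℚ.* σ ^ i)  ≡⟨ FiniteSums.sum<-*ˡ ℚ.+-*-commutativeRing n (σ ^ k) (σ ^_) ⟩
        σ ^ k ℚ.* sum< n (σ ^_)  ≤⟨ *-mono (0≤* (ℚ.nonNegative⁻¹ ½) 0≤δ) (sum<-nonNeg n (λ i → 0≤^ i 0≤σ))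
            (ℚ.<⇒≤ σ^k<½δ) (geometric-≤ n) ⟩
        ½ ℚ.* δ ℚ.* γ  ≡⟨ ℚ.*-assoc ½ δ γ ⟩
        ½ ℚ.* (δ ℚ.* γ)  ≡⟨ ≡.cong (½ ℚ.*_) (ℚ.*-inverseʳ δ) ⟩
        ½ ℚ.* 1ℚ  ≡⟨⟩
        ½ ∎

      bound : ∀ n → distinct (n ℕ.+ k) ℚ.≤ U ℚ.+ U
      bound n = begin
        distinct (n ℕ.+ k)
          ≡⟨ solve 1 (λ u → u := u :* con ½ :+ u :* con ½) ≡.refl (distinct (n ℕ.+ k)) ⟩
        distinct (n ℕ.+ k) ℚ.* ½ ℚ.+ distinct (n ℕ.+ k) ℚ.* ½
          ≤⟨ ℚ.+-mono-≤ half half ⟩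
        U ℚ.+ U ∎
        where
        half : distinct (n ℕ.+ k) ℚ.* ½ ℚ.≤ U
        half = ℚ.≤-trans (*-monoˡ (0≤distinct (n ℕ.+ k)) (≤-gap (½ ℚ.- T n) (≤⇒0≤- (T≤½ n))
          (solve 1 (λ t → con 1ℚ :- t := con ½ :+ (con ½ :- t)) ≡.refl (T n)))) (product n)

module _ {A : Set} where
  -- Finite index sets are duplicate-free lists, and sums are invariant under permutation; so an
  -- inclusion of index sets becomes a splitting of sums.
  unique-split : ∀ {xs ys : List A} → Unique xs → xs ⊆ ys → ∃ λ zs → ys ↭ xs ++ zs
  unique-split {[]}     {ys} _ _ = ys , ↭.refl
  unique-split {x ∷ xs} {ys} (x∉xs ∷ xs!) x∷xs⊆ys =
    let us , vs , ys≡ = ∈-∃++ (x∷xs⊆ys (here ≡.refl))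
        ys↭ = ↭.trans (↭.↭-reflexive ys≡) (shift x us vs)
        zs , rest↭ = unique-split xs! (λ {y} y∈xs → drop-head ys↭ (x∷xs⊆ys (there y∈xs)) (λ y≡x →
            All.lookup x∉xs y∈xs (≡.sym y≡x)))
    in zs , ↭.trans ys↭ (↭.prep x rest↭)
    where
    drop-head : ∀ {x y : A} {ys zs} → ys ↭ x ∷ zs → y ∈ ys → y ≡.≢ x → y ∈ zs
    drop-head ys↭ y∈ys y≢x with ↭.∈-resp-↭ ys↭ y∈ys
    ... | here y≡x    = contradiction y≡x y≢x
    ... | there y∈zs = y∈zs

-- Gaussian rationals with the norm |a| + |b|.

module Gaussian where
  open ℚ-Solver

  gaussian : CommutativeRing 0ℓ 0ℓ
  gaussian = record
    { Carrier = ℚ × ℚ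
    ; _≈_ = _≡_
    ; _+_ = λ (a , b) (c , d) → a ℚ.+ c , b ℚ.+ d
    ; _*_ = λ (a , b) (c , d) → a ℚ.* c ℚ.+ ℚ.- (b ℚ.* d) , a ℚ.* d ℚ.+ b ℚ.* c
    ; -_ = λ (a , b) → ℚ.- a , ℚ.- b
    ; 0# = 0ℚ , 0ℚ
    ; 1# = 1ℚ , 0ℚ
    ; isCommutativeRing = record
      { isRing = record
        { +-isAbelianGroup = record
          { isGroup = record
            { isMonoid = record
              { isSemigroup = record
                { isMagma = record { isEquivalence = ≡.isEquivalence ; ∙-cong = ≡.cong₂ _ }
                ; assoc = λ (a , b) (c , d) (e , f) → ≡.cong₂ _,_ (ℚ.+-assoc a c e) (ℚ.+-assoc b d f) }
              ; identity = (λ (a , b) → ≡.cong₂ _,_ (ℚ.+-identityˡ a) (ℚ.+-identityˡ b))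
                , (λ (a , b) → ≡.cong₂ _,_ (ℚ.+-identityʳ a) (ℚ.+-identityʳ b)) }
            ; inverse = (λ (a , b) → ≡.cong₂ _,_ (ℚ.+-inverseˡ a) (ℚ.+-inverseˡ b))
              , (λ (a , b) → ≡.cong₂ _,_ (ℚ.+-inverseʳ a) (ℚ.+-inverseʳ b))
            ; ⁻¹-cong = ≡.cong (λ (a , b) → ℚ.- a , ℚ.- b) }
          ; comm = λ (a , b) (c , d) → ≡.cong₂ _,_ (ℚ.+-comm a c) (ℚ.+-comm b d) }
        ; *-cong = ≡.cong₂ _
        ; *-assoc = λ (a , b) (c , d) (e , f) → ≡.cong₂ _,_
            (solve 6 (λ a b c d e f → (a :* c :+ :- (b :* d)) :* e :+ :- ((a :* d :+ b :* c) :* f)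
              := a :* (c :* e :+ :- (d :* f)) :+ :- (b :* (c :* f :+ d :* e))) ≡.refl a b c d e f)
            (solve 6 (λ a b c d e f → (a :* c :+ :- (b :* d)) :* f :+ (a :* d :+ b :* c) :* e
              := a :* (c :* f :+ d :* e) :+ b :* (c :* e :+ :- (d :* f))) ≡.refl a b c d e f)
        ; *-identity = (λ (a , b) → ≡.cong₂ _,_
              (solve 2 (λ a b → con 1ℚ :* a :+ :- (con 0ℚ :* b) := a) ≡.refl a b)
              (solve 2 (λ a b → con 1ℚ :* b :+ con 0ℚ :* a := b) ≡.refl a b))
            , (λ (a , b) → ≡.cong₂ _,_
              (solve 2 (λ a b → a :* con 1ℚ :+ :- (b :* con 0ℚ) := a) ≡.refl a b)
              (solve 2 (λ a b → a :* con 0ℚ :+ b :* con 1ℚ := b) ≡.refl a b))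
        ; distrib = (λ (a , b) (c , d) (e , f) → ≡.cong₂ _,_
              (solve 6 (λ a b c d e f → a :* (c :+ e) :+ :- (b :* (d :+ f))
                := (a :* c :+ :- (b :* d)) :+ (a :* e :+ :- (b :* f))) ≡.refl a b c d e f)
              (solve 6 (λ a b c d e f → a :* (d :+ f) :+ b :* (c :+ e)
                := (a :* d :+ b :* c) :+ (a :* f :+ b :* e)) ≡.refl a b c d e f))
            , (λ (a , b) (c , d) (e , f) → ≡.cong₂ _,_
              (solve 6 (λ a b c d e f → (c :+ e) :* a :+ :- ((d :+ f) :* b)
                := (c :* a :+ :- (d :* b)) :+ (e :* a :+ :- (f :* b))) ≡.refl a b c d e f)
              (solve 6 (λ a b c d e f → (c :+ e) :* b :+ (d :+ f) :* a
                := (c :* b :+ d :* a) :+ (e :* b :+ f :* a)) ≡.refl a b c d e f)) }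
      ; *-comm = λ (a , b) (c , d) → ≡.cong₂ _,_
          (solve 4 (λ a b c d → a :* c :+ :- (b :* d) := c :* a :+ :- (d :* b)) ≡.refl a b c d)
          (solve 4 (λ a b c d → a :* d :+ b :* c := c :* b :+ d :* a) ≡.refl a b c d) } }

  module G where
    open CommutativeRing gaussian public
    open import Algebra.Properties.CommutativeSemiring.Exp commutativeSemiring public using (_^_; ^-homo-*; ^-assocʳ; ^-distrib-*)
    open ListSums gaussian public
    open TruncatedIdentity gaussian public using (partitionTerm)
    open Monomials gaussian public

  open G using () renaming (Carrier to ℚ[i])
  open Rationals
  open ℚ.≤-Reasoning

  -- The modulus is irrational in general. `norm` is rational and submultiplicative, `sq` is the
  -- squared modulus and multiplicative, and norm² lies between `sq` and 2 `sq`.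
  norm sq : ℚ[i] → ℚ
  norm (a , b) = ℚ.∣ a ∣ ℚ.+ ℚ.∣ b ∣
  sq (a , b) = a ℚ.* a ℚ.+ b ℚ.* b

  0≤norm : ∀ z → 0ℚ ℚ.≤ norm z
  0≤norm (a , b) = 0≤+ (ℚ.0≤∣p∣ a) (ℚ.0≤∣p∣ b)

  norm-neg : ∀ z → norm (G.- z) ≡ norm z
  norm-neg (a , b) = ≡.cong₂ ℚ._+_ (ℚ.∣-p∣≡∣p∣ a) (ℚ.∣-p∣≡∣p∣ b)

  norm-+ : ∀ z w → norm (z G.+ w) ℚ.≤ norm z ℚ.+ norm w
  norm-+ (a , b) (c , d) = ℚ.≤-trans (ℚ.+-mono-≤ (ℚ.∣p+q∣≤∣p∣+∣q∣ a c) (ℚ.∣p+q∣≤∣p∣+∣q∣ b d))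
    (ℚ.≤-reflexive (solve 4 (λ a b c d → (a :+ c) :+ (b :+ d) := (a :+ b) :+
        (c :+ d)) ≡.refl ℚ.∣ a ∣ ℚ.∣ b ∣ ℚ.∣ c ∣ ℚ.∣ d ∣))

  norm-* : ∀ z w → norm (z G.* w) ℚ.≤ norm z ℚ.* norm w
  norm-* (a , b) (c , d) = begin
    ℚ.∣ a ℚ.* c ℚ.+ ℚ.- (b ℚ.* d) ∣ ℚ.+ ℚ.∣ a ℚ.* d ℚ.+ b ℚ.* c ∣
      ≤⟨ ℚ.+-mono-≤ (ℚ.∣p+q∣≤∣p∣+∣q∣ (a ℚ.* c) (ℚ.- (b ℚ.* d))) (ℚ.∣p+q∣≤∣p∣+∣q∣ (a ℚ.* d) (b ℚ.* c)) ⟩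
    (ℚ.∣ a ℚ.* c ∣ ℚ.+ ℚ.∣ ℚ.- (b ℚ.* d) ∣) ℚ.+ (ℚ.∣ a ℚ.* d ∣ ℚ.+ ℚ.∣ b ℚ.* c ∣)
      ≡⟨ ≡.cong₂ ℚ._+_ (≡.cong₂ ℚ._+_ (ℚ.∣p*q∣≡∣p∣*∣q∣ a c) (≡.trans (ℚ.∣-p∣≡∣p∣ (b ℚ.* d)) (ℚ.∣p*q∣≡∣p∣*∣q∣ b d)))
           (≡.cong₂ ℚ._+_ (ℚ.∣p*q∣≡∣p∣*∣q∣ a d) (ℚ.∣p*q∣≡∣p∣*∣q∣ b c)) ⟩
    (ℚ.∣ a ∣ ℚ.* ℚ.∣ c ∣ ℚ.+ ℚ.∣ b ∣ ℚ.* ℚ.∣ d ∣) ℚ.+ (ℚ.∣ a ∣ ℚ.* ℚ.∣ d ∣ ℚ.+ ℚ.∣ b ∣ ℚ.* ℚ.∣ c ∣)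
      ≡⟨ solve 4 (λ a b c d → (a :* c :+ b :* d) :+ (a :* d :+ b :* c) := (a :+ b) :*
          (c :+ d)) ≡.refl ℚ.∣ a ∣ ℚ.∣ b ∣ ℚ.∣ c ∣ ℚ.∣ d ∣ ⟩
    (ℚ.∣ a ∣ ℚ.+ ℚ.∣ b ∣) ℚ.* (ℚ.∣ c ∣ ℚ.+ ℚ.∣ d ∣) ∎

  square-∣∣ : ∀ p → p ℚ.* p ≡ ℚ.∣ p ∣ ℚ.* ℚ.∣ p ∣
  square-∣∣ p = cases (ℚ.∣p∣≡p∨∣p∣≡-p p)
    where
    cases : _ → _
    cases (inj₁ eq) = ≡.sym (≡.cong₂ ℚ._*_ eq eq)
    cases (inj₂ eq) = ≡.trans (solve 1 (λ p → p :* p := (:- p) :* (:- p)) ≡.refl p) (≡.sym (≡.cong₂ ℚ._*_ eq eq))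

  0≤square : ∀ p → 0ℚ ℚ.≤ p ℚ.* p
  0≤square p = ≡.subst (0ℚ ℚ.≤_) (≡.sym (square-∣∣ p)) (0≤* (ℚ.0≤∣p∣ p) (ℚ.0≤∣p∣ p))

  0≤sq : ∀ z → 0ℚ ℚ.≤ sq z
  0≤sq (a , b) = 0≤+ (0≤square a) (0≤square b)

  sq≤norm² : ∀ z → sq z ℚ.≤ norm z ℚ.* norm z
  sq≤norm² (a , b) = ≤-gap (x ℚ.* y ℚ.+ x ℚ.* y) (0≤+ 0≤xy 0≤xy)
    (≡.trans (solve 2 (λ x y → (x :+ y) :* (x :+ y) := (x :* x :+ y :* y) :+ (x :* y :+ x :* y)) ≡.refl x y)
      (≡.cong (ℚ._+ (x ℚ.* y ℚ.+ x ℚ.* y)) (≡.sym (≡.cong₂ ℚ._+_ (square-∣∣ a) (square-∣∣ b)))))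
    where
    x = ℚ.∣ a ∣
    y = ℚ.∣ b ∣
    0≤xy = 0≤* {x} {y} (ℚ.0≤∣p∣ a) (ℚ.0≤∣p∣ b)

  norm²≤2sq : ∀ z → norm z ℚ.* norm z ℚ.≤ sq z ℚ.+ sq z
  norm²≤2sq (a , b) = ≤-gap ((x ℚ.- y) ℚ.* (x ℚ.- y)) (0≤square (x ℚ.- y))
    (≡.trans (≡.cong (λ s → s ℚ.+ s) (≡.cong₂ ℚ._+_ (square-∣∣ a) (square-∣∣ b)))
      (solve 2 (λ x y → (x :* x :+ y :* y) :+ (x :* x :+ y :* y) := (x :+ y) :* (x :+ y) :+ (x :- y) :*
          (x :- y)) ≡.refl x y))
    where
    x = ℚ.∣ a ∣
    y = ℚ.∣ b ∣

  sq-* : ∀ z w → sq (z G.* w) ≡ sq z ℚ.* sq w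
  sq-* (a , b) (c , d) = solve 4 (λ a b c d → (a :* c :+ :- (b :* d)) :* (a :* c :+ :- (b :* d)) :+
      (a :* d :+ b :* c) :* (a :* d :+ b :* c)
    := (a :* a :+ b :* b) :* (c :* c :+ d :* d)) ≡.refl a b c d

  sq-^ : ∀ z n → sq (z G.^ n) ≡ sq z ^ n
  sq-^ z zero    = ≡.refl
  sq-^ z (suc n) = ≡.trans (sq-* z (z G.^ n)) (≡.cong (sq z ℚ.*_) (sq-^ z n))

  -- Submultiplicativity would only give powers of `norm z`, which may exceed 1. Passing through the
  -- multiplicative `sq` keeps the rate ρ and costs a constant factor √2, rounded up to 2.
  norm-^ : ∀ z ρ n → 0ℚ ℚ.≤ ρ → sq z ℚ.≤ ρ ℚ.* ρ → norm (z G.^ n) ℚ.≤ ρ ^ n ℚ.+ ρ ^ n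
  norm-^ z ρ n 0≤ρ sq≤ρ² = square-cancel-≤ (0≤+ 0≤x 0≤x) (begin
    norm (z G.^ n) ℚ.* norm (z G.^ n)  ≤⟨ norm²≤2sq (z G.^ n) ⟩
    sq (z G.^ n) ℚ.+ sq (z G.^ n)  ≤⟨ ℚ.+-mono-≤ sq≤ sq≤ ⟩
    x ℚ.* x ℚ.+ x ℚ.* x  ≤⟨ ≤-gap (x ℚ.* x ℚ.+ x ℚ.* x) (0≤+ (0≤* 0≤x 0≤x) (0≤* 0≤x 0≤x))
        (solve 1 (λ x → (x :+ x) :* (x :+ x) := (x :* x :+ x :* x) :+ (x :* x :+ x :* x)) ≡.refl x) ⟩
    (x ℚ.+ x) ℚ.* (x ℚ.+ x) ∎)
    where
    x = ρ ^ n
    0≤x = 0≤^ n 0≤ρ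
    sq≤ : sq (z G.^ n) ℚ.≤ x ℚ.* x
    sq≤ = begin
      sq (z G.^ n)  ≡⟨ sq-^ z n ⟩
      sq z ^ n  ≤⟨ ^-monoˡ n (0≤sq z) sq≤ρ² ⟩
      (ρ ℚ.* ρ) ^ n  ≡⟨ square-^ n ⟩
      x ℚ.* x ∎
      where
      square-^ : ∀ n → (ρ ℚ.* ρ) ^ n ≡ ρ ^ n ℚ.* ρ ^ n
      square-^ zero    = ≡.refl
      square-^ (suc n) = ≡.trans (≡.cong (ρ ℚ.* ρ ℚ.*_) (square-^ n))
        (solve 2 (λ r x → r :* r :* (x :* x) := r :* x :* (r :* x)) ≡.refl ρ (ρ ^ n))

-- Nonnegative sums and abstract normed rings.

module RationalSums where
  open Rationals

  module _ {A : Set} where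
    Σˡ-mono : ∀ {xs} {f g : A → ℚ} → All (λ x → f x ℚ.≤ g x) xs → Σˡ xs f ℚ.≤ Σˡ xs g
    Σˡ-mono []       = ℚ.≤-refl
    Σˡ-mono (p ∷ ps) = ℚ.+-mono-≤ p (Σˡ-mono ps)

    Σˡ-nonNeg : ∀ xs {f : A → ℚ} → (∀ x → 0ℚ ℚ.≤ f x) → 0ℚ ℚ.≤ Σˡ xs f
    Σˡ-nonNeg []       0≤f = ℚ.≤-refl
    Σˡ-nonNeg (x ∷ xs) 0≤f = 0≤+ (0≤f x) (Σˡ-nonNeg xs 0≤f)

    Σˡ-⊆ : ∀ {xs ys} {f : A → ℚ} → (∀ x → 0ℚ ℚ.≤ f x) → Unique xs → xs ⊆ ys → Σˡ xs f ℚ.≤ Σˡ ys f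
    Σˡ-⊆ {xs} {ys} {f} 0≤f xs! xs⊆ys =
      let zs , ys↭ = unique-split xs! xs⊆ys
      in ≤-gap (Σˡ zs f) (Σˡ-nonNeg zs 0≤f) (≡.trans (Σˡ-↭ f ys↭) (Σˡ-++ xs zs f))

    Σˡ-filter : ∀ {P : Pred A 0ℓ} (P? : Decidable P) xs {f : A → ℚ} → (∀ x → 0ℚ ℚ.≤ f x) → Σˡ
        (filter P? xs) f ℚ.≤ Σˡ xs f
    Σˡ-filter P? []       0≤f = ℚ.≤-refl
    Σˡ-filter P? (x ∷ xs) {f} 0≤f = cases (P? x)
      where
      cases : Dec _ → Σˡ (filter P? (x ∷ xs)) f ℚ.≤ f x ℚ.+ Σˡ xs f
      cases (yes p) = ≡.subst (λ ys → Σˡ ys f ℚ.≤ f x ℚ.+ Σˡ xs f) (≡.sym (List.filter-accept P? {x} {xs} p))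
        (ℚ.+-monoʳ-≤ (f x) (Σˡ-filter P? xs 0≤f))
      cases (no ¬p) = ≡.subst (λ ys → Σˡ ys f ℚ.≤ f x ℚ.+ Σˡ xs f) (≡.sym (List.filter-reject P? {x} {xs} ¬p))
        (ℚ.≤-trans (Σˡ-filter P? xs 0≤f) (≤-gap (f x) (0≤f x) (ℚ.+-comm (f x) (Σˡ xs f))))

record NormedRing : Set₁ where
  field
    ring : CommutativeRing 0ℓ 0ℓ
  open CommutativeRing ring public hiding (ring; zero)
  field
    norm : Carrier → ℚ
    norm-cong : ∀ {x y} → x ≈ y → norm x ≡ norm y
    0≤norm : ∀ x → 0ℚ ℚ.≤ norm x
    norm-0 : norm 0# ≡ 0ℚ
    norm-neg : ∀ x → norm (- x) ≡ norm x
    norm-+ : ∀ x y → norm (x + y) ℚ.≤ norm x ℚ.+ norm y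
    norm-* : ∀ x y → norm (x * y) ℚ.≤ norm x ℚ.* norm y

  open import Algebra.Properties.CommutativeSemiring.Exp commutativeSemiring public using (_^_; ^-homo-*; ^-assocʳ; ^-distrib-*)
  open import Algebra.Properties.Monoid.Mult +-monoid public using () renaming (_×_ to _·_)
  open ListSums ring public
  open TruncatedIdentity ring public using (partitionTerm)
  open Monomials ring public using (monomial; error)

  norm-sign : ∀ a x → norm ((- 1#) ^ a * x) ≡ norm x
  norm-sign zero    x = norm-cong (*-identityˡ x)
  norm-sign (suc a) x = ≡.trans (norm-cong (trans (*-assoc (- 1#) ((- 1#) ^ a) x) (-1*x≈-x ((- 1#) ^ a * x))))
    (≡.trans (norm-neg ((- 1#) ^ a * x)) (norm-sign a x))
    where open import Algebra.Properties.Ring (CommutativeRing.ring ring) using (-1*x≈-x)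

  norm-Σ : ∀ {A : Set} xs (f : A → Carrier) → norm (Σˡ xs f) ℚ.≤ Rationals.Σˡ xs (norm ∘ f)
  norm-Σ []       f = ℚ.≤-reflexive norm-0
  norm-Σ (x ∷ xs) f = ℚ.≤-trans (norm-+ (f x) (Σˡ xs f)) (ℚ.+-monoʳ-≤ (norm (f x)) (norm-Σ xs f))

gaussianNormed : NormedRing
gaussianNormed = record
  { ring = gaussian
  ; norm = norm
  ; norm-cong = ≡.cong norm
  ; 0≤norm = 0≤norm
  ; norm-0 = ≡.refl
  ; norm-neg = norm-neg
  ; norm-+ = norm-+
  ; norm-* = norm-*
  }
  where open Gaussian

-- Grouping the pairs (δ, k) by m, n and j.

module _ {A : Set} where
  Unique-resp-↭ : ∀ {xs ys : List A} → xs ↭ ys → Unique xs → Unique ys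
  Unique-resp-↭ ↭.refl         xs! = xs!
  Unique-resp-↭ (↭.prep x p)   (x∉ ∷ xs!) = ↭.All-resp-↭ p x∉ ∷ Unique-resp-↭ p xs!
  Unique-resp-↭ (↭.swap x y p) ((x≢y ∷ x∉) ∷ y∉ ∷ xs!) =
    ((x≢y ∘ ≡.sym) ∷ ↭.All-resp-↭ p y∉) ∷ ↭.All-resp-↭ p x∉ ∷ Unique-resp-↭ p xs!
  Unique-resp-↭ (↭.trans p p′) xs! = Unique-resp-↭ p′ (Unique-resp-↭ p xs!)

  Unique-++⁻ : ∀ xs {zs : List A} → Unique (xs ++ zs) → Unique zs × All (λ z → ¬ z ∈ xs) zs
  Unique-++⁻ []       zs! = zs! , All.universal (λ z ()) _
  Unique-++⁻ (x ∷ xs) (x∉ ∷ rest!) with Unique-++⁻ xs rest!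
  ... | zs! , zs∉xs = zs! , All.zipWith (λ (x≢z , z∉xs) → λ { (here z≡x) → x≢z (≡.sym z≡x) ; (there z∈xs) →
      z∉xs z∈xs })
    (All.++⁻ʳ xs x∉ , zs∉xs)

  -- A finite set F that contains F₀ is F₀ together with a set disjoint from it; the sum over the
  -- latter is what tail estimates control.
  complement : ∀ {xs ys : List A} → Unique xs → Unique ys → xs ⊆ ys →
    ∃ λ zs → ys ↭ xs ++ zs × Unique zs × All (λ z → ¬ z ∈ xs) zs
  complement {xs} xs! ys! xs⊆ys =
    let zs , ys↭ = unique-split xs! xs⊆ys
    in zs , ys↭ , Unique-++⁻ xs (Unique-resp-↭ ys↭ ys!)

decreasing-sound : ∀ b → All (λ δ → AllPairs ℕ._>_ δ × All (0 ℕ.<_) δ × All (ℕ._≤ b) δ) (decreasing b)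
decreasing-sound zero = ([] , [] , []) ∷ []
decreasing-sound (suc b) = All.++⁺
  (All.map⁺ (All.map (λ (dec , pos , ≤b) → (All.map s≤s ≤b ∷ dec) , (s≤s z≤n ∷ pos) ,
      (ℕ.≤-refl ∷ All.map ℕ.m≤n⇒m≤1+n ≤b)) (decreasing-sound b)))
  (All.map (λ (dec , pos , ≤b) → dec , pos , All.map ℕ.m≤n⇒m≤1+n ≤b) (decreasing-sound b))

decreasing-unique : ∀ b → Unique (decreasing b)
decreasing-unique zero = [] ∷ []
decreasing-unique (suc b) = Unique.++⁺ (Unique.map⁺ List.∷-injectiveʳ (decreasing-unique b))
    (decreasing-unique b) disjoint
  where
  disjoint : ∀ {δ} → δ ∈ map (suc b ∷_) (decreasing b) × δ ∈ decreasing b → ⊥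
  disjoint (δ∈₁ , δ∈₂) with ∈-map⁻ (suc b ∷_) δ∈₁
  ... | _ , _ , ≡.refl = ℕ.<-irrefl ≡.refl (All.head (proj₂ (proj₂ (All.lookup (decreasing-sound b) δ∈₂))))

decreasing-⊆ : ∀ {n b} → n ℕ.≤ b → decreasing n ⊆ decreasing b
decreasing-⊆ {n} {b} n≤b = ≡.subst (λ k → decreasing n ⊆ decreasing k) (ℕ.m∸n+n≡m n≤b) (go (b ℕ.∸ n))
  where
  go : ∀ k → decreasing n ⊆ decreasing (k ℕ.+ n)
  go zero    δ∈ = δ∈
  go (suc k) δ∈ = ∈-++⁺ʳ (map (suc (k ℕ.+ n) ∷_) (decreasing (k ℕ.+ n))) (go k δ∈)

length≤sum : ∀ {δ} → All (0 ℕ.<_) δ → length δ ℕ.≤ sum δ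
length≤sum []          = z≤n
length≤sum (0<x ∷ pos) = ℕ.+-mono-≤ 0<x (length≤sum pos)

largest≤sum : ∀ δ → largest δ ℕ.≤ sum δ
largest≤sum []      = z≤n
largest≤sum (x ∷ δ) = ℕ.⊔-lub (ℕ.m≤m+n x (sum δ)) (ℕ.≤-trans (largest≤sum δ) (ℕ.m≤n+m (sum δ) x))

Triple : Set
Triple = ℕ × ℕ × ℕ

triple : List ℕ × ℕ → Triple
triple p@(δ , k) = length δ , total p , largest δ

fiber : Triple → List (List ℕ × ℕ)
fiber (m , n , j) = pairs m j n

triples : ℕ → List Triple
triples b = cartesianProduct (upTo b) (cartesianProduct (upTo b) (upTo b))

triples-unique : ∀ b → Unique (triples b)
triples-unique b = Unique.cartesianProduct⁺ (Unique.upTo⁺ b) (Unique.cartesianProduct⁺ (Unique.upTo⁺ b)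
    (Unique.upTo⁺ b))

box-unique : ∀ b → Unique (box b)
box-unique b = Unique.cartesianProduct⁺ (decreasing-unique b) (Unique.upTo⁺ (suc b))

∈-fiber⇒triple : ∀ {x p} → p ∈ fiber x → triple p ≡ x
∈-fiber⇒triple {m , n , j} {p} p∈ with ∈-pairs⁻ {m} {j} {n} {p} p∈
... | mkIsPair _ _ ≡.refl ≡.refl ≡.refl = ≡.refl

∈-fiber⇒∈-box : ∀ {x p b} → proj₁ (proj₂ x) ℕ.≤ b → p ∈ fiber x → p ∈ box b
∈-fiber⇒∈-box {m , n , j} {p} {b} n≤b p∈ =
  let δ∈ , k∈ = ∈-cartesianProduct⁻ (decreasing n) (upTo (suc n))
                  (proj₁ (∈-filter⁻ (isPair? m j n) {xs = box n} p∈))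
  in ∈-cartesianProduct⁺ (decreasing-⊆ n≤b δ∈) (∈-upTo⁺ (ℕ.≤-trans (∈-upTo⁻ k∈) (s≤s n≤b)))

∈-box⇒∈-fiber : ∀ {b p} → p ∈ box b → p ∈ fiber (triple p)
∈-box⇒∈-fiber {b} {p} p∈ =
  let δ∈ , _ = ∈-cartesianProduct⁻ (decreasing b) (upTo (suc b)) p∈
      dec , pos , _ = All.lookup (decreasing-sound b) δ∈
  in ∈-pairs (mkIsPair dec pos ≡.refl ≡.refl ≡.refl)

-- The number of parts and the largest part are at most the total, so a total below b puts all three
-- coordinates below b.
fiber-high : ∀ {x p b} → ¬ x ∈ triples b → p ∈ fiber x → b ℕ.≤ total p
fiber-high {x@(m , n , j)} {p} {b} x∉ p∈ with ∈-pairs⁻ {m} {j} {n} {p} p∈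
... | mkIsPair _ pos ≡.refl ≡.refl ≡.refl = ℕ.≮⇒≥ λ n<b → x∉
  (∈-cartesianProduct⁺ (∈-upTo⁺ (ℕ.≤-<-trans (ℕ.≤-trans (length≤sum pos) sum≤) n<b))
    (∈-cartesianProduct⁺ (∈-upTo⁺ n<b) (∈-upTo⁺ (ℕ.≤-<-trans (ℕ.≤-trans (largest≤sum (proj₁ p)) sum≤) n<b))))
  where
  sum≤ : sum (proj₁ p) ℕ.≤ total p
  sum≤ = ℕ.m≤m+n (sum (proj₁ p)) _

fibers-unique : ∀ {xs} → Unique xs → Unique (concatMap fiber xs)
fibers-unique {[]}     _          = []
fibers-unique {x@(m , n , j) ∷ xs} (x∉ ∷ xs!) = Unique.++⁺ (pairs-unique m j n) (fibers-unique xs!) disjoint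
  where
  disjoint : ∀ {p} → p ∈ fiber x × p ∈ concatMap fiber xs → ⊥
  disjoint (p∈x , p∈xs) =
    let y , y∈xs , p∈y = find (∈-concatMap⁻ fiber p∈xs)
    in All.lookup x∉ y∈xs (≡.trans (≡.sym (∈-fiber⇒triple {x} p∈x)) (∈-fiber⇒triple {y} p∈y))

-- The fibres over `triples b` are exactly the pairs of total below b, and all of these lie in the
-- box. The remainder `zs` is a tail.
box-split : ∀ b → ∃ λ zs → box b ↭ concatMap fiber (triples b) ++ zs × Unique zs × zs ⊆ box b × All (λ p →
    b ℕ.≤ total p) zs
box-split b =
  let zs , box↭ , zs! , zs∉ = complement (fibers-unique (triples-unique b)) (box-unique b) ⊆box
      zs⊆ : zs ⊆ box b
      zs⊆ = λ z∈ → ↭.∈-resp-↭ (↭.↭-sym box↭) (∈-++⁺ʳ (concatMap fiber (triples b)) z∈)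
  in zs , box↭ , zs! , zs⊆ , All.tabulate λ {p} p∈ → high p (zs⊆ p∈) (All.lookup zs∉ p∈)
  where
  ⊆box : concatMap fiber (triples b) ⊆ box b
  ⊆box p∈ =
    let x , x∈ , p∈x = find (∈-concatMap⁻ fiber p∈)
        _ , nj∈ = ∈-cartesianProduct⁻ (upTo b) (cartesianProduct (upTo b) (upTo b)) x∈
        n∈ , _ = ∈-cartesianProduct⁻ (upTo b) (upTo b) nj∈
    in ∈-fiber⇒∈-box {x} (ℕ.<⇒≤ (∈-upTo⁻ n∈)) p∈x

  high : ∀ p → p ∈ box b → ¬ p ∈ concatMap fiber (triples b) → b ℕ.≤ total p
  high p p∈box p∉ = fiber-high {triple p} (λ x∈ → p∉ (∈-concatMap⁺ fiber (lose x∈ p∈fiber))) p∈fiber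
    where
    p∈fiber : p ∈ fiber (triple p)
    p∈fiber = ∈-box⇒∈-fiber {b} p∈box

module FiberSums {a ℓ} (R : CommutativeRing a ℓ) where
  open CommutativeRing R hiding (zero)
  open ListSums R
  open TruncatedIdentity R using (partitionTerm)
  open import Algebra.Properties.Semiring.Exp semiring using (_^_)
  open import Algebra.Properties.Monoid.Mult +-monoid using () renaming (_×_ to _·_)

  tripleTerm : Carrier → Triple → Carrier
  tripleTerm q (m , n , j) = (- 1#) ^ j * (P m j n · q ^ n)

  Σˡ-constant : ∀ {A : Set} (xs : List A) c → Σˡ xs (λ _ → c) ≈ length xs · c
  Σˡ-constant []       c = refl
  Σˡ-constant (x ∷ xs) c = +-congˡ (Σˡ-constant xs c)

  -- `P m j n` is the length of the fibre, and the summand is constant along it.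
  fiber-sum : ∀ q x → tripleTerm q x ≈ Σˡ (fiber x) (partitionTerm q)
  fiber-sum q x@(m , n , j) = trans (*-congˡ (sym (Σˡ-constant (fiber x) (q ^ n))))
    (trans (sym (Σˡ-*ˡ (fiber x) _ _)) (Σˡ-cong (All.tabulate λ {p} p∈ → constant p (∈-fiber⇒triple {x} p∈))))
    where
    constant : ∀ p → triple p ≡ x → (- 1#) ^ j * q ^ n ≈ partitionTerm q p
    constant p ≡.refl = refl

  fibers-sum : ∀ q xs → Σˡ xs (tripleTerm q) ≈ Σˡ (concatMap fiber xs) (partitionTerm q)
  fibers-sum q xs = trans (Σˡ-cong′ xs (fiber-sum q)) (sym (Σˡ-concatMap fiber xs (partitionTerm q)))

upper-bound : ∀ {A : Set} (f : A → ℕ) (xs : List A) → ∃ λ M → All (λ x → f x ℕ.≤ M) xs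
upper-bound f []       = 0 , []
upper-bound f (x ∷ xs) =
  let M , xs≤M = upper-bound f xs
  in f x ℕ.⊔ M , ℕ.m≤m⊔n (f x) M ∷ All.map (λ ≤M → ℕ.≤-trans ≤M (ℕ.m≤n⊔m (f x) M)) xs≤M

-- Bounds on tails, uniform in the cut-off.

module Tails (N : NormedRing) (σ δ : ℚ) (0≤σ : 0ℚ ℚ.≤ σ) (0<δ : 0ℚ ℚ.< δ) (σ+δ≡1 : σ ℚ.+ δ ≡ 1ℚ) where
  open Rationals
  open Geometric σ δ 0≤σ 0<δ σ+δ≡1
  open RationalSums
  module G = NormedRing N
  open G using (norm; norm-sign; norm-Σ)
  open ℚ.≤-Reasoning

  0≤σ^ : ∀ n → 0ℚ ℚ.≤ σ ^ n
  0≤σ^ n = 0≤^ n 0≤σ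

  powers-≤ : ∀ {xs} → Unique xs → Σˡ xs (σ ^_) ℚ.≤ γ
  powers-≤ {xs} xs! =
    let M , xs≤M = upper-bound (λ n → n) xs
    in begin
      Σˡ xs (σ ^_)  ≤⟨ Σˡ-⊆ 0≤σ^ xs! (λ {x} x∈ → ∈-upTo⁺ (s≤s (All.lookup xs≤M x∈))) ⟩
      Σˡ (upTo (suc M)) (σ ^_)  ≡⟨ Σˡ-upTo (suc M) (σ ^_) ⟩
      sum< (suc M) (σ ^_)  ≤⟨ geometric-≤ (suc M) ⟩
      γ ∎

  n≤n² : ∀ n → n ℕ.≤ n ℕ.^ 2
  n≤n² zero    = z≤n
  n≤n² (suc n) = ≡.subst (suc n ℕ.≤_) (≡.cong (suc n ℕ.*_) (≡.sym (ℕ.*-identityʳ (suc n)))) (ℕ.m≤m*n (suc n) (suc n))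

  -- In the n-th Hecke-type term at σ, the leading power is at most σ^n, the bracket at most 2, and
  -- the theta sum at most 1 + 2/(1 - σ).
  κ : ℚ
  κ = (1ℚ ℚ.+ 1ℚ) ℚ.* (1ℚ ℚ.+ (1ℚ ℚ.+ 1ℚ) ℚ.* γ)

  0≤2 : 0ℚ ℚ.≤ 1ℚ ℚ.+ 1ℚ
  0≤2 = 0≤+ 0≤1 0≤1

  theta-≤ : ∀ n → Σˡ (symRange n) (λ j → σ ^ (∣ j ∣ ℕ.^ 2)) ℚ.≤ 1ℚ ℚ.+ (1ℚ ℚ.+ 1ℚ) ℚ.* γ
  theta-≤ n = begin
    Σˡ (symRange n) (λ j → σ ^ (∣ j ∣ ℕ.^ 2))  ≡⟨ Σˡ-symRange n (λ r → σ ^ (r ℕ.^ 2)) ⟩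
    1ℚ ℚ.+ (1ℚ ℚ.+ 1ℚ) ℚ.* sum< n (λ r → σ ^ (suc r ℕ.^ 2))
      ≤⟨ ℚ.+-monoʳ-≤ 1ℚ (*-monoˡ 0≤2 (ℚ.≤-trans (sum<-mono n λ r → ^-antitone (ℕ.≤-trans (ℕ.n≤1+n r) (n≤n²
          (suc r)))) (geometric-≤ n))) ⟩
    1ℚ ℚ.+ (1ℚ ℚ.+ 1ℚ) ℚ.* γ ∎

  heckeTerm-≤ : ∀ n → heckeTerm σ n ℚ.≤ κ ℚ.* σ ^ n
  heckeTerm-≤ n = begin
    heckeTerm σ n
      ≤⟨ *-mono (0≤* (0≤σ^ n) 0≤2) (Σˡ-nonNeg (symRange n) (λ j → 0≤σ^ (∣ j ∣ ℕ.^ 2)))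
           (*-mono (0≤σ^ n) (0≤+ 0≤1 (0≤σ^ (2 ℕ.* n ℕ.+ 1))) (^-antitone (ℕ.m≤n+m n (2 ℕ.* n ℕ.^ 2)))
             (ℚ.+-monoʳ-≤ 1ℚ (^-antitone {0} {2 ℕ.* n ℕ.+ 1} z≤n)))
           (theta-≤ n) ⟩
    σ ^ n ℚ.* (1ℚ ℚ.+ 1ℚ) ℚ.* (1ℚ ℚ.+ (1ℚ ℚ.+ 1ℚ) ℚ.* γ)
      ≡⟨ ≡.trans (ℚ.*-assoc (σ ^ n) (1ℚ ℚ.+ 1ℚ) _) (ℚ.*-comm (σ ^ n) κ) ⟩
    κ ℚ.* σ ^ n ∎

  0≤κ : 0ℚ ℚ.≤ κ
  0≤κ = 0≤* 0≤2 (0≤+ 0≤1 (0≤* 0≤2 0≤γ))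

  heckeTerms-≤ : ∀ {xs} → Unique xs → Σˡ xs (heckeTerm σ) ℚ.≤ κ ℚ.* γ
  heckeTerms-≤ {xs} xs! = begin
    Σˡ xs (heckeTerm σ)  ≤⟨ Σˡ-mono (All.universal heckeTerm-≤ xs) ⟩
    Σˡ xs (λ n → κ ℚ.* σ ^ n)  ≡⟨ Σˡ-*ˡ xs κ (σ ^_) ⟩
    κ ℚ.* Σˡ xs (σ ^_)  ≤⟨ *-monoˡ 0≤κ (powers-≤ xs!) ⟩
    κ ℚ.* γ ∎

  distinct-sum : ∀ b → Σˡ (decreasing b) (λ δ → σ ^ sum δ) ≡ distinct b
  distinct-sum zero    = ≡.refl
  distinct-sum (suc b) = begin-equality
    Σˡ (map (suc b ∷_) (decreasing b) ++ decreasing b) (λ δ → σ ^ sum δ)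
      ≡⟨ Σˡ-++ (map (suc b ∷_) (decreasing b)) (decreasing b) (λ δ → σ ^ sum δ) ⟩
    Σˡ (map (suc b ∷_) (decreasing b)) (λ δ → σ ^ sum δ) ℚ.+ S
      ≡⟨ ≡.cong (ℚ._+ S) (≡.trans (Σˡ-map (suc b ∷_) (decreasing b) (λ δ → σ ^ sum δ))
           (≡.trans (Σˡ-cong′ (decreasing b) (λ δ → ^-homo-* σ (suc b) (sum δ))) (Σˡ-*ˡ (decreasing b)
               (σ ^ suc b) (λ δ → σ ^ sum δ)))) ⟩
    σ ^ suc b ℚ.* S ℚ.+ S  ≡⟨ ℚ-Solver.solve 2 (λ x s → x :* s :+ s := (con 1ℚ :+ x) :* s) ≡.refl (σ ^ suc b) S ⟩
    (1ℚ ℚ.+ σ ^ suc b) ℚ.* S  ≡⟨ ≡.cong ((1ℚ ℚ.+ σ ^ suc b) ℚ.*_) (distinct-sum b) ⟩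
    distinct (suc b) ∎
    where
    open ℚ-Solver using (_:*_; _:+_; _:=_; con)
    S = Σˡ (decreasing b) (λ δ → σ ^ sum δ)

  C : ℚ
  C = proj₁ distinct-bounded

  0≤C : 0ℚ ℚ.≤ C
  0≤C = proj₁ (proj₂ distinct-bounded)

  -- Since k(2m+1) is at least k, the sum over the box is dominated by a geometric series times the
  -- product over distinct parts, both bounded independently of b.
  box-≤ : ∀ b → Σˡ (box b) (λ p → σ ^ total p) ℚ.≤ γ ℚ.* C
  box-≤ b = begin
    Σˡ (box b) (λ p → σ ^ total p)  ≡⟨ Σˡ-× (decreasing b) (upTo (suc b)) (λ p → σ ^ total p) ⟩
    Σˡ (decreasing b) (λ δ → Σˡ (upTo (suc b)) (λ k → σ ^ total (δ , k)))
      ≤⟨ Σˡ-mono (All.universal column (decreasing b)) ⟩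
    Σˡ (decreasing b) (λ δ → γ ℚ.* σ ^ sum δ)
      ≡⟨ ≡.trans (Σˡ-*ˡ (decreasing b) γ (λ δ → σ ^ sum δ)) (≡.cong (γ ℚ.*_) (distinct-sum b)) ⟩
    γ ℚ.* distinct b  ≤⟨ *-monoˡ 0≤γ (proj₂ (proj₂ distinct-bounded) b) ⟩
    γ ℚ.* C ∎
    where
    column : ∀ δ → Σˡ (upTo (suc b)) (λ k → σ ^ total (δ , k)) ℚ.≤ γ ℚ.* σ ^ sum δ
    column δ = begin
      Σˡ (upTo (suc b)) (λ k → σ ^ total (δ , k))
        ≤⟨ Σˡ-mono (All.universal (λ k → ℚ.≤-trans (ℚ.≤-reflexive (^-homo-* σ (sum δ) (k ℕ.* (2 ℕ.* length δ ℕ.+ 1))))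
             (*-monoˡ (0≤σ^ (sum δ)) (^-antitone (≡.subst (λ c → k ℕ.≤ k ℕ.* c) (ℕ.+-comm 1 (2 ℕ.* length δ))
                 (ℕ.m≤m*n k (suc (2 ℕ.* length δ))))))) (upTo (suc b))) ⟩
      Σˡ (upTo (suc b)) (λ k → σ ^ sum δ ℚ.* σ ^ k)  ≡⟨ Σˡ-*ˡ (upTo (suc b)) (σ ^ sum δ) (σ ^_) ⟩
      σ ^ sum δ ℚ.* Σˡ (upTo (suc b)) (σ ^_)  ≤⟨ *-monoˡ (0≤σ^ (sum δ)) (powers-≤ (Unique.upTo⁺ (suc b))) ⟩
      σ ^ sum δ ℚ.* γ  ≡⟨ ℚ.*-comm (σ ^ sum δ) γ ⟩
      γ ℚ.* σ ^ sum δ ∎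

  double : ∀ n → (1ℚ ℚ.+ 1ℚ) ℚ.* n ≡ n ℚ.+ n
  double n = ≡.trans (ℚ.*-distribʳ-+ n 1ℚ 1ℚ) (≡.cong₂ ℚ._+_ (ℚ.*-identityˡ n) (ℚ.*-identityˡ n))

  -- A power z^w of norm at most 2σ^(2w) is, for w ≥ K, at most `tail K` times σ^w: half of the
  -- decay is turned into a uniform small factor, the other half remains for summation.
  tail : ℕ → ℚ
  tail K = (1ℚ ℚ.+ 1ℚ) ℚ.* σ ^ K

  0≤tail : ∀ K → 0ℚ ℚ.≤ tail K
  0≤tail K = 0≤* 0≤2 (0≤σ^ K)

  heckeExponents-≥ : ∀ n → All (n ℕ.≤_) (heckeExponents n)
  heckeExponents-≥ n = All.concat⁺ (All.map⁺ (All.universal (λ j →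
      ℕ.≤-trans n≤e (ℕ.m≤m+n e _) ∷ ℕ.≤-trans n≤e (ℕ.≤-trans (ℕ.m≤m+n e (2 ℕ.* n ℕ.+ 1)) (ℕ.m≤m+n _ _)) ∷ [])
          (symRange n)))
    where
    e = 2 ℕ.* n ℕ.^ 2 ℕ.+ n
    n≤e : n ℕ.≤ e
    n≤e = ℕ.m≤n+m n (2 ℕ.* n ℕ.^ 2)

  module _ (z : G.Carrier) (z-small : ∀ w → norm (z G.^ w) ℚ.≤ (σ ℚ.* σ) ^ w ℚ.+ (σ ℚ.* σ) ^ w) where
    norm-power : ∀ {K w} → K ℕ.≤ w → norm (z G.^ w) ℚ.≤ tail K ℚ.* σ ^ w
    norm-power {K} {w} K≤w = begin
      norm (z G.^ w)  ≤⟨ z-small w ⟩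
      (σ ℚ.* σ) ^ w ℚ.+ (σ ℚ.* σ) ^ w  ≡⟨ double ((σ ℚ.* σ) ^ w) ⟨
      (1ℚ ℚ.+ 1ℚ) ℚ.* (σ ℚ.* σ) ^ w  ≡⟨ ≡.cong ((1ℚ ℚ.+ 1ℚ) ℚ.*_) (^-distrib-* σ σ w) ⟩
      (1ℚ ℚ.+ 1ℚ) ℚ.* (σ ^ w ℚ.* σ ^ w)  ≤⟨ *-monoˡ 0≤2 (*-monoʳ (0≤σ^ w) (^-antitone K≤w)) ⟩
      (1ℚ ℚ.+ 1ℚ) ℚ.* (σ ^ K ℚ.* σ ^ w)  ≡⟨ ℚ.*-assoc (1ℚ ℚ.+ 1ℚ) (σ ^ K) (σ ^ w) ⟨
      tail K ℚ.* σ ^ w ∎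
      where open import Algebra.Properties.CommutativeSemiring.Exp (CommutativeRing.commutativeSemiring ℚ.+-*-commutativeRing) using (^-distrib-*)

    norm-sum : ∀ {A : Set} K (w : A → ℕ) {xs : List A} {f : A → G.Carrier} →
      All (λ x → norm (f x) ℚ.≤ tail K ℚ.* σ ^ w x) xs → norm (G.Σˡ xs f) ℚ.≤ tail K ℚ.* Σˡ xs (λ x → σ ^ w x)
    norm-sum K w {xs} {f} f≤ = begin
      norm (G.Σˡ xs f)  ≤⟨ norm-Σ xs f ⟩
      Σˡ xs (norm ∘ f)  ≤⟨ Σˡ-mono f≤ ⟩
      Σˡ xs (λ x → tail K ℚ.* σ ^ w x)  ≡⟨ Σˡ-*ˡ xs (tail K) (λ x → σ ^ w x) ⟩
      tail K ℚ.* Σˡ xs (λ x → σ ^ w x) ∎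

    -- Expand into monomials, bound each one, and fold the bounds back into the positive series
    -- `heckeTerm σ`.
    norm-hecke : ∀ {K xs} → Unique xs → All (K ℕ.≤_) xs → norm (G.Σˡ xs (G.heckeTerm z)) ℚ.≤ tail K ℚ.* (κ ℚ.* γ)
    norm-hecke {K} {xs} xs! K≤xs = begin
      norm (G.Σˡ xs (G.heckeTerm z))
        ≡⟨ G.norm-cong (G.trans (G.Σˡ-cong′ xs (G.heckeTerm-expand z)) (G.sym (G.Σˡ-concatMap heckeExponents xs
            (z G.^_)))) ⟩
      norm (G.Σˡ (concatMap heckeExponents xs) (z G.^_))
        ≤⟨ norm-sum K (λ w → w) (All.map norm-power (All.concat⁺ (All.map⁺ (All.map (λ {n} K≤n → All.map
            (ℕ.≤-trans K≤n) (heckeExponents-≥ n)) K≤xs)))) ⟩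
      tail K ℚ.* Σˡ (concatMap heckeExponents xs) (σ ^_)
        ≡⟨ ≡.cong (tail K ℚ.*_) (≡.trans (Σˡ-cong′ xs (heckeTerm-expand σ)) (≡.sym
            (Σˡ-concatMap heckeExponents xs (σ ^_)))) ⟨
      tail K ℚ.* Σˡ xs (heckeTerm σ)  ≤⟨ *-monoˡ (0≤tail K) (heckeTerms-≤ xs!) ⟩
      tail K ℚ.* (κ ℚ.* γ) ∎

    norm-monomial : ∀ {K a w} → K ℕ.≤ w → norm (G.monomial z (a , w)) ℚ.≤ tail K ℚ.* σ ^ w
    norm-monomial {K} {a} {w} K≤w = ℚ.≤-trans (ℚ.≤-reflexive (norm-sign a (z G.^ w))) (norm-power K≤w)

    partitionTerm-monomial : ∀ p → G.partitionTerm (z G.* z) p G.≈ G.monomial z (largest (proj₁ p) , 2 ℕ.* total p)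
    partitionTerm-monomial p = G.*-congˡ
      (G.trans (^-congˡ (total p) (G.*-congˡ (G.sym (G.*-identityʳ z)))) (G.^-assocʳ z 2 (total p)))
      where open import Algebra.Properties.Semiring.Exp G.semiring using (^-congˡ)

    -- The box bounds the sum of weights by that over a larger finite set; the resulting estimate
    -- does not depend on its size b.
    norm-partition : ∀ {K b ps} → Unique ps → ps ⊆ box b → All (λ p → K ℕ.≤ total p) ps →
      norm (G.Σˡ ps (G.partitionTerm (z G.* z))) ℚ.≤ tail K ℚ.* (γ ℚ.* C)
    norm-partition {K} {b} {ps} ps! ps⊆ K≤ps = begin
      norm (G.Σˡ ps (G.partitionTerm (z G.* z)))  ≤⟨ norm-sum K total (All.map (λ {p} → each p) K≤ps) ⟩
      tail K ℚ.* Σˡ ps (λ p → σ ^ total p)  ≤⟨ *-monoˡ (0≤tail K) (ℚ.≤-trans (Σˡ-⊆ (λ p → 0≤σ^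
          (total p)) ps! ps⊆) (box-≤ b)) ⟩
      tail K ℚ.* (γ ℚ.* C) ∎
      where
      each : ∀ p → K ℕ.≤ total p → norm (G.partitionTerm (z G.* z) p) ℚ.≤ tail K ℚ.* σ ^ total p
      each p K≤p = begin
        norm (G.partitionTerm (z G.* z) p)  ≡⟨ G.norm-cong (partitionTerm-monomial p) ⟩
        norm (G.monomial z (largest (proj₁ p) , 2 ℕ.* total p))
          ≤⟨ norm-monomial {K} {largest (proj₁ p)} (ℕ.≤-trans K≤p p≤2p) ⟩
        tail K ℚ.* σ ^ (2 ℕ.* total p)  ≤⟨ *-monoˡ (0≤tail K) (^-antitone p≤2p) ⟩
        tail K ℚ.* σ ^ total p ∎
        where
        p≤2p : total p ℕ.≤ 2 ℕ.* total p
        p≤2p = ℕ.m≤m+n (total p) _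

    -- By `error-tail` only monomials of degree above b count. The bracket bounds the total weight
    -- of all monomials: the partitions twice, and the two Hecke-type sums.
    norm-error : ∀ b → norm (G.error z b) ℚ.≤ tail (suc b) ℚ.* ((γ ℚ.* C ℚ.+ γ ℚ.* C) ℚ.+ (κ ℚ.* γ ℚ.+ κ ℚ.* γ))
    norm-error b = begin
      norm (G.error z b)  ≡⟨ G.norm-cong (Truncation.error-tail G.ring z b) ⟩
      norm (G.Σˡ (filter high? (errorMonomials b)) (G.monomial z))
        ≤⟨ norm-sum (suc b) proj₂ (All.map (λ {x} → norm-monomial {suc b} {proj₁ x}) (All.all-filter high?
            (errorMonomials b))) ⟩
      tail (suc b) ℚ.* Σˡ (filter high? (errorMonomials b)) weight
        ≤⟨ *-monoˡ (0≤tail (suc b)) (ℚ.≤-trans (Σˡ-filter high? (errorMonomials b) (λ x → 0≤σ^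
            (proj₂ x))) total-weight) ⟩
      tail (suc b) ℚ.* ((γ ℚ.* C ℚ.+ γ ℚ.* C) ℚ.+ (κ ℚ.* γ ℚ.+ κ ℚ.* γ)) ∎
      where
      high? = Truncation.high? G.ring (suc b) z

      weight : Monomial → ℚ
      weight x = σ ^ proj₂ x

      partition-weight : Σˡ (partitionMonomials b) weight ℚ.≤ γ ℚ.* C
      partition-weight = begin
        Σˡ (partitionMonomials b) weight  ≡⟨ Σˡ-map (λ p → largest (proj₁ p) , 2 ℕ.* total p) (box b) weight ⟩
        Σˡ (box b) (λ p → σ ^ (2 ℕ.* total p))  ≤⟨ Σˡ-mono (All.universal (λ p → ^-antitone (ℕ.m≤m+n
            (total p) _)) (box b)) ⟩
        Σˡ (box b) (λ p → σ ^ total p)  ≤⟨ box-≤ b ⟩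
        γ ℚ.* C ∎

      hecke-weight : ∀ (f : ℕ → ℕ) → Σˡ (map (λ w → f w , w) (concatMap heckeExponents (upTo
          (suc b)))) weight ℚ.≤ κ ℚ.* γ
      hecke-weight f = begin
        Σˡ (map (λ w → f w , w) (concatMap heckeExponents (upTo (suc b)))) weight
          ≡⟨ Σˡ-map (λ w → f w , w) (concatMap heckeExponents (upTo (suc b))) weight ⟩
        Σˡ (concatMap heckeExponents (upTo (suc b))) (σ ^_)
          ≡⟨ ≡.trans (Σˡ-cong′ (upTo (suc b)) (heckeTerm-expand σ)) (≡.sym (Σˡ-concatMap heckeExponents (upTo
              (suc b)) (σ ^_))) ⟨
        Σˡ (upTo (suc b)) (heckeTerm σ)  ≤⟨ heckeTerms-≤ (Unique.upTo⁺ (suc b)) ⟩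
        κ ℚ.* γ ∎

      total-weight : Σˡ (errorMonomials b) weight ℚ.≤ (γ ℚ.* C ℚ.+ γ ℚ.* C) ℚ.+ (κ ℚ.* γ ℚ.+ κ ℚ.* γ)
      total-weight = begin
        Σˡ (errorMonomials b) weight
          ≡⟨ ≡.trans (Σˡ-++ (partitionMonomials b ++ partitionMonomials b)
              (heckeMonomials₊ b ++ heckeMonomials₋ b) weight)
               (≡.cong₂ ℚ._+_ (Σˡ-++ (partitionMonomials b) (partitionMonomials b) weight) (Σˡ-++
                   (heckeMonomials₊ b) (heckeMonomials₋ b) weight)) ⟩
        (Σˡ (partitionMonomials b) weight ℚ.+ Σˡ (partitionMonomials b) weight) ℚ.+ (Σˡ
            (heckeMonomials₊ b) weight ℚ.+ Σˡ (heckeMonomials₋ b) weight)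
          ≤⟨ ℚ.+-mono-≤ (ℚ.+-mono-≤ partition-weight partition-weight) (ℚ.+-mono-≤ (hecke-weight (λ _ → 1))
              (hecke-weight suc)) ⟩
        (γ ℚ.* C ℚ.+ γ ℚ.* C) ℚ.+ (κ ℚ.* γ ℚ.+ κ ℚ.* γ) ∎

-- Parity of exponents and algebraic regroupings of differences.

module SignedPowers {a ℓ} (R : CommutativeRing a ℓ) where
  open CommutativeRing R hiding (zero)
  open IntegerCoefficients R
  open ListSums R
  open Monomials R using (neg^)
  open import Algebra.Properties.Semiring.Exp semiring using (_^_; ^-homo-*; ^-assocʳ; ^-congˡ)

  sign-even : ∀ k → (- 1#) ^ (2 ℕ.* k) ≈ 1#
  sign-even k = trans (sym (^-assocʳ (- 1#) 2 k)) (trans (^-congˡ k (solve 0 ((:- :1) :*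
      ((:- :1) :* :1) := :1) refl)) (one^ k))
    where
    one^ : ∀ k → 1# ^ k ≈ 1#
    one^ zero    = refl
    one^ (suc k) = trans (*-identityˡ _) (one^ k)

  sign-even+ : ∀ k n → (- 1#) ^ (2 ℕ.* k ℕ.+ n) ≈ (- 1#) ^ n
  sign-even+ k n = trans (^-homo-* (- 1#) (2 ℕ.* k) n) (trans (*-congʳ (sign-even k)) (*-identityˡ _))

  sign-square : ∀ n → (- 1#) ^ (n ℕ.^ 2) ≈ (- 1#) ^ n
  sign-square zero    = refl
  sign-square (suc n) = trans (reflexive (≡.cong ((- 1#) ^_) exponent))
    (trans (sign-even+ n (suc (n ℕ.^ 2))) (*-congˡ (sign-square n)))
    where
    exponent : suc n ℕ.^ 2 ≡ 2 ℕ.* n ℕ.+ suc (n ℕ.^ 2)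
    exponent = ℕ-solve 1 (λ n → (ℕ-con 1 ⊕ n) ↑ 2 ⊜ ℕ-con 2 ⊗ n ⊕ (ℕ-con 1 ⊕ n ↑ 2)) ≡.refl n

  -- Parity: 2n² + n is congruent to n and j² to j modulo 2, while 2n + 1 is odd.
  heckeTerm-neg : ∀ t n → (- 1#) ^ n * t ^ (2 ℕ.* n ℕ.^ 2 ℕ.+ n) * (1# - t ^ (2 ℕ.* n ℕ.+ 1))
    * Σˡ (symRange n) (λ j → (- 1#) ^ ∣ j ∣ * t ^ (∣ j ∣ ℕ.^ 2)) ≈ heckeTerm (- t) n
  heckeTerm-neg t n = *-cong (*-cong
      (sym (trans (neg^ t (2 ℕ.* n ℕ.^ 2 ℕ.+ n)) (*-congʳ (sign-even+ (n ℕ.^ 2) n))))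
      (+-congˡ (sym (trans (neg^ t (2 ℕ.* n ℕ.+ 1)) (trans (*-congʳ (sign-even+ n 1))
        (solve 1 (λ x → (:- :1) :* :1 :* x := :- x) refl (t ^ (2 ℕ.* n ℕ.+ 1))))))))
    (Σˡ-cong′ (symRange n) λ j → sym (trans (neg^ t (∣ j ∣ ℕ.^ 2)) (*-congʳ (sign-square ∣ j ∣))))

module Regroupings {a ℓ} (R : CommutativeRing a ℓ) where
  open CommutativeRing R hiding (zero)
  open IntegerCoefficients R
  open FiniteSums R using (by-multiple)

  +-minus-+ : ∀ a b c d → (a + b) - (c + d) ≈ (a - c) + (b - d)
  +-minus-+ = solve 4 (λ a b c d → (a :+ b) :- (c :+ d) := (a :- c) :+ (b :- d)) refl

  through : ∀ u v w → u - v ≈ (u - w) + - (v - w)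
  through = solve 3 (λ u v w → u :- v := (u :- w) :+ (:- (v :- w))) refl

  through-split : ∀ {x y u v w} → y ≈ u + v → x - w ≈ (x - y) + ((u - w) + v)
  through-split {x} {y} {u} {v} {w} y≈ = by-multiple 1# y≈
    (solve 5 (λ x y u v w → x :- w := ((x :- y) :+ ((u :- w) :+ v)) :+ :1 :* (y :- (u :+ v))) refl x y u v w)

  product-difference : ∀ u x v y → u * x - v * y ≈ u * (x - y) + (u - v) * y
  product-difference = solve 4 (λ u x v y → u :* x :- v :* y := u :* (x :- y) :+ (u :- v) :* y) refl

  -- Here p is the sum over the box, e its part over fibres, z the remainder, x and y the partial
  -- Hecke-type sums, a and b their limits. Each group on the right has its own estimate.
  halves : ∀ {h} → h * (1# + 1#) ≈ 1# → ∀ {p} e z x y a b → p ≈ e + z →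
    e - (h * a + h * b) ≈ (- z + h * ((1# + 1#) * p - (x + y))) + (h * (x - a) + h * (y - b))
  halves {h} h2≈1 {p} e z x y a b p≈ = by-multiple 1# (sym p≈) (by-multiple (- p) h2≈1
    (solve 8 (λ h p e z x y a b → e :- (h :* a :+ h :* b) :=
      ((((:- z) :+ h :* ((:1 :+ :1) :* p :- (x :+ y))) :+ (h :* (x :- a) :+ h :* (y :- b))) :+ :1 :* ((e :+ z) :- p))
        :+ (:- p) :* (h :* (:1 :+ :1) :- :1)) refl h p e z x y a b))

  *-distribˡ-minus : ∀ x y z → x * (y - z) ≈ x * y - x * z
  *-distribˡ-minus = solve 3 (λ x y z → x :* (y :- z) := x :* y :- x :* z) refl

  cancel : ∀ x y → (x + y) - x ≈ y
  cancel = solve 2 (λ x y → (x :+ y) :- x := y) refl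

-- Eventual properties of entries and shares of ε.

module Smallness where
  open Rationals
  open ℚ.≤-Reasoning

  Eventually : (ℕ → Set) → Set
  Eventually Q = ∃ λ N → ∀ i → N ℕ.≤ i → Q i

  module _ {Q R : ℕ → Set} where
    eventually-map : (∀ i → Q i → R i) → Eventually Q → Eventually R
    eventually-map f (N , q) = N , λ i N≤i → f i (q i N≤i)

    eventually-× : Eventually Q → Eventually R → Eventually (λ i → Q i × R i)
    eventually-× (M , q) (N , r) = M ℕ.⊔ N , λ i i≥ → q i (ℕ.m⊔n≤o⇒m≤o M N i≥) , r i (ℕ.m⊔n≤o⇒n≤o M N i≥)

  half eighth : ℚ → ℚ
  half ε = ½ ℚ.* ε
  eighth ε = half (half (half ε))

  0<half : ∀ {ε} → 0ℚ ℚ.< ε → 0ℚ ℚ.< half ε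
  0<half {ε} = 0<* {½} {ε} (ℚ.positive⁻¹ ½)

  0<eighth : ∀ {ε} → 0ℚ ℚ.< ε → 0ℚ ℚ.< eighth ε
  0<eighth {ε} 0<ε = 0<half {half (half ε)} (0<half {half ε} (0<half {ε} 0<ε))

  half+half : ∀ ε → half ε ℚ.+ half ε ≡ ε
  half+half = solve 1 (λ e → con ½ :* e :+ con ½ :* e := e) ≡.refl
    where open ℚ-Solver

  3eighths≤half : ∀ ε → 0ℚ ℚ.≤ ε → eighth ε ℚ.+ (eighth ε ℚ.+ eighth ε) ℚ.≤ half ε
  3eighths≤half ε 0≤ε = ≤-gap (eighth ε) (0≤* 0≤½ (0≤* 0≤½ (0≤* 0≤½ 0≤ε)))
    (solve 1 (λ e → let e₈ = con ½ :* (con ½ :* (con ½ :* e)) in con ½ :* e := (e₈ :+ (e₈ :+ e₈)) :+ e₈) ≡.refl ε)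
    where
    open ℚ-Solver
    0≤½ = ℚ.nonNegative⁻¹ ½

  4quarters : ∀ ε → (half (half ε) ℚ.+ half (half ε)) ℚ.+ (half (half ε) ℚ.+ half (half ε)) ≡ ε
  4quarters ε = ≡.trans (≡.cong₂ ℚ._+_ (half+half (half ε)) (half+half (half ε))) (half+half ε)

  half≤ : ∀ ε → 0ℚ ℚ.≤ ε → half ε ℚ.≤ ε
  half≤ ε 0≤ε = ≤-gap (half ε) (0≤* (ℚ.nonNegative⁻¹ ½) 0≤ε) (≡.sym (half+half ε))

  quarter≤ : ∀ ε → 0ℚ ℚ.< ε → half (half ε) ℚ.≤ ε
  quarter≤ ε 0<ε = ℚ.≤-trans (half≤ (half ε) (ℚ.<⇒≤ (0<half {ε} 0<ε))) (half≤ ε (ℚ.<⇒≤ 0<ε))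

  share : ∀ C ε → 0ℚ ℚ.≤ C → 0ℚ ℚ.< ε → ∃ λ η → 0ℚ ℚ.< η × C ℚ.* η ℚ.≤ ε
  -- Dividing by 1 + C instead of C allows C = 0.
  share C ε 0≤C 0<ε = share-of (1ℚ ℚ.+ C) ≡.refl (ℚ.+-mono-<-≤ (ℚ.positive⁻¹ 1ℚ) 0≤C)
    where
    open ℚ-Solver
    split : ∀ D r → D ≡ 1ℚ ℚ.+ C → D ℚ.* r ≡ 1ℚ → ε ≡ C ℚ.* (r ℚ.* ε) ℚ.+ r ℚ.* ε
    split D r D≡ Dr≡1 = begin-equality
      ε  ≡⟨ ℚ.*-identityˡ ε ⟨
      1ℚ ℚ.* ε  ≡⟨ ≡.cong (ℚ._* ε) (≡.trans (≡.sym Dr≡1) (≡.cong (ℚ._* r) D≡)) ⟩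
      (1ℚ ℚ.+ C) ℚ.* r ℚ.* ε  ≡⟨ solve 3 (λ c d e → (con 1ℚ :+ c) :* d :* e := c :* (d :* e) :+ d :* e) ≡.refl C r ε ⟩
      C ℚ.* (r ℚ.* ε) ℚ.+ r ℚ.* ε ∎

    share-of : ∀ D → D ≡ 1ℚ ℚ.+ C → 0ℚ ℚ.< D → ∃ λ η → 0ℚ ℚ.< η × C ℚ.* η ℚ.≤ ε
    share-of D D≡ 0<D = r ℚ.* ε , 0<η , ≤-gap (r ℚ.* ε) (ℚ.<⇒≤ 0<η) (split D r D≡ (ℚ.*-inverseʳ D))
      where
      instance
        D>0 : ℚ.Positive D
        D>0 = ℚ.positive 0<D
        D≢0 : ℚ.NonZero D
        D≢0 = ℚ.pos⇒nonZero D
      r = ℚ.1/ D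
      0<η : 0ℚ ℚ.< r ℚ.* ε
      0<η = 0<* {r} {ε} (ℚ.positive⁻¹ r {{ℚ.1/pos⇒pos D}}) 0<ε

-- Unconditional summation of complex series through their entries.

module C where
  open Defs public

-- Complex numbers seen through the entries of their representing Cauchy sequences.
-- The ring of entries is abstract so that its operations do not unfold.
module Summation (normedRing : NormedRing) where
  open Rationals using (*-mono; *-monoˡ; *-monoʳ; 0≤+; 0≤*; 0≤1)
  open Smallness
  open C using (ℂ; HasSum; Σ[_]_; ∣_∣<_; fromℚ)
  open NormedRing normedRing
  open Regroupings ring
  open FiberSums ring using (tripleTerm; fibers-sum)

  norm-of-0 : ∀ {x y} → x ≈ y → norm (x - y) ≡ 0ℚ
  norm-of-0 {x} {y} x≈y = ≡.trans (norm-cong (trans (+-congʳ x≈y) (-‿inverseʳ y))) norm-0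

  norm-through : ∀ u v w → norm (u - v) ℚ.≤ norm (u - w) ℚ.+ norm (v - w)
  norm-through u v w = ≡.subst₂ (λ a b → a ℚ.≤ norm (u - w) ℚ.+ b) (≡.sym (norm-cong (through u v w))) (norm-neg
      (v - w))
    (norm-+ (u - w) (- (v - w)))

  norm-+-minus-+ : ∀ a b c d → norm ((a + b) - (c + d)) ℚ.≤ norm (a - c) ℚ.+ norm (b - d)
  norm-+-minus-+ a b c d = ≡.subst (ℚ._≤ norm (a - c) ℚ.+ norm (b - d)) (≡.sym (norm-cong (+-minus-+ a b c d)))
      (norm-+ (a - c) (b - d))

  norm-through-split : ∀ x {y u v} w → y ≈ u + v → norm (x - w) ℚ.≤ norm (x - y) ℚ.+ (norm (u - w) ℚ.+ norm v)
  norm-through-split x {y} {u} {v} w y≈ = ≡.subst (ℚ._≤ norm (x - y) ℚ.+ (norm (u - w) ℚ.+ norm v))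
    (≡.sym (norm-cong (through-split {x} {y} {u} {v} {w} y≈)))
    (ℚ.≤-trans (norm-+ (x - y) ((u - w) + v)) (ℚ.+-monoʳ-≤ (norm (x - y)) (norm-+ (u - w) v)))

  Bounded : Carrier → Set
  Bounded u = ∀ n → norm (u ^ n) ℚ.≤ 1ℚ ℚ.+ 1ℚ

  -- The entries of q and of t² agree only up to a null sequence. This controls the change of a
  -- single summand when one replaces the other; the constant may depend on the summand.
  Lipschitz : (Carrier → Carrier) → Set
  Lipschitz f = ∃ λ C → 0ℚ ℚ.≤ C × ∀ u v → Bounded u → Bounded v → norm (f u - f v) ℚ.≤ C ℚ.* norm (u - v)

  power-lipschitz : ∀ n → Lipschitz (_^ n)
  power-lipschitz zero = 0ℚ , ℚ.≤-refl , λ u v _ _ → ℚ.≤-reflexive (≡.trans (norm-of-0 refl) (≡.sym (ℚ.*-zeroˡ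
      (norm (u - v)))))
  power-lipschitz (suc n) = 2ℚ ℚ.* C ℚ.+ 2ℚ , 0≤+ (0≤* 0≤2 0≤C) 0≤2 , λ u v u≤ v≤ → begin
    norm (u * u ^ n - v * v ^ n)  ≡⟨ norm-cong (product-difference u (u ^ n) v (v ^ n)) ⟩
    norm (u * (u ^ n - v ^ n) + (u - v) * v ^ n)
      ≤⟨ ℚ.≤-trans (norm-+ (u * (u ^ n - v ^ n)) ((u - v) * v ^ n)) (ℚ.+-mono-≤ (norm-* u (u ^ n - v ^ n))
          (norm-* (u - v) (v ^ n))) ⟩
    norm u ℚ.* norm (u ^ n - v ^ n) ℚ.+ norm (u - v) ℚ.* norm (v ^ n)
      ≤⟨ ℚ.+-mono-≤ (*-mono 0≤2 (0≤norm (u ^ n - v ^ n)) (ℚ.≤-trans (ℚ.≤-reflexive (norm-cong (sym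
          (*-identityʳ u)))) (u≤ 1)) (lip u v u≤ v≤))
           (*-monoˡ (0≤norm (u - v)) (v≤ n)) ⟩
    2ℚ ℚ.* (C ℚ.* norm (u - v)) ℚ.+ norm (u - v) ℚ.* 2ℚ
      ≡⟨ ℚ-Solver.solve 3 (λ t c d → t ℚ-Solver.:* (c ℚ-Solver.:* d) ℚ-Solver.:+ d ℚ-Solver.:* t
           ℚ-Solver.:= (t ℚ-Solver.:* c ℚ-Solver.:+ t) ℚ-Solver.:* d) ≡.refl 2ℚ C (norm (u - v)) ⟩
    (2ℚ ℚ.* C ℚ.+ 2ℚ) ℚ.* norm (u - v) ∎
    where
    open ℚ.≤-Reasoning
    2ℚ = 1ℚ ℚ.+ 1ℚ
    0≤2 : 0ℚ ℚ.≤ 2ℚ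
    0≤2 = 0≤+ 0≤1 0≤1
    C = proj₁ (power-lipschitz n)
    0≤C = proj₁ (proj₂ (power-lipschitz n))
    lip = proj₂ (proj₂ (power-lipschitz n))

  multiple-lipschitz : ∀ p {f} → Lipschitz f → Lipschitz (λ u → p · f u)
  multiple-lipschitz zero    lip = 0ℚ , ℚ.≤-refl , λ u v _ _ → ℚ.≤-reflexive (≡.trans (norm-of-0 refl) (≡.sym
      (ℚ.*-zeroˡ (norm (u - v)))))
  multiple-lipschitz (suc p) {f} lip@(C , 0≤C , f-lip) =
    let C′ , 0≤C′ , pf-lip = multiple-lipschitz p lip
    in C ℚ.+ C′ , 0≤+ 0≤C 0≤C′ , λ u v u≤ v≤ → ℚ.≤-trans (norm-+-minus-+ (f u) (p · f u) (f v) (p · f v))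
      (ℚ.≤-trans (ℚ.+-mono-≤ (f-lip u v u≤ v≤) (pf-lip u v u≤ v≤)) (ℚ.≤-reflexive (≡.sym (ℚ.*-distribʳ-+ (norm
          (u - v)) C C′))))

  tripleTerm-lipschitz : ∀ x → Lipschitz (λ q → tripleTerm q x)
  tripleTerm-lipschitz (m , n , j) =
    let C , 0≤C , lip = multiple-lipschitz (P m j n) (power-lipschitz n)
    in C , 0≤C , λ u v u≤ v≤ → ℚ.≤-trans
      (ℚ.≤-reflexive (≡.trans (norm-cong (sym (*-distribˡ-minus ((- 1#) ^ j) (P m j n · u ^ n)
          (P m j n · v ^ n)))) (norm-sign j (P m j n · u ^ n - P m j n · v ^ n))))
      (lip u v u≤ v≤)

  module Entries
    (at : ℕ → ℂ → Carrier)
    (at-* : ∀ i z w → at i (z C.* w) ≈ at i z * at i w)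
    (at-+ : ∀ i z w → at i (z C.+ w) ≈ at i z + at i w)
    (at-- : ∀ i z w → at i (z C.- w) ≈ at i z - at i w)
    (at-^ : ∀ i z n → at i (z C.^ n) ≈ at i z ^ n)
    (at-· : ∀ i n z → at i (n C.· z) ≈ n · at i z)
    (at-Σ : ∀ {A : Set} i xs (f : A → ℂ) → at i (Σ[ xs ] f) ≈ Σˡ xs (λ x → at i (f x)))
    (∣∣<-intro : ∀ z ε → 0ℚ ℚ.< ε → Eventually (λ i → norm (at i z) ℚ.≤ half ε) → ∣ z ∣< fromℚ ε)
    -- In the hypothesis the threshold for i is uniform in k; in the conclusion it may depend on k.
    (limit : (x : ℕ → ℂ) →
      (∀ ε → 0ℚ ℚ.< ε → ∃ λ K → Eventually (λ i → ∀ k → K ℕ.≤ k → norm (at i (x k) - at i (x K)) ℚ.≤ ε)) →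
      ∃ λ s → ∀ ε → 0ℚ ℚ.< ε → ∃ λ K → ∀ k → K ℕ.≤ k → Eventually (λ i → norm (at i (x k) - at i s) ℚ.≤ ε))
    where

    -- A data type, so that it is compared index by index, without unfolding the reals in z.
    data Value (i : ℕ) (z : ℂ) (x : Carrier) : Set where
      value : at i z ≈ x → Value i z x

    at≈ : ∀ {i z x} → Value i z x → at i z ≈ x
    at≈ (value p) = p

    module _ {i : ℕ} where
      value-at : ∀ z → Value i z (at i z)
      value-at z = value refl

      value-≈ : ∀ {z x y} → Value i z x → x ≈ y → Value i z y
      value-≈ (value p) x≈y = value (trans p x≈y)

      value-* : ∀ {z w x y} → Value i z x → Value i w y → Value i (z C.* w) (x * y)
      value-* {z} {w} (value p) (value r) = value (trans (at-* i z w) (*-cong p r))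

      value-+ : ∀ {z w x y} → Value i z x → Value i w y → Value i (z C.+ w) (x + y)
      value-+ {z} {w} (value p) (value r) = value (trans (at-+ i z w) (+-cong p r))

      value-- : ∀ {z w x y} → Value i z x → Value i w y → Value i (z C.- w) (x - y)
      value-- {z} {w} (value p) (value r) = value (trans (at-- i z w) (+-cong p (-‿cong r)))

      value-^ : ∀ {z x} n → Value i z x → Value i (z C.^ n) (x ^ n)
      value-^ {z} n (value p) = value (trans (at-^ i z n) (^-congˡ n p))
        where open import Algebra.Properties.Semiring.Exp semiring using (^-congˡ)

      value-· : ∀ {z x} n → Value i z x → Value i (n C.· z) (n · x)
      value-· {z} n (value p) = value (trans (at-· i n z) (×-congʳ n p))
        where open import Algebra.Properties.Monoid.Mult +-monoid using (×-congʳ)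

      value-Σ : ∀ {A : Set} {f : A → ℂ} {g : A → Carrier} xs → (∀ x → Value i (f x) (g x)) → Value i (Σ[ xs ] f)
          (Σˡ xs g)
      value-Σ {f = f} xs ps = value (trans (at-Σ i xs f) (Σˡ-cong′ xs λ x → at≈ (ps x)))

      -- `u` and `v` stand for -1 and 1 and are known only through their entries.
      module _ {u v : ℂ} where
        value-heckeTerm : Value i v 1# → ∀ t n →
          Value i (t C.^ (2 ℕ.* n ℕ.^ 2 ℕ.+ n) C.* (v C.+ t C.^ (2 ℕ.* n ℕ.+ 1)) C.* (Σ[ symRange n ] λ j → t C.^
              (∣ j ∣ ℕ.^ 2)))
            (heckeTerm (at i t) n)
        value-heckeTerm v≈1 t n = r
          where
          r = value-* (value-* (value-^ (2 ℕ.* n ℕ.^ 2 ℕ.+ n) (value-at t)) (value-+ v≈1 (value-^ (2 ℕ.* n ℕ.+ 1)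
              (value-at t))))
            (value-Σ (symRange n) (λ j → value-^ (∣ j ∣ ℕ.^ 2) (value-at t)))

        value-heckeTerm₋ : Value i u (- 1#) → Value i v 1# → ∀ t n →
          Value i (u C.^ n C.* t C.^ (2 ℕ.* n ℕ.^ 2 ℕ.+ n) C.* (v C.- t C.^ (2 ℕ.* n ℕ.+ 1))
            C.* (Σ[ symRange n ] λ j → u C.^ ∣ j ∣ C.* t C.^ (∣ j ∣ ℕ.^ 2)))
            (heckeTerm (- at i t) n)
        value-heckeTerm₋ u≈-1 v≈1 t n = value-≈ r (SignedPowers.heckeTerm-neg ring (at i t) n)
          where
          r = value-* (value-* (value-* (value-^ n u≈-1) (value-^ (2 ℕ.* n ℕ.^ 2 ℕ.+ n) (value-at t)))
              (value-- v≈1 (value-^ (2 ℕ.* n ℕ.+ 1) (value-at t))))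
            (value-Σ (symRange n) (λ j → value-* (value-^ ∣ j ∣ u≈-1) (value-^ (∣ j ∣ ℕ.^ 2) (value-at t))))

        value-tripleTerm : Value i u (- 1#) → ∀ q m n j → Value i (u C.^ j C.* (P m j n C.· q C.^ n)) (tripleTerm
            (at i q) (m , n , j))
        value-tripleTerm u≈-1 q m n j = r
          where
          r = value-* (value-^ j u≈-1) (value-· (P m j n) (value-^ n (value-at q)))

    module _ {I : Set} (f : I → ℂ) (φ : I → ℕ → Carrier)
      (f≈φ : ∀ x ε → 0ℚ ℚ.< ε → Eventually (λ i → norm (at i (f x) - φ x i) ℚ.≤ ε)) where

      private
        Σφ : List I → ℕ → Carrier
        Σφ xs i = Σˡ xs (λ x → φ x i)

        Σ′ : List I → ℕ → Carrier
        Σ′ xs i = Σˡ xs (λ x → at i (f x))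

      Σf≈Σφ : ∀ xs ε → 0ℚ ℚ.< ε → Eventually (λ i → norm (Σ′ xs i - Σφ xs i) ℚ.≤ ε)
      Σf≈Σφ []       ε 0<ε = 0 , λ i _ → ℚ.≤-trans (ℚ.≤-reflexive (norm-of-0 refl)) (ℚ.<⇒≤ 0<ε)
      Σf≈Σφ (x ∷ xs) ε 0<ε = eventually-map combine (eventually-× (f≈φ x (half ε) (0<half {ε} 0<ε)) (Σf≈Σφ xs
          (half ε) (0<half {ε} 0<ε)))
        where
        combine : ∀ i → norm (at i (f x) - φ x i) ℚ.≤ half ε × norm (Σ′ xs i - Σφ xs i) ℚ.≤ half ε →
          norm (Σ′ (x ∷ xs) i - Σφ (x ∷ xs) i) ℚ.≤ ε
        combine i (p , r) = ℚ.≤-trans (norm-+-minus-+ (at i (f x)) (Σ′ xs i) (φ x i) (Σφ xs i))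
          (≡.subst (norm (at i (f x) - φ x i) ℚ.+ norm (Σ′ xs i - Σφ xs i) ℚ.≤_) (half+half ε) (ℚ.+-mono-≤ p r))

      -- The entries of f need to approach φ only term by term, because each F is finite. Uniformity
      -- over all F disjoint from F₀ is required of φ alone.
      hasSum-intro : ∀ s →
        (∀ ε → 0ℚ ℚ.< ε → ∃ λ F₀ → Unique F₀ × Eventually (λ i →
          norm (Σˡ F₀ (λ x → φ x i) - at i s) ℚ.≤ ε
          × (∀ F → Unique F → All (λ x → ¬ x ∈ F₀) F → norm (Σˡ F (λ x → φ x i)) ℚ.≤ ε))) →
        HasSum f s
      hasSum-intro s tails = λ ε 0<ε → F₀ ε 0<ε , λ F F! F₀⊆F → close ε 0<ε F (complement (F₀! ε 0<ε) F! F₀⊆F)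
        where
        F₀ : ∀ ε → 0ℚ ℚ.< ε → List I
        F₀ ε 0<ε = proj₁ (tails (eighth ε) (0<eighth {ε} 0<ε))

        F₀! : ∀ ε 0<ε → Unique (F₀ ε 0<ε)
        F₀! ε 0<ε = proj₁ (proj₂ (tails (eighth ε) (0<eighth {ε} 0<ε)))

        combine : ∀ ε → 0ℚ ℚ.< ε → ∀ F₀ F zs → F ↭ F₀ ++ zs → Unique zs → All (λ x → ¬ x ∈ F₀) zs → ∀ i →
          norm (Σ′ F i - Σφ F i) ℚ.≤ eighth ε ×
          norm (Σφ F₀ i - at i s) ℚ.≤ eighth ε
          × (∀ F → Unique F → All (λ x → ¬ x ∈ F₀) F → norm (Σφ F i) ℚ.≤ eighth ε) →
          norm (at i (Σ[ F ] f C.- s)) ℚ.≤ half ε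
        combine ε 0<ε F₀ F zs F↭ zs! zs∉ i (p , r , t) =
          ≡.subst (ℚ._≤ half ε) (≡.sym (norm-cong (trans (at-- i (Σ[ F ] f) s) (+-congʳ (at-Σ i F f)))))
            -- Three errors of ε/8: from f to φ on F, from the φ-sum over F₀ to s, and the tail.
            -- Together they stay below the ε/2 that `∣∣<-intro` asks for.
            (ℚ.≤-trans (norm-through-split (Σ′ F i) {Σφ F i} {Σφ F₀ i} {Σφ zs i} (at i s)
                (trans (Σˡ-↭ (λ x → φ x i) F↭) (Σˡ-++ F₀ zs (λ x → φ x i))))
              (ℚ.≤-trans (ℚ.+-mono-≤ p (ℚ.+-mono-≤ r (t zs zs! zs∉))) (3eighths≤half ε (ℚ.<⇒≤ 0<ε))))

        close : ∀ ε 0<ε F → (∃ λ zs → F ↭ F₀ ε 0<ε ++ zs × Unique zs × All (λ z → ¬ z ∈ F₀ ε 0<ε) zs) →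
            ∣ Σ[ F ] f C.- s ∣< fromℚ ε
        close ε 0<ε F (zs , F↭ , zs! , zs∉) = r
          where
          r = ∣∣<-intro (Σ[ F ] f C.- s) ε 0<ε (eventually-map (combine ε 0<ε (F₀ ε 0<ε) F zs F↭ zs! zs∉)
            (eventually-× (Σf≈Σφ F (eighth ε) (0<eighth {ε} 0<ε)) (proj₂ (proj₂ (tails (eighth ε)
                (0<eighth {ε} 0<ε))))))

    module _ (σ δ : ℚ) (0≤σ : 0ℚ ℚ.≤ σ) (0<δ : 0ℚ ℚ.< δ) (σ+δ≡1 : σ ℚ.+ δ ≡ 1ℚ) where
      open Tails normedRing σ δ 0≤σ 0<δ σ+δ≡1
      open Rationals.Geometric σ δ 0≤σ 0<δ σ+δ≡1 using (γ; 0≤γ; ^-small; ^-antitone)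

      tail-small : ∀ B ε → 0ℚ ℚ.≤ B → 0ℚ ℚ.< ε → ∃ λ K → ∀ k → K ℕ.≤ k → tail k ℚ.* B ℚ.≤ ε
      tail-small B ε 0≤B 0<ε =
        let η , 0<η , Bη≤ε = share ((1ℚ ℚ.+ 1ℚ) ℚ.* B) ε (0≤* 0≤2 0≤B) 0<ε
            K , σ^K<η = ^-small {η} 0<η
        in K , λ k K≤k → ℚ.≤-trans (ℚ.≤-reflexive (regroup (σ Rationals.^ k)))
          (ℚ.≤-trans (*-monoˡ (0≤* 0≤2 0≤B) (ℚ.≤-trans (^-antitone K≤k) (ℚ.<⇒≤ σ^K<η))) Bη≤ε)
        where
        regroup : ∀ x → (1ℚ ℚ.+ 1ℚ) ℚ.* x ℚ.* B ≡ (1ℚ ℚ.+ 1ℚ) ℚ.* B ℚ.* x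
        regroup x = ℚ-Solver.solve 3 (λ t x b → t ℚ-Solver.:* x ℚ-Solver.:* b ℚ-Solver.:= t ℚ-Solver.:* b
            ℚ-Solver.:* x) ≡.refl (1ℚ ℚ.+ 1ℚ) x B

      Small : Carrier → Set
      Small z = ∀ w → norm (z ^ w) ℚ.≤ (σ ℚ.* σ) Rationals.^ w ℚ.+ (σ ℚ.* σ) Rationals.^ w

      small-neg : ∀ {z} → Small z → Small (- z)
      small-neg {z} z-small w = ≡.subst (ℚ._≤ _) (≡.sym (≡.trans (norm-cong (Monomials.neg^ ring z w))
          (norm-sign w (z ^ w)))) (z-small w)

      HeckeLimit : (ℕ → Carrier) → ℂ → Set
      HeckeLimit z s = ∀ ε → 0ℚ ℚ.< ε → ∃ λ K → ∀ k → K ℕ.≤ k → Eventually (λ i → norm (Σˡ (upTo k) (heckeTerm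
          (z i)) - at i s) ℚ.≤ ε)

      module _ (z : ℕ → Carrier) (z-small : Eventually (λ i → Small (z i))) where

        heckeTail : ∀ ε → 0ℚ ℚ.< ε → ∃ λ K → ∀ i → Small (z i) → ∀ F → Unique F → All (λ n → ¬ n ∈ upTo K) F →
            norm (Σˡ F (heckeTerm (z i))) ℚ.≤ ε
        heckeTail ε 0<ε =
          let K , tail≤ = tail-small (κ ℚ.* γ) ε (0≤* 0≤κ 0≤γ) 0<ε
          in K , λ i small F F! F∉ → ℚ.≤-trans
            (norm-hecke (z i) small F! (All.map (λ n∉ → ℕ.≮⇒≥ (n∉ ∘ ∈-upTo⁺)) F∉)) (tail≤ K ℕ.≤-refl)

        module _ {f : ℕ → ℂ} (f≈ : ∀ i n → Value i (f n) (heckeTerm (z i) n)) where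

          private
            partialSum : ℕ → ℂ
            partialSum k = Σ[ upTo k ] f

            at-partialSum : ∀ i k → at i (partialSum k) ≈ Σˡ (upTo k) (heckeTerm (z i))
            at-partialSum i k = at≈ (value-Σ (upTo k) (f≈ i))

            uniform : ∀ ε → 0ℚ ℚ.< ε → ∃ λ K → Eventually (λ i → ∀ k → K ℕ.≤ k → norm (at i (partialSum k) - at i
                (partialSum K)) ℚ.≤ ε)
            uniform ε 0<ε =
              let K , tail≤ = heckeTail ε 0<ε
              in K , eventually-map (λ i small k K≤k →
                let zs , k↭ , zs! , zs∉ = complement (Unique.upTo⁺ K) (Unique.upTo⁺ k) (λ n∈ → ∈-upTo⁺ (ℕ.<-≤-trans (∈-upTo⁻ n∈) K≤k))
                in ≡.subst (ℚ._≤ ε) (≡.sym (norm-cong (trans (+-cong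
                    (trans (at-partialSum i k) (trans (Σˡ-↭ (heckeTerm (z i)) k↭) (Σˡ-++ (upTo K) zs (heckeTerm
                        (z i)))))
                    (-‿cong (at-partialSum i K))) (cancel (Σˡ (upTo K) (heckeTerm (z i))) (Σˡ zs (heckeTerm
                        (z i)))))))
                  (tail≤ i small zs zs! zs∉)) z-small

            limit-of : ∃ λ s → ∀ ε → 0ℚ ℚ.< ε → ∃ λ K → ∀ k → K ℕ.≤ k → Eventually (λ i → norm (at i
                (partialSum k) - at i s) ℚ.≤ ε)
            limit-of = limit partialSum uniform

          heckeSum : ℂ
          heckeSum = proj₁ limit-of

          heckeSum-limit : HeckeLimit z heckeSum
          heckeSum-limit ε 0<ε =
            let K , close = proj₂ limit-of ε 0<ε
            in K , λ k K≤k → eventually-map (λ i → ≡.subst (ℚ._≤ ε) (norm-cong (+-congʳ (at-partialSum i k))))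
                (close k K≤k)

          heckeSum-hasSum : HasSum f heckeSum
          heckeSum-hasSum = r
            where
            tails : ∀ ε → 0ℚ ℚ.< ε → ∃ λ F₀ → Unique F₀ × Eventually (λ i →
              norm (Σˡ F₀ (λ n → heckeTerm (z i) n) - at i heckeSum) ℚ.≤ ε
              × (∀ F → Unique F → All (λ n → ¬ n ∈ F₀) F → norm (Σˡ F (λ n → heckeTerm (z i) n)) ℚ.≤ ε))
            tails ε 0<ε =
              let K₁ , tail≤ = heckeTail ε 0<ε
                  K₂ , close = heckeSum-limit ε 0<ε
                  K = K₁ ℕ.⊔ K₂
              in upTo K , Unique.upTo⁺ K , eventually-map
                (λ i (near , small) → near , λ F F! F∉ → tail≤ i small F F!
                  (All.map (λ n∉ n∈ → n∉ (∈-upTo⁺ (ℕ.<-≤-trans (∈-upTo⁻ n∈) (ℕ.m≤m⊔n K₁ K₂)))) F∉))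
                (eventually-× (close K (ℕ.m≤n⊔m K₁ K₂)) z-small)

            r = hasSum-intro f (λ n i → heckeTerm (z i) n)
              (λ n ε 0<ε → 0 , λ i _ → ℚ.≤-trans (ℚ.≤-reflexive (norm-of-0 (at≈ (f≈ i n))))
                  (ℚ.<⇒≤ 0<ε)) heckeSum tails

        module _ {f : Triple → ℂ} {A B s : ℂ} (h : Carrier) (2h≈1 : h * (1# + 1#) ≈ 1#) (h≤1 : norm h ℚ.≤ 1ℚ)
          (s≈ : ∀ i → at i s ≈ h * at i A + h * at i B)
          (A-limit : HeckeLimit z A) (B-limit : HeckeLimit (λ i → - z i) B)
          (f≈ : ∀ x ε → 0ℚ ℚ.< ε → Eventually (λ i → norm (at i (f x) - tripleTerm (z i * z i) x) ℚ.≤ ε)) where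

          private
            norm-h : ∀ x → norm (h * x) ℚ.≤ norm x
            norm-h x = ℚ.≤-trans (norm-* h x) (ℚ.≤-trans (*-monoʳ (0≤norm x) h≤1) (ℚ.≤-reflexive (ℚ.*-identityˡ
                (norm x))))

            -- Four errors of size e: pairs in the box of total at least b, the truncated identity,
            -- and the two Hecke-type limits. Later e is ε/4.
            estimate : ∀ e b i → Small (z i) →
              tail b ℚ.* (γ ℚ.* C) ℚ.≤ e →
              tail (suc b) ℚ.* ((γ ℚ.* C ℚ.+ γ ℚ.* C) ℚ.+ (κ ℚ.* γ ℚ.+ κ ℚ.* γ)) ℚ.≤ e →
              norm (Σˡ (upTo (suc b)) (heckeTerm (z i)) - at i A) ℚ.≤ e →
              norm (Σˡ (upTo (suc b)) (heckeTerm (- z i)) - at i B) ℚ.≤ e →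
              norm (Σˡ (triples b) (tripleTerm (z i * z i)) - at i s) ℚ.≤ (e ℚ.+ e) ℚ.+ (e ℚ.+ e)
            estimate e b i small tail≤ error≤ A≤ B≤ =
              let zs , box↭ , zs! , zs⊆ , zs-high = box-split b
                  p = Σˡ (box b) (partitionTerm (z i * z i))
                  E = Σˡ (concatMap fiber (triples b)) (partitionTerm (z i * z i))
                  Z = Σˡ zs (partitionTerm (z i * z i))
                  X = Σˡ (upTo (suc b)) (heckeTerm (z i))
                  Y = Σˡ (upTo (suc b)) (heckeTerm (- z i))
                  p≈ = trans (Σˡ-↭ (partitionTerm (z i * z i)) box↭) (Σˡ-++ (concatMap fiber (triples b)) zs
                      (partitionTerm (z i * z i)))
              in begin
                norm (Σˡ (triples b) (tripleTerm (z i * z i)) - at i s)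
                  ≡⟨ norm-cong (trans (+-cong (fibers-sum (z i * z i) (triples b)) (-‿cong (s≈ i)))
                      (halves 2h≈1 E Z X Y (at i A) (at i B) p≈)) ⟩
                norm ((- Z + h * error (z i) b) + (h * (X - at i A) + h * (Y - at i B)))
                  ≤⟨ ℚ.≤-trans (norm-+ (- Z + h * error (z i) b) (h * (X - at i A) + h * (Y - at i B)))
                       (ℚ.+-mono-≤ (norm-+ (- Z) (h * error (z i) b)) (norm-+ (h * (X - at i A)) (h *
                           (Y - at i B)))) ⟩
                (norm (- Z) ℚ.+ norm (h * error (z i) b)) ℚ.+ (norm (h * (X - at i A)) ℚ.+ norm (h * (Y - at i B)))
                  ≤⟨ ℚ.+-mono-≤ (ℚ.+-mono-≤
                         (ℚ.≤-trans (ℚ.≤-reflexive (norm-neg Z)) (ℚ.≤-trans (norm-partition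
                             (z i) small {b} {b} zs! zs⊆ zs-high) tail≤))
                         (ℚ.≤-trans (norm-h (error (z i) b)) (ℚ.≤-trans (norm-error (z i) small b) error≤)))
                       (ℚ.+-mono-≤ (ℚ.≤-trans (norm-h (X - at i A)) A≤) (ℚ.≤-trans (norm-h (Y - at i B)) B≤)) ⟩
                (e ℚ.+ e) ℚ.+ (e ℚ.+ e) ∎
              where open ℚ.≤-Reasoning

            tripleTail : ∀ b i → Small (z i) → ∀ F → Unique F → All (λ x → ¬ x ∈ triples b) F →
              norm (Σˡ F (tripleTerm (z i * z i))) ℚ.≤ tail b ℚ.* (γ ℚ.* C)
            tripleTail b i small F F! F∉ =
              -- Bounding the second coordinates by N places all fibres over F in the finite
              -- `box N`; the smallness comes from b alone.
              let N , F≤N = upper-bound (λ x → proj₁ (proj₂ x)) F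
              in ℚ.≤-trans (ℚ.≤-reflexive (norm-cong (fibers-sum (z i * z i) F)))
                (norm-partition (z i) small {b} {N} (fibers-unique F!)
                  (λ p∈ → let x , x∈ , p∈x = find (∈-concatMap⁻ fiber p∈) in ∈-fiber⇒∈-box {x} (All.lookup F≤N x∈) p∈x)
                  (All.tabulate λ p∈ → let x , x∈ , p∈x = find (∈-concatMap⁻ fiber p∈) in fiber-high {x} (All.lookup F∉ x∈) p∈x))

          tripleSum-hasSum : HasSum f s
          tripleSum-hasSum = r
            where
            0≤γC : 0ℚ ℚ.≤ γ ℚ.* C
            0≤γC = 0≤* 0≤γ 0≤C
            0≤κγ : 0ℚ ℚ.≤ κ ℚ.* γ
            0≤κγ = 0≤* 0≤κ 0≤γ

            tails : ∀ ε → 0ℚ ℚ.< ε → ∃ λ F₀ → Unique F₀ × Eventually (λ i →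
              norm (Σˡ F₀ (λ x → tripleTerm (z i * z i) x) - at i s) ℚ.≤ ε
              × (∀ F → Unique F → All (λ x → ¬ x ∈ F₀) F → norm (Σˡ F (λ x → tripleTerm (z i * z i) x)) ℚ.≤ ε))
            tails ε 0<ε = triples b , triples-unique b , eventually-map bounds (eventually-× z-small
                (eventually-× (proj₂ stageA (suc b) (ℕ.m≤n⇒m≤1+n K₃≤b)) (proj₂ stageB (suc b) (ℕ.m≤n⇒m≤1+n K₄≤b))))
              where
              0<e : 0ℚ ℚ.< half (half ε)
              0<e = 0<half {half ε} (0<half {ε} 0<ε)
              stage₁ = tail-small (γ ℚ.* C) (half (half ε)) 0≤γC 0<e
              stage₂ = tail-small ((γ ℚ.* C ℚ.+ γ ℚ.* C) ℚ.+ (κ ℚ.* γ ℚ.+ κ ℚ.* γ)) (half (half ε)) (0≤+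
                  (0≤+ 0≤γC 0≤γC) (0≤+ 0≤κγ 0≤κγ)) 0<e
              stageA = A-limit (half (half ε)) 0<e
              stageB = B-limit (half (half ε)) 0<e
              K₁ = proj₁ stage₁
              K₂ = proj₁ stage₂
              K₃ = proj₁ stageA
              K₄ = proj₁ stageB
              b = (K₁ ℕ.⊔ K₂) ℕ.⊔ (K₃ ℕ.⊔ K₄)
              K₁≤b : K₁ ℕ.≤ b
              K₁≤b = ℕ.≤-trans (ℕ.m≤m⊔n K₁ K₂) (ℕ.m≤m⊔n (K₁ ℕ.⊔ K₂) (K₃ ℕ.⊔ K₄))
              K₂≤b : K₂ ℕ.≤ b
              K₂≤b = ℕ.≤-trans (ℕ.m≤n⊔m K₁ K₂) (ℕ.m≤m⊔n (K₁ ℕ.⊔ K₂) (K₃ ℕ.⊔ K₄))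
              K₃≤b : K₃ ℕ.≤ b
              K₃≤b = ℕ.≤-trans (ℕ.m≤m⊔n K₃ K₄) (ℕ.m≤n⊔m (K₁ ℕ.⊔ K₂) (K₃ ℕ.⊔ K₄))
              K₄≤b : K₄ ℕ.≤ b
              K₄≤b = ℕ.≤-trans (ℕ.m≤n⊔m K₃ K₄) (ℕ.m≤n⊔m (K₁ ℕ.⊔ K₂) (K₃ ℕ.⊔ K₄))

              tail≤ : tail b ℚ.* (γ ℚ.* C) ℚ.≤ half (half ε)
              tail≤ = proj₂ stage₁ b K₁≤b

              bounds : ∀ i → Small (z i) ×
                norm (Σˡ (upTo (suc b)) (heckeTerm (z i)) - at i A) ℚ.≤ half (half ε) ×
                norm (Σˡ (upTo (suc b)) (heckeTerm (- z i)) - at i B) ℚ.≤ half (half ε) →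
                norm (Σˡ (triples b) (λ x → tripleTerm (z i * z i) x) - at i s) ℚ.≤ ε
                × (∀ F → Unique F → All (λ x → ¬ x ∈ triples b) F → norm (Σˡ F (λ x → tripleTerm
                    (z i * z i) x)) ℚ.≤ ε)
              bounds i (small , near-A , near-B) =
                ℚ.≤-trans (estimate (half (half ε)) b i small tail≤ (proj₂ stage₂ (suc b)
                    (ℕ.m≤n⇒m≤1+n K₂≤b)) near-A near-B) (ℚ.≤-reflexive (4quarters ε))
                , λ F F! F∉ → ℚ.≤-trans (tripleTail b i small F F! F∉) (ℚ.≤-trans tail≤ (quarter≤ ε 0<ε))

            r = hasSum-intro f (λ x i → tripleTerm (z i * z i) x) f≈ s tails

        module _ {f : Triple → ℂ} {A B s : ℂ} {q : ℂ} (f≈ : ∀ i x → Value i (f x) (tripleTerm (at i q) x))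
          (h : Carrier) (2h≈1 : h * (1# + 1#) ≈ 1#) (h≤1 : norm h ℚ.≤ 1ℚ)
          (s≈ : ∀ i → Value i s (h * at i A + h * at i B))
          (A-limit : HeckeLimit z A) (B-limit : HeckeLimit (λ i → - z i) B)
          (bounded : Eventually (λ i → Bounded (at i q) × Bounded (z i * z i)))
          (q≈z² : ∀ ε → 0ℚ ℚ.< ε → Eventually (λ i → norm (at i q - z i * z i) ℚ.≤ ε)) where

          substitute : ∀ x ε → 0ℚ ℚ.< ε → Eventually (λ i → norm (at i (f x) - tripleTerm (z i * z i) x) ℚ.≤ ε)
          substitute x ε 0<ε =
            let C , 0≤C , lip = tripleTerm-lipschitz x
                η , 0<η , Cη≤ε = share C ε 0≤C 0<ε
            in eventually-map (λ i ((q-bounded , z²-bounded) , near) → ℚ.≤-trans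
                  (ℚ.≤-reflexive (norm-cong (+-congʳ (at≈ (f≈ i x)))))
                  (ℚ.≤-trans (lip (at i q) (z i * z i) q-bounded z²-bounded) (ℚ.≤-trans (*-monoˡ 0≤C near) Cη≤ε)))
                (eventually-× bounded (q≈z² η 0<η))

          partitionSum-hasSum : HasSum f s
          partitionSum-hasSum = r
            where r = tripleSum-hasSum {f} {A} {B} {s} h 2h≈1 h≤1 (λ i → at≈ (s≈ i)) A-limit B-limit substitute

      module _ {u v h½ : ℂ} (u≈-1 : ∀ i → Value i u (- 1#)) (v≈1 : ∀ i → Value i v 1#)
        (h : Carrier) (h½≈h : ∀ i → Value i h½ h) (2h≈1 : h * (1# + 1#) ≈ 1#) (h≤1 : norm h ℚ.≤ 1ℚ)
        (q t : ℂ) (t-small : Eventually (λ i → Small (at i t)))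
        (bounded : Eventually (λ i → Bounded (at i q) × Bounded (at i t * at i t)))
        (q≈t² : ∀ ε → 0ℚ ℚ.< ε → Eventually (λ i → norm (at i q - at i t * at i t) ℚ.≤ ε)) where

        private
          heckeSum-exists : ∀ (z : ℕ → Carrier) → Eventually (λ i → Small (z i)) → ∀ {f : ℕ → ℂ} →
            (∀ i n → Value i (f n) (heckeTerm (z i) n)) → ∃ λ s → HasSum f s × HeckeLimit z s
          heckeSum-exists z z-small {f} f≈ = heckeSum z z-small f≈ , hs , heckeSum-limit z z-small f≈
            where hs = heckeSum-hasSum z z-small f≈

          combine :
            (∃ λ A → HasSum (λ n → t C.^ (2 ℕ.* n ℕ.^ 2 ℕ.+ n) C.* (v C.+ t C.^ (2 ℕ.* n ℕ.+ 1))
              C.* (Σ[ symRange n ] λ j → t C.^ (∣ j ∣ ℕ.^ 2))) A × HeckeLimit (λ i → at i t) A) →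
            (∃ λ B → HasSum (λ n → u C.^ n C.* t C.^ (2 ℕ.* n ℕ.^ 2 ℕ.+ n) C.* (v C.- t C.^ (2 ℕ.* n ℕ.+ 1))
              C.* (Σ[ symRange n ] λ j → u C.^ ∣ j ∣ C.* t C.^ (∣ j ∣ ℕ.^ 2))) B × HeckeLimit (λ i → - at i t) B) →
            ∃ λ A → ∃ λ B →
              HasSum (λ (n : ℕ) → t C.^ (2 ℕ.* n ℕ.^ 2 ℕ.+ n) C.* (v C.+ t C.^ (2 ℕ.* n ℕ.+ 1))
                C.* (Σ[ symRange n ] λ j → t C.^ (∣ j ∣ ℕ.^ 2))) A
              × HasSum (λ (n : ℕ) → u C.^ n C.* t C.^ (2 ℕ.* n ℕ.^ 2 ℕ.+ n) C.* (v C.- t C.^ (2 ℕ.* n ℕ.+ 1))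
                C.* (Σ[ symRange n ] λ j → u C.^ ∣ j ∣ C.* t C.^ (∣ j ∣ ℕ.^ 2))) B
              × HasSum (λ ((m , n , j) : ℕ × ℕ × ℕ) → u C.^ j C.* (P m j n C.· q C.^ n)) (h½ C.* A C.+ h½ C.* B)
          combine (A , A-sum , A-limit) (B , B-sum , B-limit) = A , B , A-sum , B-sum , r
            where
            r = partitionSum-hasSum (λ i → at i t) t-small
              (λ i x → value-tripleTerm {v = v} (u≈-1 i) q (proj₁ x) (proj₁ (proj₂ x)) (proj₂ (proj₂ x)))
              h 2h≈1 h≤1 (λ i → value-+ (value-* (h½≈h i) (value-at A)) (value-* (h½≈h i) (value-at B)))
              A-limit B-limit bounded q≈t²

        generatingFunctions : ∃ λ A → ∃ λ B →
          HasSum (λ (n : ℕ) → t C.^ (2 ℕ.* n ℕ.^ 2 ℕ.+ n) C.* (v C.+ t C.^ (2 ℕ.* n ℕ.+ 1))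
            C.* (Σ[ symRange n ] λ j → t C.^ (∣ j ∣ ℕ.^ 2))) A
          × HasSum (λ (n : ℕ) → u C.^ n C.* t C.^ (2 ℕ.* n ℕ.^ 2 ℕ.+ n) C.* (v C.- t C.^ (2 ℕ.* n ℕ.+ 1))
            C.* (Σ[ symRange n ] λ j → u C.^ ∣ j ∣ C.* t C.^ (∣ j ∣ ℕ.^ 2))) B
          × HasSum (λ ((m , n , j) : ℕ × ℕ × ℕ) → u C.^ j C.* (P m j n C.· q C.^ n)) (h½ C.* A C.+ h½ C.* B)
        generatingFunctions = combine A-exists B-exists
          where
          A-exists = heckeSum-exists (λ i → at i t) t-small (λ i → value-heckeTerm {u = u} (v≈1 i) t)
          B-exists = heckeSum-exists (λ i → - at i t) (eventually-map (λ i → small-neg) t-small) (λ i →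
              value-heckeTerm₋ (u≈-1 i) (v≈1 i) t)

-- Entries of complex numbers, completeness, and the decay of powers of t.

module GaussianEntries where
  open Rationals
  open Gaussian
  open Smallness
  open G using () renaming (Carrier to ℚ[i])
  open C using (ℂ; Σ[_]_)
  open import Algebra.Properties.Monoid.Mult G.+-monoid using () renaming (_×_ to _·_)
  open ℚ.≤-Reasoning

  at : ℕ → ℂ → ℚ[i]
  at i z = seq (re z) i , seq (im z) i

  at-* : ∀ i z w {y} → at i w ≡ y → at i (z C.* w) ≡ at i z G.* y
  at-* i z w ≡.refl = ≡.refl

  at-+ : ∀ i z w {y} → at i w ≡ y → at i (z C.+ w) ≡ at i z G.+ y
  at-+ i z w ≡.refl = ≡.refl

  at-^ : ∀ i z n → at i (z C.^ n) ≡ at i z G.^ n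
  at-^ i z zero    = ≡.refl
  at-^ i z (suc n) = at-* i z (z C.^ n) (at-^ i z n)

  at-· : ∀ i n z → at i (n C.· z) ≡ n · at i z
  at-· i zero    z = ≡.refl
  at-· i (suc n) z = at-+ i z (n C.· z) (at-· i n z)

  at-Σ : ∀ {A : Set} i xs (f : A → ℂ) → at i (Σ[ xs ] f) ≡ G.Σˡ xs (at i ∘ f)
  at-Σ i []       f = ≡.refl
  at-Σ i (x ∷ xs) f = at-+ i (f x) (Σ[ xs ] f) (at-Σ i xs f)

  ∣∣<-intro : ∀ z ε → 0ℚ ℚ.< ε → Eventually (λ i → norm (at i z) ℚ.≤ half ε) → C.∣ z ∣< C.fromℚ ε
  ∣∣<-intro z ε 0<ε bounds = (ε , 0<ε , 0 , λ _ _ → ℚ.≤-reflexive (ℚ.+-identityˡ ε))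
    -- The strict order needs a rational gap. From |z|² ≤ ε²/4 the gap ε²/4 below ε² is available.
    , half ε ℚ.* half ε , 0<* {half ε} {half ε} (0<half {ε} 0<ε) (0<half {ε} 0<ε) , eventually-map square bounds
    where
    0≤h : 0ℚ ℚ.≤ half ε
    0≤h = ℚ.<⇒≤ (0<half {ε} 0<ε)

    square : ∀ i → norm (at i z) ℚ.≤ half ε → sq (at i z) ℚ.+ half ε ℚ.* half ε ℚ.≤ ε ℚ.* ε
    square i n≤ = begin
      sq (at i z) ℚ.+ half ε ℚ.* half ε
        ≤⟨ ℚ.+-monoˡ-≤ (half ε ℚ.* half ε) (ℚ.≤-trans (sq≤norm² (at i z)) (*-mono {norm (at i z)} {half ε} 0≤h
            (0≤norm (at i z)) n≤ n≤)) ⟩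
      half ε ℚ.* half ε ℚ.+ half ε ℚ.* half ε
        ≤⟨ ≤-gap (half ε ℚ.* half ε ℚ.+ half ε ℚ.* half ε) (0≤+ (0≤* 0≤h 0≤h) (0≤* 0≤h 0≤h))
             (solve 1 (λ e → let h = con ½ :* e in e :* e := (h :* h :+ h :* h) :+ (h :* h :+ h :* h)) ≡.refl ε) ⟩
      ε ℚ.* ε ∎
      where open ℚ-Solver

  -- The limit of x is the diagonal of its representatives: uniformity makes the single entry x i i enough.
  module Diagonal (x : ℕ → ℂ)
    (uniform : ∀ ε → 0ℚ ℚ.< ε → ∃ λ K → Eventually (λ i → ∀ k → K ℕ.≤ k → norm (at i (x k) G.- at i
        (x K)) ℚ.≤ ε)) where

    diagonal-cauchy : (part : ℂ → C.ℝ) → (∀ i z w → ℚ.∣ seq (part z) i ℚ.- seq (part w) i ∣ ℚ.≤ norm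
        (at i z G.- at i w)) →
      C.IsCauchy (λ i → seq (part (x i)) i)
    diagonal-cauchy part part≤ ε 0<ε = bound , λ m n m≥ n≥ → begin-strict
      ℚ.∣ a m ℚ.- a n ∣
        ≡⟨ ≡.cong ℚ.∣_∣ (solve 4 (λ a b c d → a :- b := (a :- c) :+ ((c :- d) :+ (:- (b :- d)))) ≡.refl (a m)
            (a n) (c m) (c n)) ⟩
      ℚ.∣ (a m ℚ.- c m) ℚ.+ ((c m ℚ.- c n) ℚ.+ ℚ.- (a n ℚ.- c n)) ∣
        ≤⟨ ℚ.≤-trans (ℚ.∣p+q∣≤∣p∣+∣q∣ (a m ℚ.- c m) _) (ℚ.+-monoʳ-≤ ℚ.∣ a m ℚ.- c m ∣ (ℚ.∣p+q∣≤∣p∣+∣q∣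
            (c m ℚ.- c n) _)) ⟩
      ℚ.∣ a m ℚ.- c m ∣ ℚ.+ (ℚ.∣ c m ℚ.- c n ∣ ℚ.+ ℚ.∣ ℚ.- (a n ℚ.- c n) ∣)
        ≤⟨ ℚ.+-mono-≤ (near m m≥) (ℚ.+-mono-≤ (ℚ.<⇒≤ (proj₂ stable m n (ℕ.m⊔n≤o⇒n≤o (K ℕ.⊔ N) N′ m≥) (ℕ.m⊔n≤o⇒n≤o
            (K ℕ.⊔ N) N′ n≥)))
             (ℚ.≤-trans (ℚ.≤-reflexive (ℚ.∣-p∣≡∣p∣ (a n ℚ.- c n))) (near n n≥))) ⟩
      e ℚ.+ (e ℚ.+ e)  ≤⟨ 3eighths≤half ε (ℚ.<⇒≤ 0<ε) ⟩
      half ε  ≡⟨ ℚ.+-identityˡ (half ε) ⟨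
      0ℚ ℚ.+ half ε  <⟨ ℚ.+-monoˡ-< (half ε) (0<half {ε} 0<ε) ⟩
      half ε ℚ.+ half ε  ≡⟨ half+half ε ⟩
      ε ∎
      where
      open ℚ-Solver
      e = eighth ε
      0<e = 0<eighth {ε} 0<ε
      K = proj₁ (uniform e 0<e)
      N = proj₁ (proj₂ (uniform e 0<e))
      stable = cauchy (part (x K)) e 0<e
      N′ = proj₁ stable
      bound = K ℕ.⊔ N ℕ.⊔ N′
      a c : ℕ → ℚ
      a i = seq (part (x i)) i
      c i = seq (part (x K)) i
      near : ∀ i → bound ℕ.≤ i → ℚ.∣ a i ℚ.- c i ∣ ℚ.≤ e
      near i i≥ = ℚ.≤-trans (part≤ i (x i) (x K)) (proj₂ (proj₂ (uniform e 0<e)) i (ℕ.m⊔n≤o⇒n≤o K N KN≤i) i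
          (ℕ.m⊔n≤o⇒m≤o K N KN≤i))
        where KN≤i = ℕ.m⊔n≤o⇒m≤o (K ℕ.⊔ N) N′ i≥

    re-≤ : ∀ i z w → ℚ.∣ seq (re z) i ℚ.- seq (re w) i ∣ ℚ.≤ norm (at i z G.- at i w)
    re-≤ i z w = ≤-gap ℚ.∣ seq (im z) i ℚ.- seq (im w) i ∣ (ℚ.0≤∣p∣ (seq (im z) i ℚ.- seq (im w) i)) ≡.refl

    im-≤ : ∀ i z w → ℚ.∣ seq (im z) i ℚ.- seq (im w) i ∣ ℚ.≤ norm (at i z G.- at i w)
    im-≤ i z w = ≤-gap ℚ.∣ seq (re z) i ℚ.- seq (re w) i ∣ (ℚ.0≤∣p∣ (seq (re z) i ℚ.- seq (re w) i))
      (ℚ.+-comm ℚ.∣ seq (re z) i ℚ.- seq (re w) i ∣ ℚ.∣ seq (im z) i ℚ.- seq (im w) i ∣)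

    lim : ℂ
    lim = mkℝ (λ i → seq (re (x i)) i) (diagonal-cauchy re re-≤) C.+i mkℝ (λ i → seq (im (x i)) i)
        (diagonal-cauchy im im-≤)

    -- At entry i the limit is `x i`. For i ≥ k ≥ K both `x k` and `x i` are within ε/2 of `x K`
    -- there, which is why the threshold includes k.
    lim-close : ∀ ε → 0ℚ ℚ.< ε → ∃ λ K → ∀ k → K ℕ.≤ k → Eventually (λ i → norm (at i (x k) G.- at i lim) ℚ.≤ ε)
    lim-close ε 0<ε = K , λ k K≤k → k ℕ.⊔ N , λ i i≥ →
      let k≤i = ℕ.m⊔n≤o⇒m≤o k N i≥
      in triangle i k (bound i (ℕ.m⊔n≤o⇒n≤o k N i≥) k K≤k) (bound i (ℕ.m⊔n≤o⇒n≤o k N i≥) i (ℕ.≤-trans K≤k k≤i))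
      where
      h = half ε
      K = proj₁ (uniform h (0<half {ε} 0<ε))
      N = proj₁ (proj₂ (uniform h (0<half {ε} 0<ε)))
      bound = proj₂ (proj₂ (uniform h (0<half {ε} 0<ε)))

      triangle : ∀ i k → norm (at i (x k) G.- at i (x K)) ℚ.≤ h → norm (at i (x i) G.- at i (x K)) ℚ.≤ h → norm
          (at i (x k) G.- at i (x i)) ℚ.≤ ε
      triangle i k p r = ℚ.≤-trans (Summation.norm-through gaussianNormed (at i (x k)) (at i (x i)) (at i (x K)))
        (≡.subst (norm (at i (x k) G.- at i (x K)) ℚ.+ norm (at i (x i) G.- at i (x K)) ℚ.≤_) (half+half ε)
            (ℚ.+-mono-≤ p r))

  limit : (x : ℕ → ℂ) →
    (∀ ε → 0ℚ ℚ.< ε → ∃ λ K → Eventually (λ i → ∀ k → K ℕ.≤ k → norm (at i (x k) G.- at i (x K)) ℚ.≤ ε)) →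
    ∃ λ s → ∀ ε → 0ℚ ℚ.< ε → ∃ λ K → ∀ k → K ℕ.≤ k → Eventually (λ i → norm (at i (x k) G.- at i s) ℚ.≤ ε)
  limit x uniform = Diagonal.lim x uniform , Diagonal.lim-close x uniform

  open Summation gaussianNormed using (Bounded; module Entries)
  module Values = Entries at (λ i z w → ≡.refl) (λ i z w → ≡.refl) (λ i z w → ≡.refl) at-^ at-· at-Σ ∣∣<-intro limit
  open Values using (Value; value; Small)

  p≤∣p∣ : ∀ p → p ℚ.≤ ℚ.∣ p ∣
  p≤∣p∣ p = cases (ℚ.∣p∣≡p∨∣p∣≡-p p)
    where
    cases : _ → _
    cases (inj₁ ∣p∣≡p) = ℚ.≤-reflexive (≡.sym ∣p∣≡p)
    cases (inj₂ ∣p∣≡-p) = ≤-gap (ℚ.∣ p ∣ ℚ.+ ℚ.∣ p ∣) (0≤+ (ℚ.0≤∣p∣ p) (ℚ.0≤∣p∣ p))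
      (≡.trans (solve 2 (λ p a → a := (:- (:- p) :+ (:- p :+ (a :+ a))) :- a) ≡.refl p ℚ.∣ p ∣)
        (≡.trans (≡.cong (λ x → (ℚ.- (ℚ.- p) ℚ.+ (x ℚ.+ (ℚ.∣ p ∣ ℚ.+ ℚ.∣ p ∣))) ℚ.- ℚ.∣ p ∣) (≡.sym ∣p∣≡-p))
          (solve 2 (λ p a → (:- (:- p) :+ (a :+ (a :+ a))) :- a := p :+ (a :+ a)) ≡.refl p ℚ.∣ p ∣)))
      where open ℚ-Solver

  norm≤2 : ∀ z → sq z ℚ.≤ 1ℚ → norm z ℚ.≤ 1ℚ ℚ.+ 1ℚ
  norm≤2 z sq≤1 = square-cancel-≤ (0≤+ 0≤1 0≤1) (ℚ.≤-trans (norm²≤2sq z) (ℚ.≤-trans (ℚ.+-mono-≤ sq≤1 sq≤1)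
    (≤-gap (1ℚ ℚ.+ 1ℚ) (0≤+ 0≤1 0≤1) ≡.refl)))

  -- |v|² - |u|² = (v - u)·(v + u) coordinatewise.
  sq-perturb : ∀ u v → sq u ℚ.≤ 1ℚ → norm (v G.- u) ℚ.≤ 1ℚ →
    sq v ℚ.≤ sq u ℚ.+ norm (v G.- u) ℚ.* (1ℚ ℚ.+ ((1ℚ ℚ.+ 1ℚ) ℚ.+ (1ℚ ℚ.+ 1ℚ)))
  sq-perturb u@(a , b) v@(c , d) sq≤1 near = begin
    c ℚ.* c ℚ.+ d ℚ.* d
      ≡⟨ solve 4 (λ a b c d → c :* c :+ d :* d := (a :* a :+ b :* b) :+ ((c :+ :- a) :* ((c :+ :- a) :+
          (a :+ a)) :+ (d :+ :- b) :* ((d :+ :- b) :+ (b :+ b)))) ≡.refl a b c d ⟩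
    sq u ℚ.+ (x ℚ.* (x ℚ.+ (a ℚ.+ a)) ℚ.+ y ℚ.* (y ℚ.+ (b ℚ.+ b)))
      ≤⟨ ℚ.+-monoʳ-≤ (sq u) (ℚ.+-mono-≤ (part x a (sum≤ˡ ℚ.∣ x ∣ ℚ.∣ y ∣ (ℚ.0≤∣p∣ y)) (sum≤ˡ ℚ.∣ a ∣ ℚ.∣ b ∣
          (ℚ.0≤∣p∣ b)))
           (part y b (sum≤ʳ ℚ.∣ x ∣ ℚ.∣ y ∣ (ℚ.0≤∣p∣ x)) (sum≤ʳ ℚ.∣ a ∣ ℚ.∣ b ∣ (ℚ.0≤∣p∣ a)))) ⟩
    sq u ℚ.+ (ℚ.∣ x ∣ ℚ.* D ℚ.+ ℚ.∣ y ∣ ℚ.* D)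
      ≡⟨ ≡.cong (sq u ℚ.+_) (≡.sym (ℚ.*-distribʳ-+ D ℚ.∣ x ∣ ℚ.∣ y ∣)) ⟩
    sq u ℚ.+ (ℚ.∣ x ∣ ℚ.+ ℚ.∣ y ∣) ℚ.* D ∎
    where
    open ℚ-Solver
    x = c ℚ.+ ℚ.- a
    y = d ℚ.+ ℚ.- b
    D = 1ℚ ℚ.+ ((1ℚ ℚ.+ 1ℚ) ℚ.+ (1ℚ ℚ.+ 1ℚ))

    sum≤ˡ : ∀ p r → 0ℚ ℚ.≤ r → p ℚ.≤ p ℚ.+ r
    sum≤ˡ p r 0≤r = ≤-gap r 0≤r ≡.refl
    sum≤ʳ : ∀ p r → 0ℚ ℚ.≤ p → r ℚ.≤ p ℚ.+ r
    sum≤ʳ p r 0≤p = ≤-gap p 0≤p (ℚ.+-comm p r)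

    part : ∀ x a → ℚ.∣ x ∣ ℚ.≤ norm (v G.- u) → ℚ.∣ a ∣ ℚ.≤ norm u → x ℚ.* (x ℚ.+ (a ℚ.+ a)) ℚ.≤ ℚ.∣ x ∣ ℚ.* D
    part x a x≤ a≤ = begin
      x ℚ.* (x ℚ.+ (a ℚ.+ a))  ≤⟨ p≤∣p∣ (x ℚ.* (x ℚ.+ (a ℚ.+ a))) ⟩
      ℚ.∣ x ℚ.* (x ℚ.+ (a ℚ.+ a)) ∣  ≡⟨ ℚ.∣p*q∣≡∣p∣*∣q∣ x (x ℚ.+ (a ℚ.+ a)) ⟩
      ℚ.∣ x ∣ ℚ.* ℚ.∣ x ℚ.+ (a ℚ.+ a) ∣
        ≤⟨ *-monoˡ (ℚ.0≤∣p∣ x) (ℚ.≤-trans (ℚ.∣p+q∣≤∣p∣+∣q∣ x (a ℚ.+ a)) (ℚ.+-mono-≤ (ℚ.≤-trans x≤ near)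
             (ℚ.≤-trans (ℚ.∣p+q∣≤∣p∣+∣q∣ a a) (ℚ.+-mono-≤ a≤2 a≤2)))) ⟩
      ℚ.∣ x ∣ ℚ.* D ∎
      where
      a≤2 : ℚ.∣ a ∣ ℚ.≤ 1ℚ ℚ.+ 1ℚ
      a≤2 = ℚ.≤-trans a≤ (norm≤2 u sq≤1)

  -- (1 - x)⁸ ≥ 1 - 8x.
  radius : ∀ ε → 0ℚ ℚ.< ε → ε ℚ.≤ 1ℚ → let σ = 1ℚ ℚ.- eighth ε in
    0ℚ ℚ.≤ σ × (∀ z → sq z ℚ.* sq z ℚ.≤ 1ℚ ℚ.- ε → sq z ℚ.≤ σ ℚ.* σ ℚ.* (σ ℚ.* σ))
  radius ε 0<ε ε≤1 = σ-nonNeg , λ z sq²≤ → square-cancel-≤ {sq z} {τ ℚ.* τ} (0≤* 0≤τ 0≤τ) (begin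
      sq z ℚ.* sq z  ≤⟨ sq²≤ ⟩
      1ℚ ℚ.- ε  ≤⟨ step ε 0≤ε ⟩
      (1ℚ ℚ.- half ε) ℚ.* (1ℚ ℚ.- half ε)
        ≤⟨ *-mono (ℚ.≤-trans 0≤1-h h≤) 0≤1-h h≤ h≤ ⟩
      (τ ℚ.* τ) ℚ.* (τ ℚ.* τ) ∎)
    where
    0≤½ = ℚ.nonNegative⁻¹ ½
    0≤ε = ℚ.<⇒≤ 0<ε
    0≤hε = 0≤* 0≤½ 0≤ε
    0≤hhε = 0≤* 0≤½ 0≤hε
    0≤hhhε = 0≤* 0≤½ 0≤hhε
    σ τ : ℚ
    σ = 1ℚ ℚ.- eighth ε
    τ = σ ℚ.* σ

    step : ∀ x → 0ℚ ℚ.≤ x → 1ℚ ℚ.- x ℚ.≤ (1ℚ ℚ.- half x) ℚ.* (1ℚ ℚ.- half x)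
    step x 0≤x = ≤-gap (half x ℚ.* half x) (0≤* (0≤* 0≤½ 0≤x) (0≤* 0≤½ 0≤x))
      (solve 1 (λ x → let h = con ½ :* x in (con 1ℚ :- h) :* (con 1ℚ :- h) := (con 1ℚ :- x) :+ h :* h) ≡.refl x)
      where open ℚ-Solver

    0≤1-h : 0ℚ ℚ.≤ 1ℚ ℚ.- half ε
    0≤1-h = ≤⇒0≤- (ℚ.≤-trans (half≤ ε 0≤ε) ε≤1)
    0≤1-hh : 0ℚ ℚ.≤ 1ℚ ℚ.- half (half ε)
    0≤1-hh = ≤⇒0≤- (ℚ.≤-trans (half≤ (half ε) 0≤hε) (ℚ.≤-trans (half≤ ε 0≤ε) ε≤1))
    σ-nonNeg : 0ℚ ℚ.≤ σ
    σ-nonNeg = ≤⇒0≤- (ℚ.≤-trans (half≤ (half (half ε)) 0≤hhε) (ℚ.≤-trans (half≤ (half ε) 0≤hε) (ℚ.≤-trans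
        (half≤ ε 0≤ε) ε≤1)))
    0≤τ : 0ℚ ℚ.≤ τ
    0≤τ = 0≤* σ-nonNeg σ-nonNeg

    hh≤ : 1ℚ ℚ.- half (half ε) ℚ.≤ τ
    hh≤ = step (half (half ε)) 0≤hhε
    h≤ : 1ℚ ℚ.- half ε ℚ.≤ τ ℚ.* τ
    h≤ = ℚ.≤-trans (step (half ε) 0≤hε) (*-mono 0≤τ 0≤1-hh hh≤ hh≤)

  bounded : ∀ z → sq z ℚ.≤ 1ℚ → Bounded z
  bounded z sq≤1 n = ℚ.≤-trans (norm-^ z 1ℚ n 0≤1 sq≤1) (ℚ.≤-reflexive (≡.cong₂ ℚ._+_ (one^ n) (one^ n)))
    where
    one^ : ∀ n → 1ℚ ^ n ≡ 1ℚ
    one^ zero    = ≡.refl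
    one^ (suc n) = ≡.trans (ℚ.*-identityˡ (1ℚ ^ n)) (one^ n)

  minusOne-value : ∀ i → Value i (C.- C.1#) (G.- G.1#)
  minusOne-value i = value ≡.refl

  one-value : ∀ i → Value i C.1# G.1#
  one-value i = value ≡.refl

  half-value : ∀ i → Value i C.½ᶜ (½ , 0ℚ)
  half-value i = value ≡.refl

  half-bounded : norm (½ , 0ℚ) ℚ.≤ 1ℚ
  half-bounded = ≤-gap ½ (ℚ.nonNegative⁻¹ ½) ≡.refl

  module Estimates (q t : ℂ) (t²≈q : t C.^ 2 C.≈ q) (e : ℚ) (0<e : 0ℚ ℚ.< e)
    (q-small : Eventually (λ i → sq (at i q) ℚ.+ e ℚ.≤ 1ℚ)) where

    e≤1 : e ℚ.≤ 1ℚ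
    e≤1 = ℚ.≤-trans (≤-gap (sq (at (proj₁ q-small) q)) (0≤sq (at (proj₁ q-small) q)) (ℚ.+-comm (sq (at
        (proj₁ q-small) q)) e))
      (proj₂ q-small (proj₁ q-small) ℕ.≤-refl)

    at-square : ∀ i → at i (t C.^ 2) ≡ at i t G.* at i t
    at-square i = ≡.trans (at-^ i t 2) (≡.cong (at i t G.*_) (G.*-identityʳ (at i t)))

    near : ∀ ε → 0ℚ ℚ.< ε → Eventually (λ i → norm (at i t G.* at i t G.- at i q) ℚ.≤ ε)
    near ε 0<ε = eventually-map
      (λ i (p , r) → ≡.subst₂ (λ x y → norm (x G.- at i q) ℚ.≤ y) (at-square i) (half+half ε) (ℚ.+-mono-≤
          (ℚ.<⇒≤ p) (ℚ.<⇒≤ r)))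
      (eventually-× (proj₁ t²≈q (half ε) (0<half {ε} 0<ε)) (proj₂ t²≈q (half ε) (0<half {ε} 0<ε)))

    q≈t² : ∀ ε → 0ℚ ℚ.< ε → Eventually (λ i → norm (at i q G.- at i t G.* at i t) ℚ.≤ ε)
    q≈t² ε 0<ε = eventually-map (λ i → ≡.subst (ℚ._≤ ε) (flip (at i t G.* at i t) (at i q))) (near ε 0<ε)
      where
      flip : ∀ x y → norm (x G.- y) ≡ norm (y G.- x)
      flip x y = ≡.trans (≡.sym (norm-neg (x G.- y))) (≡.cong norm (⁻¹-anti-homo-// x y))
        where open import Algebra.Properties.Group G.+-group using (⁻¹-anti-homo-//)

    σ δ : ℚ
    -- The value that `radius` prescribes for the gap e/2, which is what remains of e after passing
    -- from q to t².
    δ = eighth (half e)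
    σ = 1ℚ ℚ.- δ

    0<δ : 0ℚ ℚ.< δ
    0<δ = 0<eighth {half e} (0<half {e} 0<e)

    σ+δ≡1 : σ ℚ.+ δ ≡ 1ℚ
    σ+δ≡1 = solve 1 (λ d → (con 1ℚ :- d) :+ d := con 1ℚ) ≡.refl δ
      where open ℚ-Solver

    half-e≤1 : half e ℚ.≤ 1ℚ
    half-e≤1 = ℚ.≤-trans (half≤ e (ℚ.<⇒≤ 0<e)) e≤1

    0≤σ : 0ℚ ℚ.≤ σ
    0≤σ = proj₁ (radius (half e) (0<half {e} 0<e) half-e≤1)

    -- Half of the gap e in |q|² < 1 absorbs the difference between the entries of q and t².
    t²-small : Eventually (λ i → sq (at i t G.* at i t) ℚ.≤ 1ℚ ℚ.- half e)
    t²-small =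
      -- The constant 5 of `sq-perturb`.
      let D = 1ℚ ℚ.+ ((1ℚ ℚ.+ 1ℚ) ℚ.+ (1ℚ ℚ.+ 1ℚ))
          η , 0<η , Dη≤ = share D (half e) (ℚ.nonNegative⁻¹ D) (0<half {e} 0<e)
      in eventually-map (λ i → bound D η Dη≤ (ℚ.nonNegative⁻¹ D) ≡.refl (at i q) (at i t G.* at i t))
           (eventually-× q-small (eventually-× (near 1ℚ (ℚ.positive⁻¹ 1ℚ)) (near η 0<η)))
      where
      bound : ∀ D η → D ℚ.* η ℚ.≤ half e → 0ℚ ℚ.≤ D → D ≡ 1ℚ ℚ.+ ((1ℚ ℚ.+ 1ℚ) ℚ.+ (1ℚ ℚ.+ 1ℚ)) → ∀ u v →
        sq u ℚ.+ e ℚ.≤ 1ℚ × norm (v G.- u) ℚ.≤ 1ℚ × norm (v G.- u) ℚ.≤ η → sq v ℚ.≤ 1ℚ ℚ.- half e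
      bound D η Dη≤ 0≤D D≡ u v (u≤ , near₁ , near-η) = begin
        sq v  ≤⟨ sq-perturb u v (ℚ.≤-trans (≤-gap e (ℚ.<⇒≤ 0<e) ≡.refl) u≤) near₁ ⟩
        sq u ℚ.+ norm (v G.- u) ℚ.* (1ℚ ℚ.+ ((1ℚ ℚ.+ 1ℚ) ℚ.+ (1ℚ ℚ.+ 1ℚ)))
          ≡⟨ ≡.cong (λ d → sq u ℚ.+ norm (v G.- u) ℚ.* d) (≡.sym D≡) ⟩
        sq u ℚ.+ norm (v G.- u) ℚ.* D
          ≤⟨ ℚ.+-monoʳ-≤ (sq u) (ℚ.≤-trans (*-monoʳ 0≤D near-η) (ℚ.≤-trans (ℚ.≤-reflexive (ℚ.*-comm η D)) Dη≤)) ⟩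
        sq u ℚ.+ half e  ≡⟨ solve 2 (λ s e → let h = con ½ :* e in s :+ h := (s :+ e) :- h) ≡.refl (sq u) e ⟩
        (sq u ℚ.+ e) ℚ.- half e  ≤⟨ ℚ.+-monoˡ-≤ (ℚ.- half e) u≤ ⟩
        1ℚ ℚ.- half e ∎
        where open ℚ-Solver

    t-small : Eventually (λ i → Small σ δ 0≤σ 0<δ σ+δ≡1 (at i t))
    t-small = eventually-map (λ i → small (at i t)) t²-small
      where
      small : ∀ z → sq (z G.* z) ℚ.≤ 1ℚ ℚ.- half e → ∀ w → norm (z G.^ w) ℚ.≤ (σ ℚ.* σ) ^ w ℚ.+ (σ ℚ.* σ) ^ w
      small z sq≤ w = norm-^ z (σ ℚ.* σ) w (0≤* 0≤σ 0≤σ)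
        (proj₂ (radius (half e) (0<half {e} 0<e) half-e≤1) z (ℚ.≤-trans (ℚ.≤-reflexive (≡.sym (sq-* z z))) sq≤))

    both-bounded : Eventually (λ i → Bounded (at i q) × Bounded (at i t G.* at i t))
    both-bounded = eventually-map (λ i (q≤ , t²≤) →
        bounded (at i q) (ℚ.≤-trans (≤-gap e (ℚ.<⇒≤ 0<e) ≡.refl) q≤)
      , bounded (at i t G.* at i t) (ℚ.≤-trans t²≤ (≤-gap (half e) (ℚ.<⇒≤ (0<half {e} 0<e)) (minus-plus (half e)))))
      (eventually-× q-small t²-small)
      where
      open ℚ-Solver
      minus-plus : ∀ h → 1ℚ ≡ (1ℚ ℚ.- h) ℚ.+ h
      minus-plus = solve 1 (λ h → con 1ℚ := (con 1ℚ :- h) :+ h) ≡.refl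

open import Defs

theorem1p1 : (q q^½ : ℂ) → q^½ ^ 2 ≈ q → 0<∣ q ∣ → ∣ q ∣< 1ᴿ →
    ∃ λ (A : ℂ) → ∃ λ (B : ℂ) →
    HasSum (λ (n : ℕ) →
    q^½ ^ (2 ℕ.* n ℕ.^ 2 ℕ.+ n) * (1# + q^½ ^ (2 ℕ.* n ℕ.+ 1))
    * (Σ[ symRange n ] λ j → q^½ ^ (∣ j ∣ ℕ.^ 2))) A
    × HasSum (λ (n : ℕ) →
    (- 1#) ^ n * q^½ ^ (2 ℕ.* n ℕ.^ 2 ℕ.+ n) * (1# - q^½ ^ (2 ℕ.* n ℕ.+ 1))
    * (Σ[ symRange n ] λ j → (- 1#) ^ ∣ j ∣ * q^½ ^ (∣ j ∣ ℕ.^ 2))) B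
    × HasSum (λ ((m , n , j) : ℕ × ℕ × ℕ) →
    (- 1#) ^ j * (P m j n · q ^ n))
    (½ᶜ * A + ½ᶜ * B)
theorem1p1 q q^½ sq≈ _ (_ , e , 0<e , q-small) = r
  where
  open GaussianEntries
  module E = Estimates q q^½ sq≈ e 0<e q-small
  -- The gap `e` between |q|² and 1 determines the rate σ; the ½ of the statement enters through its
  -- entries (½ , 0).
  r = Values.generatingFunctions E.σ E.δ E.0≤σ E.0<δ E.σ+δ≡1 minusOne-value one-value
      (½ , 0ℚ) half-value ≡.refl half-bounded
    q q^½ E.t-small E.both-bounded E.q≈t²
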